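{- Let $q$ be prime. Let $c,k,M$ be positive integers with $c<M<q$. Let $A(X)\in\mathbb{F}_q[X]$ be a nonzero polynomial with $\deg(A)<cq$ and $\mathsf{pdeg}(A)<k$. Then $$\left|\{\alpha\in\mathbb{F}_q:\mathsf{mult}(A,\alpha)\ge M\}\right|\le\min\left(\frac{c}{M-c+1}\cdot k+c,\ k\right).$$
   Context: For $A(X)\in\mathbb{F}_q[X]$, the Hasse derivatives $A^{[\ell]}$ are defined by $A(X+Z)=\sum_{\ell\ge0}A^{[\ell]}(X)Z^\ell$. The pseudoderivative is $A_{\langle\ell\rangle}(X)=A^{[\ell]}(X)\bmod (X^q-X)$, and the pseudodegree is $\mathsf{pdeg}(A)=\max_{\ell\ge0}\deg(A_{\langle\ell\rangle})$. For nonzero $A$ and $\alpha\in\mathbb{F}_q$, $\mathsf{mult}(A,\alpha)$ is the largest $r$ such that $(X-\alpha)^r$ divides $A(X)$. -}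

module Defs where

open import Data.Nat using (ℕ; zero; suc; _+_; _*_; _∸_; _≤_; NonZero)
open import Data.Nat.DivMod using (_mod_)
open import Data.Nat.Combinatorics using (_C_)
open import Data.Fin using (Fin; toℕ)
open import Data.List using (List; []; _∷_; map; upTo; length)
open import Data.Product using (Σ; ∃; _×_)
open import Relation.Binary.PropositionalEquality using (_≡_; _≢_)
open import Relation.Nullary using (¬_)

-- Everything below is parametrised by the characteristic q (a nonzero
-- natural; the theorem additionally assumes q prime, so Fin q with
-- arithmetic mod q is the field F_q).
module _ (q : ℕ) .{{_ : NonZero q}} where

  𝔽 : Set
  𝔽 = Fin q

  0F 1F : 𝔽
  0F = 0 mod q
  1F = 1 mod q

  _+F_ _*F_ : 𝔽 → 𝔽 → 𝔽
  a +F b = (toℕ a + toℕ b) mod q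
  a *F b = (toℕ a * toℕ b) mod q

  -F_ : 𝔽 → 𝔽
  -F a = (q ∸ toℕ a) mod q

  -- Polynomials in F_q[X]: coefficient lists, lowest degree first
  -- (trailing zeros allowed; polynomials are compared coefficientwise).
  Poly : Set
  Poly = List 𝔽

  coeff : Poly → ℕ → 𝔽
  coeff []      _       = 0F
  coeff (a ∷ _) zero    = a
  coeff (_ ∷ A) (suc n) = coeff A n

  _≈P_ : Poly → Poly → Set
  A ≈P B = ∀ n → coeff A n ≡ coeff B n

  addP : Poly → Poly → Poly
  addP []      B       = B
  addP A@(_ ∷ _) []    = A
  addP (a ∷ A) (b ∷ B) = (a +F b) ∷ addP A B

  negP : Poly → Poly
  negP = map -F_

  subP : Poly → Poly → Poly
  subP A B = addP A (negP B)

  scaleP : 𝔽 → Poly → Poly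
  scaleP a = map (a *F_)

  mulP : Poly → Poly → Poly
  mulP []      B = []
  mulP (a ∷ A) B = addP (scaleP a B) (0F ∷ mulP A B)

  powP : Poly → ℕ → Poly
  powP A zero    = 1F ∷ []
  powP A (suc n) = mulP A (powP A n)

  Xp : Poly
  Xp = 0F ∷ 1F ∷ []

  X-_ : 𝔽 → Poly
  X- α = (-F α) ∷ 1F ∷ []

  _∣P_ : Poly → Poly → Set
  D ∣P A = ∃ λ B → mulP D B ≈P A

  NonZeroP : Poly → Set
  NonZeroP A = ∃ λ n → coeff A n ≢ 0F

  -- deg A < d  (every coefficient of index ≥ d vanishes; deg 0 = -∞)
  DegLt : Poly → ℕ → Set
  DegLt A d = ∀ n → d ≤ n → coeff A n ≡ 0F

  -- Hasse derivative: A(X+Z) = Σ_ℓ A^[ℓ](X) Z^ℓ, i.e.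
  -- A^[ℓ](X) = Σ_i binom(i,ℓ) a_i X^(i-ℓ); coefficient j is binom(j+ℓ,ℓ) a_(j+ℓ)
  hasse : ℕ → Poly → Poly
  hasse ℓ A = map (λ j → (((j + ℓ) C ℓ) mod q) *F coeff A (j + ℓ))
                  (upTo (length A ∸ ℓ))

  XqX : Poly
  XqX = subP (powP Xp q) Xp

  IsRemModXqX : Poly → Poly → Set
  IsRemModXqX A R = DegLt R q × (XqX ∣P subP A R)

  -- pdeg A < k : every pseudoderivative A_⟨ℓ⟩ = A^[ℓ] mod (X^q - X) has degree < k
  PdegLt : Poly → ℕ → Set
  PdegLt A k = ∀ ℓ R → IsRemModXqX (hasse ℓ A) R → DegLt R k

  IsMult : Poly → 𝔽 → ℕ → Set
  IsMult A α r = (powP (X- α) r ∣P A) × ¬ (powP (X- α) (suc r) ∣P A)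

  MultGe : Poly → 𝔽 → ℕ → Set
  MultGe A α M = ∃ λ r → IsMult A α r × M ≤ r

{-# OPTIONS --safe #-}

-- Let Λ = X^q − X, which has derivative −1 and vanishes on F_q, and write A = Σ_{j<c} Λ^j C_j with deg C_j < q.
-- Modulo Λ, the derivatives of A of order < c are triangular in the C_j, so pdeg A < k forces deg C_j < k.  At a
-- zero α of order M one may replace Λ by α − X, which also has derivative −1 and vanishes at α: the polynomial
-- Σ C_j (α − X)^j = Σ α^i B_i still vanishes to order M at α, and deg B_i < k + c − 1.  Gaussian elimination turns
-- it into Σ p_m(α) E_m with r ≤ c terms, deg p_m < c and distinct degrees deg E_m.  In place of a Wronskian, a
-- differential operator L of order < r that kills all E_m but one, E, is found by counting coefficients.  L E is
-- nonzero, because no nonzero operator of order < r kills r polynomials of distinct degrees < q; it vanishes to order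
-- M − r + 1 at every zero α outside the fewer than c roots of the corresponding p_m, and it has degree at most c k.
-- If k + c − 1 > q, then comparing M · |S| with deg A < c q is enough, and if k ≤ c then |S| < k is enough.
module Submission where

import Defs
open import Data.Nat.Base using (ℕ; NonZero)
open import Data.Nat.Primality using (Prime)

-- The obstacle is degree: the digits C_j are small, but in powers of Λ they form a polynomial of
-- degree up to c q, too large for zeros of order about M - c to give the fraction c k / (M - c +
-- 1). Replacing Λ removes q from the degree, at the price of a polynomial that depends on the zero
-- α. Only c powers of α occur, so separating α from the variable leaves a tensor with at most c
-- terms. Isolating one of them takes an operator of order at most c - 1; that loss is the origin of
-- M - c + 1, and the roots of the isolated weight account for the summand c. Operators are written
-- in θ = X d/dX, which is diagonal on monomials. Their action on leading terms is read off at the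
-- numbers deg E_m, which stay distinct in F_q because k + c - 1 ≤ q in this case. If ρ polynomials
-- are to be killed, the coefficients below X^ρ are treated for all of them at once by ρ (ρ + 1) / 2
-- conditions on the operator alone. This saving, together with the distinctness of the degrees,
-- brings the degree of L E down to c k.

module HighMultiplicityZeros (q : ℕ) .{{_ : NonZero q}} (q-prime : Prime q) where
  open import Algebra.Bundles using (CommutativeRing)
  import Algebra.Solver.Ring
  open import Algebra.Solver.Ring.AlmostCommutativeRing using (fromCommutativeRing; _-Raw-AlmostCommutative⟶_)
  open import Data.Fin.Base using (Fin; zero; suc; toℕ; finToFun; funToFin; combine)
  open import Data.Fin.Properties using (toℕ-fromℕ<; toℕ-injective; toℕ<n; _≟_; pigeonhole; funToFin-finToFin; finToFun-funToFin; <⇒≢)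
  open import Data.Integer.Base as ℤ using (ℤ; -[1+_]) renaming (+_ to pos)
  import Data.Integer.Properties as ℤ
  open import Data.List.Base using (List; []; _∷_; _++_; length; map; tabulate; lookup; applyUpTo; filter; allFin)
  open import Data.List.Properties using (length-map; length-tabulate; length-applyUpTo; length-++; map-applyUpTo; ∷-injective)
  open import Data.List.Relation.Binary.Permutation.Propositional using (_↭_; refl; prep; swap; ↭⇒↭ₛ) renaming (trans to ↭-step)
  open import Data.List.Relation.Binary.Permutation.Propositional.Properties using (↭-length; All-resp-↭) renaming (map⁺ to ↭-map⁺)
  import Data.List.Relation.Binary.Permutation.Setoid.Properties as Permutation
  open import Data.List.Relation.Unary.All as All using (All; []; _∷_)
  import Data.List.Relation.Unary.All.Properties as All
  open import Data.List.Relation.Unary.AllPairs using ([]; _∷_)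
  open import Data.List.Relation.Unary.Unique.Propositional using (Unique)
  import Data.List.Relation.Unary.Unique.Propositional.Properties as Unique
  open import Data.Maybe.Base using (Maybe; just; nothing)
  open import Data.Nat.Base as ℕ using (zero; suc; _+_; _*_; _∸_; _^_; _!; _<_; _≤_; z≤n; s≤s)
  open import Data.Nat.Combinatorics using (nCk+nC[k+1]≡[n+1]C[k+1]; k>n⇒nCk≡0; nC1≡n; nCn≡1; nCk≡nC[n∸k]) renaming (_C_ to _choose_)
  open import Data.Nat.Coprimality using (coprime-Bézout; prime⇒coprime)
  open import Data.Nat.DivMod using (_%_; _mod_; m%n<n; %-distribˡ-+; %-distribˡ-*; m<n⇒m%n≡m; m*n%n≡0)
  open import Data.Nat.GCD using (module Bézout)
  open import Data.Nat.ListAction using (sum)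
  open import Data.Nat.ListAction.Properties using (sum-↭)
  open import Data.Nat.Primality using (prime⇒nonTrivial)
  import Data.Nat.Properties as ℕ
  open import Data.Nat.Tactic.RingSolver using (solve-∀)
  open import Data.Product.Base using (∃; ∃₂; _×_; _,_; proj₁; proj₂)
  open import Data.Sum.Base using (_⊎_; inj₁; inj₂)
  open import Function.Base using (_∘_; id)
  open import Relation.Binary.Bundles using (Setoid)
  open import Relation.Binary.Definitions using (tri<; tri≈; tri>)
  open import Relation.Binary.PropositionalEquality
  import Relation.Binary.Reasoning.Setoid as SetoidReasoning
  open import Relation.Nullary using (¬_; Dec; yes; no; contradiction; ¬?)

  -- The prime field F_q

  K : Set
  K = Defs.𝔽 q

  infixl 6 _⊕_
  infixl 7 _⊗_
  infix  8 ⊖_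

  opaque
    _⊕_ _⊗_ : K → K → K
    _⊕_ = Defs._+F_ q
    _⊗_ = Defs._*F_ q

    ⊖_ : K → K
    ⊖_ = Defs.-F_ q

  0ᴷ 1ᴷ : K
  0ᴷ = Defs.0F q
  1ᴷ = Defs.1F q

  emb : ℕ → K
  emb n = n mod q

  toℕ-emb : ∀ n → toℕ (emb n) ≡ n % q
  toℕ-emb n = toℕ-fromℕ< (m%n<n n q)

  emb-cong-% : ∀ {m n} → m % q ≡ n % q → emb m ≡ emb n
  emb-cong-% {m} {n} eq = toℕ-injective (trans (toℕ-emb m) (trans eq (sym (toℕ-emb n))))

  emb-toℕ : ∀ a → emb (toℕ a) ≡ a
  emb-toℕ a = toℕ-injective (trans (toℕ-emb (toℕ a)) (m<n⇒m%n≡m (toℕ<n a)))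

  opaque
    unfolding _⊕_

    emb-+ : ∀ m n → emb m ⊕ emb n ≡ emb (m + n)
    emb-+ m n = emb-cong-% (trans (cong₂ (λ a b → (a + b) % q) (toℕ-emb m) (toℕ-emb n)) (sym (%-distribˡ-+ m n q)))

    emb-* : ∀ m n → emb m ⊗ emb n ≡ emb (m * n)
    emb-* m n = emb-cong-% (trans (cong₂ (λ a b → (a * b) % q) (toℕ-emb m) (toℕ-emb n)) (sym (%-distribˡ-* m n q)))

  emb-q*ʳ : ∀ n → emb (n * q) ≡ 0ᴷ
  emb-q*ʳ n = emb-cong-% (trans (m*n%n≡0 n q) (sym (m<n⇒m%n≡m (ℕ.>-nonZero⁻¹ q))))

  emb-q : emb q ≡ 0ᴷ
  emb-q = trans (cong emb (sym (ℕ.*-identityˡ q))) (emb-q*ʳ 1)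

  emb-injective : ∀ {m n} → m < q → n < q → emb m ≡ emb n → m ≡ n
  emb-injective {m} {n} m<q n<q eq =
    trans (sym (m<n⇒m%n≡m m<q)) (trans (sym (toℕ-emb m)) (trans (cong toℕ eq) (trans (toℕ-emb n) (m<n⇒m%n≡m n<q))))

  emb-suc≢0 : ∀ {n} → suc n < q → emb (suc n) ≢ 0ᴷ
  emb-suc≢0 n<q eq with () ← emb-injective n<q (ℕ.>-nonZero⁻¹ q) eq

  -- Every element is the image of its representative, so `emb-+` and `emb-*` reduce a ring law in
  -- F_q to the same law for natural numbers.
  viaℕ : (P : K → Set) → (∀ n → P (emb n)) → ∀ a → P a
  viaℕ P p a = subst P (emb-toℕ a) (p (toℕ a))

  opaque
    unfolding _⊕_

    ⊕-comm : ∀ a b → a ⊕ b ≡ b ⊕ a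
    ⊕-comm a b = cong emb (ℕ.+-comm (toℕ a) (toℕ b))

    ⊗-comm : ∀ a b → a ⊗ b ≡ b ⊗ a
    ⊗-comm a b = cong emb (ℕ.*-comm (toℕ a) (toℕ b))

  ⊕-assoc : ∀ a b c → (a ⊕ b) ⊕ c ≡ a ⊕ (b ⊕ c)
  ⊕-assoc a b = viaℕ _ λ c → viaℕ (λ a → (a ⊕ b) ⊕ emb c ≡ a ⊕ (b ⊕ emb c)) (λ a → viaℕ (λ b → (emb a ⊕ b) ⊕ emb c ≡ emb a ⊕ (b ⊕ emb c))
    (λ b → trans (cong (_⊕ emb c) (emb-+ a b)) (trans (emb-+ (a + b) c) (trans (cong emb (ℕ.+-assoc a b c))
       (sym (trans (cong (emb a ⊕_) (emb-+ b c)) (emb-+ a (b + c))))))) b) a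

  ⊗-assoc : ∀ a b c → (a ⊗ b) ⊗ c ≡ a ⊗ (b ⊗ c)
  ⊗-assoc a b = viaℕ _ λ c → viaℕ (λ a → (a ⊗ b) ⊗ emb c ≡ a ⊗ (b ⊗ emb c)) (λ a → viaℕ (λ b → (emb a ⊗ b) ⊗ emb c ≡ emb a ⊗ (b ⊗ emb c))
    (λ b → trans (cong (_⊗ emb c) (emb-* a b)) (trans (emb-* (a * b) c) (trans (cong emb (ℕ.*-assoc a b c))
       (sym (trans (cong (emb a ⊗_) (emb-* b c)) (emb-* a (b * c))))))) b) a

  ⊗-distribˡ-⊕ : ∀ a b c → a ⊗ (b ⊕ c) ≡ a ⊗ b ⊕ a ⊗ c
  ⊗-distribˡ-⊕ a b = viaℕ _ λ c → viaℕ (λ a → a ⊗ (b ⊕ emb c) ≡ a ⊗ b ⊕ a ⊗ emb c) (λ a → viaℕ (λ b → emb a ⊗ (b ⊕ emb c) ≡ emb a ⊗ b ⊕ emb a ⊗ emb c)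
    (λ b → trans (cong (emb a ⊗_) (emb-+ b c)) (trans (emb-* a (b + c)) (trans (cong emb (ℕ.*-distribˡ-+ a b c))
       (sym (trans (cong₂ _⊕_ (emb-* a b) (emb-* a c)) (emb-+ (a * b) (a * c))))))) b) a

  ⊗-distribʳ-⊕ : ∀ a b c → (b ⊕ c) ⊗ a ≡ b ⊗ a ⊕ c ⊗ a
  ⊗-distribʳ-⊕ a b c = trans (⊗-comm (b ⊕ c) a) (trans (⊗-distribˡ-⊕ a b c) (cong₂ _⊕_ (⊗-comm a b) (⊗-comm a c)))

  ⊕-identityˡ : ∀ a → 0ᴷ ⊕ a ≡ a
  ⊕-identityˡ = viaℕ _ (emb-+ 0)

  ⊕-identityʳ : ∀ a → a ⊕ 0ᴷ ≡ a
  ⊕-identityʳ a = trans (⊕-comm a 0ᴷ) (⊕-identityˡ a)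

  ⊗-identityˡ : ∀ a → 1ᴷ ⊗ a ≡ a
  ⊗-identityˡ = viaℕ _ λ a → trans (emb-* 1 a) (cong emb (ℕ.*-identityˡ a))

  ⊗-identityʳ : ∀ a → a ⊗ 1ᴷ ≡ a
  ⊗-identityʳ a = trans (⊗-comm a 1ᴷ) (⊗-identityˡ a)

  opaque
    unfolding _⊕_

    ⊖-inverseʳ : ∀ a → a ⊕ ⊖ a ≡ 0ᴷ
    ⊖-inverseʳ a = begin
      a ⊕ ⊖ a                         ≡⟨ cong (_⊕ ⊖ a) (emb-toℕ a) ⟨
      emb (toℕ a) ⊕ emb (q ∸ toℕ a)   ≡⟨ emb-+ (toℕ a) (q ∸ toℕ a) ⟩
      emb (toℕ a + (q ∸ toℕ a))       ≡⟨ cong emb (ℕ.m+[n∸m]≡n (ℕ.<⇒≤ (toℕ<n a))) ⟩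
      emb q                           ≡⟨ emb-q ⟩
      0ᴷ ∎
      where open ≡-Reasoning

  ⊖-inverseˡ : ∀ a → ⊖ a ⊕ a ≡ 0ᴷ
  ⊖-inverseˡ a = trans (⊕-comm (⊖ a) a) (⊖-inverseʳ a)

  K-ring : CommutativeRing _ _
  K-ring = record
    { Carrier = K ; _≈_ = _≡_ ; _+_ = _⊕_ ; _*_ = _⊗_ ; -_ = ⊖_ ; 0# = 0ᴷ ; 1# = 1ᴷ
    ; isCommutativeRing = record
      { isRing = record
        { +-isAbelianGroup = record
          { isGroup = record
            { isMonoid = record
              { isSemigroup = record
                { isMagma = record { isEquivalence = isEquivalence ; ∙-cong = cong₂ _⊕_ }
                ; assoc = ⊕-assoc }
              ; identity = ⊕-identityˡ , ⊕-identityʳ }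
            ; inverse = ⊖-inverseˡ , ⊖-inverseʳ
            ; ⁻¹-cong = cong ⊖_ }
          ; comm = ⊕-comm }
        ; *-cong = cong₂ _⊗_
        ; *-assoc = ⊗-assoc
        ; *-identity = ⊗-identityˡ , ⊗-identityʳ
        ; distrib = ⊗-distribˡ-⊕ , ⊗-distribʳ-⊕ }
      ; *-comm = ⊗-comm } }

  open import Algebra.Properties.Ring (CommutativeRing.ring K-ring) public using ()
    renaming (-‿distribˡ-* to ⊖-distribˡ-⊗; -‿distribʳ-* to ⊖-distribʳ-⊗; -‿involutive to ⊖-involutive; -‿+-comm to ⊖-⊕-comm; -0#≈0# to ⊖-0)
  open CommutativeRing K-ring public using () renaming (zeroˡ to ⊗-zeroˡ; zeroʳ to ⊗-zeroʳ)

  -- Integers as coefficients of the ring solver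

  embℤ : ℤ → K
  embℤ (pos n)    = emb n
  embℤ -[1+ n ] = ⊖ emb (suc n)

  embℤ-⊖ : ∀ m n → embℤ (m ℤ.⊖ n) ≡ emb m ⊕ ⊖ emb n
  embℤ-⊖ m       zero    = sym (trans (cong (emb m ⊕_) ⊖-0) (⊕-identityʳ _))
  embℤ-⊖ zero    (suc n) = sym (⊕-identityˡ _)
  embℤ-⊖ (suc m) (suc n) = begin
    embℤ (suc m ℤ.⊖ suc n)                       ≡⟨ cong embℤ (ℤ.[1+m]⊖[1+n]≡m⊖n m n) ⟩
    embℤ (m ℤ.⊖ n)                               ≡⟨ embℤ-⊖ m n ⟩
    emb m ⊕ ⊖ emb n                              ≡⟨ cong (_⊕ ⊖ emb n) (trans (⊕-assoc _ _ _) (trans (cong (emb m ⊕_) (⊖-inverseʳ 1ᴷ)) (⊕-identityʳ _))) ⟨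
    ((emb m ⊕ 1ᴷ) ⊕ ⊖ 1ᴷ) ⊕ ⊖ emb n              ≡⟨ ⊕-assoc _ _ _ ⟩
    (emb m ⊕ 1ᴷ) ⊕ (⊖ 1ᴷ ⊕ ⊖ emb n)              ≡⟨ cong₂ _⊕_ (trans (⊕-comm _ _) (emb-+ 1 m)) (trans (⊖-⊕-comm _ _) (cong ⊖_ (emb-+ 1 n))) ⟩
    emb (suc m) ⊕ ⊖ emb (suc n) ∎
    where open ≡-Reasoning

  embℤ-+ : ∀ i j → embℤ (i ℤ.+ j) ≡ embℤ i ⊕ embℤ j
  embℤ-+ (pos m)    (pos n)    = sym (emb-+ m n)
  embℤ-+ (pos m)    -[1+ n ] = embℤ-⊖ m (suc n)
  embℤ-+ -[1+ m ] (pos n)    = trans (embℤ-⊖ n (suc m)) (⊕-comm _ _)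
  embℤ-+ -[1+ m ] -[1+ n ] =
    sym (trans (⊖-⊕-comm _ _) (cong ⊖_ (trans (emb-+ (suc m) (suc n)) (cong (λ k → emb (suc k)) (ℕ.+-suc m n)))))

  embℤ-neg : ∀ i → embℤ (ℤ.- i) ≡ ⊖ embℤ i
  embℤ-neg (pos zero)   = sym ⊖-0
  embℤ-neg (pos (suc n))  = refl
  embℤ-neg -[1+ n ]   = sym (⊖-involutive _)

  embℤ-*⁺ : ∀ m j → embℤ (pos m ℤ.* j) ≡ emb m ⊗ embℤ j
  embℤ-*⁺ m (pos n)    = trans (cong embℤ (sym (ℤ.pos-* m n))) (sym (emb-* m n))
  embℤ-*⁺ m -[1+ n ] = begin
    embℤ (pos m ℤ.* -[1+ n ])         ≡⟨ cong embℤ (ℤ.neg-distribʳ-* (pos m) (pos (suc n))) ⟨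
    embℤ (ℤ.- (pos m ℤ.* pos (suc n)))    ≡⟨ embℤ-neg (pos m ℤ.* pos (suc n)) ⟩
    ⊖ embℤ (pos m ℤ.* pos (suc n))        ≡⟨ cong ⊖_ (embℤ-*⁺ m (pos (suc n))) ⟩
    ⊖ (emb m ⊗ emb (suc n))         ≡⟨ ⊖-distribʳ-⊗ _ _ ⟩
    emb m ⊗ ⊖ emb (suc n) ∎
    where open ≡-Reasoning

  embℤ-* : ∀ i j → embℤ (i ℤ.* j) ≡ embℤ i ⊗ embℤ j
  embℤ-* (pos m)    j = embℤ-*⁺ m j
  embℤ-* -[1+ m ] j = begin
    embℤ (-[1+ m ] ℤ.* j)           ≡⟨ cong embℤ (ℤ.neg-distribˡ-* (pos (suc m)) j) ⟨
    embℤ (ℤ.- (pos (suc m) ℤ.* j))      ≡⟨ embℤ-neg (pos (suc m) ℤ.* j) ⟩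
    ⊖ embℤ (pos (suc m) ℤ.* j)          ≡⟨ cong ⊖_ (embℤ-*⁺ (suc m) j) ⟩
    ⊖ (emb (suc m) ⊗ embℤ j)        ≡⟨ ⊖-distribˡ-⊗ _ _ ⟩
    ⊖ emb (suc m) ⊗ embℤ j ∎
    where open ≡-Reasoning

  embℤ-homomorphism : ℤ.+-*-rawRing -Raw-AlmostCommutative⟶ fromCommutativeRing K-ring
  embℤ-homomorphism = record
    { ⟦_⟧ = embℤ ; +-homo = embℤ-+ ; *-homo = embℤ-* ; -‿homo = embℤ-neg ; 0-homo = refl ; 1-homo = refl }

  embℤ-≟ : ∀ i j → Maybe (embℤ i ≡ embℤ j)
  embℤ-≟ i j with i ℤ.≟ j
  ... | yes i≡j = just (cong embℤ i≡j)
  ... | no  _   = nothing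

  open Algebra.Solver.Ring ℤ.+-*-rawRing (fromCommutativeRing K-ring) embℤ-homomorphism embℤ-≟ public
    using (solve; _:=_; _:+_; _:*_; _:-_; :-_; con)

  -- Inverses in F_q

  emb-inverse : ∀ n → suc n < q → ∃ λ b → b ⊗ emb (suc n) ≡ 1ᴷ
  emb-inverse n n<q with coprime-Bézout (prime⇒coprime {n = suc n} q-prime n<q)
  -- Here 1 + y (n + 1) = x q, so -y is the inverse; in the other case the signs are reversed and y
  -- itself serves.
  ... | Bézout.+- x y e = ⊖ emb y , (begin
      ⊖ emb y ⊗ emb (suc n)               ≡⟨ solve 2 (λ y a → :- y :* a := con (pos 1) :- (con (pos 1) :+ y :* a)) refl (emb y) (emb (suc n)) ⟩
      1ᴷ ⊕ ⊖ (1ᴷ ⊕ emb y ⊗ emb (suc n))   ≡⟨ cong (λ z → 1ᴷ ⊕ ⊖ z) (trans (cong (1ᴷ ⊕_) (emb-* y (suc n))) (trans (emb-+ 1 (y * suc n)) (trans (cong emb e) (emb-q*ʳ x)))) ⟩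
      1ᴷ ⊕ ⊖ 0ᴷ                           ≡⟨ trans (cong (1ᴷ ⊕_) ⊖-0) (⊕-identityʳ 1ᴷ) ⟩
      1ᴷ ∎)
    where open ≡-Reasoning
  ... | Bézout.-+ x y e = emb y , (begin
      emb y ⊗ emb (suc n)       ≡⟨ trans (emb-* y (suc n)) (trans (cong emb (sym e)) (sym (emb-+ 1 (x * q)))) ⟩
      1ᴷ ⊕ emb (x * q)          ≡⟨ trans (cong (1ᴷ ⊕_) (emb-q*ʳ x)) (⊕-identityʳ 1ᴷ) ⟩
      1ᴷ ∎)
    where open ≡-Reasoning

  inverse : ∀ a → a ≢ 0ᴷ → ∃ λ b → b ⊗ a ≡ 1ᴷ
  inverse a a≢0 = go (toℕ a) (toℕ<n a) (emb-toℕ a)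
    where
    go : ∀ n → n < q → emb n ≡ a → ∃ λ b → b ⊗ a ≡ 1ᴷ
    go zero    _   n≡a = contradiction (sym n≡a) a≢0
    go (suc n) n<q n≡a = subst (λ z → ∃ λ b → b ⊗ z ≡ 1ᴷ) n≡a (emb-inverse n n<q)

  ⊗-cancelˡ-0 : ∀ {a b} → a ≢ 0ᴷ → a ⊗ b ≡ 0ᴷ → b ≡ 0ᴷ
  ⊗-cancelˡ-0 {a} {b} a≢0 ab≡0 with c , ca≡1 ← inverse a a≢0 = begin
    b              ≡⟨ ⊗-identityˡ b ⟨
    1ᴷ ⊗ b         ≡⟨ cong (_⊗ b) ca≡1 ⟨
    (c ⊗ a) ⊗ b    ≡⟨ ⊗-assoc c a b ⟩
    c ⊗ (a ⊗ b)    ≡⟨ cong (c ⊗_) ab≡0 ⟩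
    c ⊗ 0ᴷ         ≡⟨ ⊗-zeroʳ c ⟩
    0ᴷ ∎
    where open ≡-Reasoning

  -- Polynomials as coefficient lists

  Poly : Set
  Poly = Defs.Poly q

  coeff : Poly → ℕ → K
  coeff = Defs.coeff q

  infix 4 _≈_
  record _≈_ (A B : Poly) : Set where
    constructor coeffwise
    field at : ∀ n → coeff A n ≡ coeff B n
  open _≈_ public

  ≈-refl : ∀ {A} → A ≈ A
  ≈-refl = coeffwise λ _ → refl

  ≈-sym : ∀ {A B} → A ≈ B → B ≈ A
  ≈-sym e = coeffwise λ n → sym (at e n)

  ≈-trans : ∀ {A B C} → A ≈ B → B ≈ C → A ≈ C
  ≈-trans e f = coeffwise λ n → trans (at e n) (at f n)

  ≈-reflexive : ∀ {A B} → A ≡ B → A ≈ B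
  ≈-reflexive refl = ≈-refl

  Poly-setoid : Setoid _ _
  Poly-setoid = record
    { Carrier = Poly ; _≈_ = _≈_ ; isEquivalence = record { refl = ≈-refl ; sym = ≈-sym ; trans = ≈-trans } }

  module ≈-Reasoning = SetoidReasoning Poly-setoid

  DegLt : Poly → ℕ → Set
  DegLt = Defs.DegLt q

  infixl 6 _+ₚ_ _-ₚ_
  infixr 7 _∙_
  infixr 8 X·_
  infixl 7 _*ₚ_

  opaque
    unfolding _⊕_

    _+ₚ_ _-ₚ_ : Poly → Poly → Poly
    _+ₚ_ = Defs.addP q
    _-ₚ_ = Defs.subP q

    _∙_ : K → Poly → Poly
    _∙_ = Defs.scaleP q

  _*ₚ_ : Poly → Poly → Poly
  _*ₚ_ = Defs.mulP q

  X·_ : Poly → Poly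
  X· A = 0ᴷ ∷ A

  opaque
    unfolding _+ₚ_

    coeff-+ : ∀ A B n → coeff (A +ₚ B) n ≡ coeff A n ⊕ coeff B n
    coeff-+ []      B       n       = sym (⊕-identityˡ _)
    coeff-+ (a ∷ A) []      n       = sym (⊕-identityʳ _)
    coeff-+ (a ∷ A) (b ∷ B) zero    = refl
    coeff-+ (a ∷ A) (b ∷ B) (suc n) = coeff-+ A B n

    coeff-neg : ∀ A n → coeff (Defs.negP q A) n ≡ ⊖ coeff A n
    coeff-neg []      n       = sym ⊖-0
    coeff-neg (a ∷ A) zero    = refl
    coeff-neg (a ∷ A) (suc n) = coeff-neg A n

    coeff-- : ∀ A B n → coeff (A -ₚ B) n ≡ coeff A n ⊕ ⊖ coeff B n
    coeff-- A B n = trans (coeff-+ A _ n) (cong (coeff A n ⊕_) (coeff-neg B n))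

    coeff-∙ : ∀ s A n → coeff (s ∙ A) n ≡ s ⊗ coeff A n
    coeff-∙ s []      n       = sym (⊗-zeroʳ s)
    coeff-∙ s (a ∷ A) zero    = refl
    coeff-∙ s (a ∷ A) (suc n) = coeff-∙ s A n

    *ₚ-∷ : ∀ a A B → (a ∷ A) *ₚ B ≡ a ∙ B +ₚ X· (A *ₚ B)
    *ₚ-∷ a A B = refl

  +ₚ-cong : ∀ {A A′ B B′} → A ≈ A′ → B ≈ B′ → A +ₚ B ≈ A′ +ₚ B′
  +ₚ-cong {A} {A′} {B} {B′} e f = coeffwise λ n →
    trans (coeff-+ A B n) (trans (cong₂ _⊕_ (at e n) (at f n)) (sym (coeff-+ A′ B′ n)))

  -ₚ-cong : ∀ {A A′ B B′} → A ≈ A′ → B ≈ B′ → A -ₚ B ≈ A′ -ₚ B′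
  -ₚ-cong {A} {A′} {B} {B′} e f = coeffwise λ n →
    trans (coeff-- A B n) (trans (cong₂ (λ a b → a ⊕ ⊖ b) (at e n) (at f n)) (sym (coeff-- A′ B′ n)))

  ∙-cong : ∀ {A B} s → A ≈ B → s ∙ A ≈ s ∙ B
  ∙-cong {A} {B} s e = coeffwise λ n → trans (coeff-∙ s A n) (trans (cong (s ⊗_) (at e n)) (sym (coeff-∙ s B n)))

  X·-cong : ∀ {A B} → A ≈ B → X· A ≈ X· B
  X·-cong e = coeffwise λ { zero → refl ; (suc n) → at e n }

  X·-+ : ∀ A B → X· (A +ₚ B) ≈ X· A +ₚ X· B
  X·-+ A B = coeffwise λ { zero → sym (trans (coeff-+ (X· A) (X· B) 0) (⊕-identityˡ _))
                         ; (suc n) → trans (coeff-+ A B n) (sym (coeff-+ (X· A) (X· B) (suc n))) }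

  X·-- : ∀ A B → X· (A -ₚ B) ≈ X· A -ₚ X· B
  X·-- A B = coeffwise λ { zero → sym (trans (coeff-- (X· A) (X· B) 0) (⊖-inverseʳ _))
                         ; (suc n) → trans (coeff-- A B n) (sym (coeff-- (X· A) (X· B) (suc n))) }

  X·-∙ : ∀ s A → X· (s ∙ A) ≈ s ∙ X· A
  X·-∙ s A = coeffwise λ { zero → sym (trans (coeff-∙ s (X· A) 0) (⊗-zeroʳ s))
                         ; (suc n) → trans (coeff-∙ s A n) (sym (coeff-∙ s (X· A) (suc n))) }

  +ₚ-identityʳ : ∀ A → A +ₚ [] ≈ A
  +ₚ-identityʳ A = coeffwise λ n → trans (coeff-+ A [] n) (⊕-identityʳ _)

  +ₚ-assoc : ∀ A B C → (A +ₚ B) +ₚ C ≈ A +ₚ (B +ₚ C)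
  +ₚ-assoc A B C = coeffwise λ n → begin
    coeff (A +ₚ B +ₚ C) n                  ≡⟨ trans (coeff-+ (A +ₚ B) C n) (cong (_⊕ coeff C n) (coeff-+ A B n)) ⟩
    (coeff A n ⊕ coeff B n) ⊕ coeff C n    ≡⟨ ⊕-assoc _ _ _ ⟩
    coeff A n ⊕ (coeff B n ⊕ coeff C n)    ≡⟨ trans (coeff-+ A (B +ₚ C) n) (cong (coeff A n ⊕_) (coeff-+ B C n)) ⟨
    coeff (A +ₚ (B +ₚ C)) n ∎
    where open ≡-Reasoning

  +ₚ-comm : ∀ A B → A +ₚ B ≈ B +ₚ A
  +ₚ-comm A B = coeffwise λ n → trans (coeff-+ A B n) (trans (⊕-comm _ _) (sym (coeff-+ B A n)))

  ∙-distribˡ : ∀ s A B → s ∙ (A +ₚ B) ≈ s ∙ A +ₚ s ∙ B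
  ∙-distribˡ s A B = coeffwise λ n → begin
    coeff (s ∙ (A +ₚ B)) n           ≡⟨ trans (coeff-∙ s (A +ₚ B) n) (cong (s ⊗_) (coeff-+ A B n)) ⟩
    s ⊗ (coeff A n ⊕ coeff B n)      ≡⟨ ⊗-distribˡ-⊕ _ _ _ ⟩
    s ⊗ coeff A n ⊕ s ⊗ coeff B n    ≡⟨ trans (coeff-+ (s ∙ A) (s ∙ B) n) (cong₂ _⊕_ (coeff-∙ s A n) (coeff-∙ s B n)) ⟨
    coeff (s ∙ A +ₚ s ∙ B) n ∎
    where open ≡-Reasoning

  ∙-assoc : ∀ s t A → (s ⊗ t) ∙ A ≈ s ∙ t ∙ A
  ∙-assoc s t A = coeffwise λ n →
    trans (coeff-∙ (s ⊗ t) A n) (trans (⊗-assoc _ _ _) (sym (trans (coeff-∙ s (t ∙ A) n) (cong (s ⊗_) (coeff-∙ t A n)))))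

  ∙-identity : ∀ A → 1ᴷ ∙ A ≈ A
  ∙-identity A = coeffwise λ n → trans (coeff-∙ 1ᴷ A n) (⊗-identityˡ _)

  -- Degree bounds

  DegLt-cong : ∀ {A B d} → A ≈ B → DegLt A d → DegLt B d
  DegLt-cong e h n d≤n = trans (sym (at e n)) (h n d≤n)

  DegLt-mono : ∀ {A d e} → d ≤ e → DegLt A d → DegLt A e
  DegLt-mono d≤e h n e≤n = h n (ℕ.≤-trans d≤e e≤n)

  DegLt-[] : ∀ {d} → DegLt [] d
  DegLt-[] n _ = refl

  DegLt0⇒≈[] : ∀ {A} → DegLt A 0 → A ≈ []
  DegLt0⇒≈[] h = coeffwise λ n → h n z≤n

  ≈[]⇒DegLt : ∀ {A d} → A ≈ [] → DegLt A d
  ≈[]⇒DegLt e n _ = at e n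

  DegLt-+ : ∀ {A B d} → DegLt A d → DegLt B d → DegLt (A +ₚ B) d
  DegLt-+ {A} {B} h k n d≤n = trans (coeff-+ A B n) (trans (cong₂ _⊕_ (h n d≤n) (k n d≤n)) (⊕-identityˡ _))

  DegLt-- : ∀ {A B d} → DegLt A d → DegLt B d → DegLt (A -ₚ B) d
  DegLt-- {A} {B} h k n d≤n = trans (coeff-- A B n) (trans (cong₂ (λ a b → a ⊕ ⊖ b) (h n d≤n) (k n d≤n)) (⊖-inverseʳ _))

  DegLt-∙ : ∀ {A d} s → DegLt A d → DegLt (s ∙ A) d
  DegLt-∙ {A} s h n d≤n = trans (coeff-∙ s A n) (trans (cong (s ⊗_) (h n d≤n)) (⊗-zeroʳ s))

  DegLt-∷ : ∀ {a A d} → DegLt A d → DegLt (a ∷ A) (suc d)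
  DegLt-∷ h (suc n) (s≤s d≤n) = h n d≤n

  DegLt-∷⁻ : ∀ {a A d} → DegLt (a ∷ A) (suc d) → DegLt A d
  DegLt-∷⁻ h n d≤n = h (suc n) (s≤s d≤n)

  DegLt-length : ∀ A → DegLt A (length A)
  DegLt-length []      = DegLt-[]
  DegLt-length (a ∷ A) = DegLt-∷ (DegLt-length A)

  -- Evaluation

  ev : K → Poly → K
  ev α []      = 0ᴷ
  ev α (a ∷ A) = a ⊕ α ⊗ ev α A

  ev-[] : ∀ {α A} → A ≈ [] → ev α A ≡ 0ᴷ
  ev-[] {α} {[]}    e = refl
  ev-[] {α} {a ∷ A} e = trans (cong₂ (λ x y → x ⊕ α ⊗ y) (at e 0) (ev-[] {A = A} (coeffwise λ n → at e (suc n))))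
                          (trans (⊕-identityˡ _) (⊗-zeroʳ α))

  opaque
    unfolding _+ₚ_

    ev-+ : ∀ α A B → ev α (A +ₚ B) ≡ ev α A ⊕ ev α B
    ev-+ α []      B       = sym (⊕-identityˡ _)
    ev-+ α (a ∷ A) []      = sym (⊕-identityʳ _)
    ev-+ α (a ∷ A) (b ∷ B) = trans (cong (λ z → (a ⊕ b) ⊕ α ⊗ z) (ev-+ α A B))
      (solve 5 (λ a b x u v → (a :+ b) :+ x :* (u :+ v) := (a :+ x :* u) :+ (b :+ x :* v)) refl a b α (ev α A) (ev α B))

    ev-∙ : ∀ α s A → ev α (s ∙ A) ≡ s ⊗ ev α A
    ev-∙ α s []      = sym (⊗-zeroʳ s)
    ev-∙ α s (a ∷ A) = trans (cong (λ z → s ⊗ a ⊕ α ⊗ z) (ev-∙ α s A))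
      (solve 4 (λ s a x u → s :* a :+ x :* (s :* u) := s :* (a :+ x :* u)) refl s a α (ev α A))

  ev-X· : ∀ α A → ev α (X· A) ≡ α ⊗ ev α A
  ev-X· α A = ⊕-identityˡ _

  -- Equal polynomials may be lists of different lengths, so there is no common recursion; linearity
  -- reduces the claim to the difference, a list of zeros.
  ev-cong : ∀ {α A B} → A ≈ B → ev α A ≡ ev α B
  ev-cong {α} {A} {B} e = begin
    ev α A                       ≡⟨ ⊕-identityʳ _ ⟨
    ev α A ⊕ 0ᴷ                  ≡⟨ cong (ev α A ⊕_) (ev-[] {A = B +ₚ ⊖ 1ᴷ ∙ A} (coeffwise cancel)) ⟨
    ev α A ⊕ ev α (B +ₚ ⊖ 1ᴷ ∙ A)   ≡⟨ cong (ev α A ⊕_) (trans (ev-+ α B _) (cong (ev α B ⊕_) (ev-∙ α (⊖ 1ᴷ) A))) ⟩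
    ev α A ⊕ (ev α B ⊕ ⊖ 1ᴷ ⊗ ev α A)   ≡⟨ solve 2 (λ a b → a :+ (b :+ :- con (pos 1) :* a) := b) refl (ev α A) (ev α B) ⟩
    ev α B ∎
    where
    open ≡-Reasoning
    cancel : ∀ n → coeff (B +ₚ ⊖ 1ᴷ ∙ A) n ≡ 0ᴷ
    cancel n = trans (coeff-+ B _ n) (trans (cong₂ _⊕_ (sym (at e n)) (coeff-∙ _ A n))
      (solve 1 (λ a → a :+ :- con (pos 1) :* a := con (pos 0)) refl (coeff A n)))

  -ₚ≈ : ∀ A B → A -ₚ B ≈ A +ₚ ⊖ 1ᴷ ∙ B
  -ₚ≈ A B = coeffwise λ n → trans (coeff-- A B n) (sym (trans (coeff-+ A (⊖ 1ᴷ ∙ B) n) (cong (coeff A n ⊕_) (trans (coeff-∙ _ B n)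
    (solve 1 (λ a → :- con (pos 1) :* a := :- a) refl (coeff B n))))))

  ev-- : ∀ α A B → ev α (A -ₚ B) ≡ ev α A ⊕ ⊖ ev α B
  ev-- α A B = trans (ev-cong (-ₚ≈ A B)) (trans (ev-+ α A _) (cong (ev α A ⊕_) (trans (ev-∙ α _ B)
    (solve 1 (λ a → :- con (pos 1) :* a := :- a) refl (ev α B)))))

  -- Derivatives

  ∂ : Poly → Poly
  ∂ []      = []
  ∂ (a ∷ A) = A +ₚ X· ∂ A

  coeff-∂ : ∀ A n → coeff (∂ A) n ≡ emb (suc n) ⊗ coeff A (suc n)
  coeff-∂ []      n       = sym (⊗-zeroʳ _)
  coeff-∂ (a ∷ A) zero    = trans (coeff-+ A (X· ∂ A) 0) (trans (⊕-identityʳ _) (sym (⊗-identityˡ _)))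
  coeff-∂ (a ∷ A) (suc n) = begin
    coeff (A +ₚ X· ∂ A) (suc n)                               ≡⟨ trans (coeff-+ A (X· ∂ A) (suc n)) (cong (coeff A (suc n) ⊕_) (coeff-∂ A n)) ⟩
    coeff A (suc n) ⊕ emb (suc n) ⊗ coeff A (suc n)           ≡⟨ solve 2 (λ a e → a :+ e :* a := (con (pos 1) :+ e) :* a) refl (coeff A (suc n)) (emb (suc n)) ⟩
    (1ᴷ ⊕ emb (suc n)) ⊗ coeff A (suc n)                      ≡⟨ cong (_⊗ coeff A (suc n)) (emb-+ 1 (suc n)) ⟩
    emb (suc (suc n)) ⊗ coeff A (suc n) ∎
    where open ≡-Reasoning

  ∂-cong : ∀ {A B} → A ≈ B → ∂ A ≈ ∂ B
  ∂-cong {A} {B} e = coeffwise λ n → trans (coeff-∂ A n) (trans (cong (emb (suc n) ⊗_) (at e (suc n))) (sym (coeff-∂ B n)))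

  ∂-+ : ∀ A B → ∂ (A +ₚ B) ≈ ∂ A +ₚ ∂ B
  ∂-+ A B = coeffwise λ n → begin
    coeff (∂ (A +ₚ B)) n                                     ≡⟨ trans (coeff-∂ (A +ₚ B) n) (cong (emb (suc n) ⊗_) (coeff-+ A B (suc n))) ⟩
    emb (suc n) ⊗ (coeff A (suc n) ⊕ coeff B (suc n))        ≡⟨ ⊗-distribˡ-⊕ _ _ _ ⟩
    emb (suc n) ⊗ coeff A (suc n) ⊕ emb (suc n) ⊗ coeff B (suc n) ≡⟨ trans (coeff-+ (∂ A) (∂ B) n) (cong₂ _⊕_ (coeff-∂ A n) (coeff-∂ B n)) ⟨
    coeff (∂ A +ₚ ∂ B) n ∎
    where open ≡-Reasoning

  ∂-∙ : ∀ s A → ∂ (s ∙ A) ≈ s ∙ ∂ A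
  ∂-∙ s A = coeffwise λ n → begin
    coeff (∂ (s ∙ A)) n                     ≡⟨ trans (coeff-∂ (s ∙ A) n) (cong (emb (suc n) ⊗_) (coeff-∙ s A (suc n))) ⟩
    emb (suc n) ⊗ (s ⊗ coeff A (suc n))     ≡⟨ solve 3 (λ e s a → e :* (s :* a) := s :* (e :* a)) refl _ _ _ ⟩
    s ⊗ (emb (suc n) ⊗ coeff A (suc n))     ≡⟨ trans (coeff-∙ s (∂ A) n) (cong (s ⊗_) (coeff-∂ A n)) ⟨
    coeff (s ∙ ∂ A) n ∎
    where open ≡-Reasoning

  ∂-- : ∀ A B → ∂ (A -ₚ B) ≈ ∂ A -ₚ ∂ B
  ∂-- A B = begin
    ∂ (A -ₚ B)               ≈⟨ ∂-cong (-ₚ≈ A B) ⟩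
    ∂ (A +ₚ ⊖ 1ᴷ ∙ B)        ≈⟨ ∂-+ A _ ⟩
    ∂ A +ₚ ∂ (⊖ 1ᴷ ∙ B)      ≈⟨ +ₚ-cong ≈-refl (∂-∙ _ B) ⟩
    ∂ A +ₚ ⊖ 1ᴷ ∙ ∂ B        ≈⟨ -ₚ≈ (∂ A) (∂ B) ⟨
    ∂ A -ₚ ∂ B ∎
    where open ≈-Reasoning

  ∂-DegLt-suc : ∀ {A d} → DegLt A (suc d) → DegLt (∂ A) d
  ∂-DegLt-suc {A} h n d≤n = trans (coeff-∂ A n) (trans (cong (emb (suc n) ⊗_) (h (suc n) (s≤s d≤n))) (⊗-zeroʳ _))

  ∂-DegLt : ∀ {A d} → DegLt A d → DegLt (∂ A) d
  ∂-DegLt {A} h = ∂-DegLt-suc {A} (DegLt-mono {A} (ℕ.n≤1+n _) h)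

  -- Vanish N α A: A vanishes at α to order N, tested on ordinary derivatives; this is multiplicity ≥ N only for N ≤ q.
  data Vanish (α : K) : ℕ → Poly → Set where
    zero : ∀ {A} → Vanish α zero A
    suc  : ∀ {N A} → ev α A ≡ 0ᴷ → Vanish α N (∂ A) → Vanish α (suc N) A

  Vanish-cong : ∀ {α N A B} → A ≈ B → Vanish α N A → Vanish α N B
  Vanish-cong e zero      = zero
  Vanish-cong e (suc r v) = suc (trans (sym (ev-cong e)) r) (Vanish-cong (∂-cong e) v)

  Vanish-+ : ∀ {α N A B} → Vanish α N A → Vanish α N B → Vanish α N (A +ₚ B)
  Vanish-+ zero zero = zero
  Vanish-+ {α} {A = A} {B} (suc r v) (suc s w) =
    suc (trans (ev-+ α A B) (trans (cong₂ _⊕_ r s) (⊕-identityˡ _)))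
        (Vanish-cong (≈-sym (∂-+ A B)) (Vanish-+ v w))

  Vanish-∙ : ∀ {α N A} s → Vanish α N A → Vanish α N (s ∙ A)
  Vanish-∙ s zero = zero
  Vanish-∙ {α} {A = A} s (suc r v) =
    suc (trans (ev-∙ α s A) (trans (cong (s ⊗_) r) (⊗-zeroʳ s)))
        (Vanish-cong (≈-sym (∂-∙ s A)) (Vanish-∙ s v))

  Vanish-- : ∀ {α N A B} → Vanish α N A → Vanish α N B → Vanish α N (A -ₚ B)
  Vanish-- {A = A} {B} v w = Vanish-cong (≈-sym (-ₚ≈ A B)) (Vanish-+ v (Vanish-∙ _ w))

  Vanish-[] : ∀ {α} N → Vanish α N []
  Vanish-[] zero    = zero
  Vanish-[] (suc N) = suc refl (Vanish-[] N)

  Vanish-≤ : ∀ {α N M A} → N ≤ M → Vanish α M A → Vanish α N A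
  Vanish-≤ z≤n       v         = zero
  Vanish-≤ (s≤s N≤M) (suc r v) = suc r (Vanish-≤ N≤M v)

  Vanish-pred : ∀ {α N A} → Vanish α (suc N) A → Vanish α N A
  Vanish-pred = Vanish-≤ (ℕ.n≤1+n _)

  Vanish-X· : ∀ {α N A} → Vanish α N A → Vanish α N (X· A)
  Vanish-X· zero = zero
  Vanish-X· {α} {A = A} v@(suc r w) =
    suc (trans (ev-X· α A) (trans (cong (α ⊗_) r) (⊗-zeroʳ α))) (Vanish-+ (Vanish-pred v) (Vanish-X· w))

  -- Multiplication by X − α

  lin : K → Poly → Poly
  lin α G = X· G -ₚ α ∙ G

  lin-cong : ∀ {α A B} → A ≈ B → lin α A ≈ lin α B
  lin-cong e = -ₚ-cong (X·-cong e) (∙-cong _ e)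

  ev-lin : ∀ α β G → ev β (lin α G) ≡ (β ⊕ ⊖ α) ⊗ ev β G
  ev-lin α β G = trans (ev-- β (X· G) (α ∙ G)) (trans (cong₂ (λ x y → x ⊕ ⊖ y) (ev-X· β G) (ev-∙ β α G))
    (solve 3 (λ a b g → b :* g :- a :* g := (b :- a) :* g) refl α β (ev β G)))

  ev-lin-root : ∀ α G → ev α (lin α G) ≡ 0ᴷ
  ev-lin-root α G = trans (ev-lin α α G) (trans (cong (_⊗ ev α G) (⊖-inverseʳ α)) (⊗-zeroˡ _))

  ∂-lin : ∀ α G → ∂ (lin α G) ≈ G +ₚ lin α (∂ G)
  ∂-lin α G = begin
    ∂ (X· G -ₚ α ∙ G)                ≈⟨ ∂-- (X· G) (α ∙ G) ⟩
    (G +ₚ X· ∂ G) -ₚ ∂ (α ∙ G)       ≈⟨ -ₚ-cong ≈-refl (∂-∙ α G) ⟩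
    (G +ₚ X· ∂ G) -ₚ α ∙ ∂ G         ≈⟨ -ₚ≈ _ _ ⟩
    (G +ₚ X· ∂ G) +ₚ _               ≈⟨ +ₚ-assoc _ _ _ ⟩
    G +ₚ (X· ∂ G +ₚ _)               ≈⟨ +ₚ-cong ≈-refl (-ₚ≈ _ _) ⟨
    G +ₚ lin α (∂ G) ∎
    where open ≈-Reasoning

  Vanish-lin : ∀ {α N G} → Vanish α N G → Vanish α (suc N) (lin α G)
  Vanish-lin {α} {G = G} zero        = suc (ev-lin-root α G) zero
  Vanish-lin {α} {G = G} v@(suc r w) =
    suc (ev-lin-root α G) (Vanish-cong (≈-sym (∂-lin α G)) (Vanish-+ v (Vanish-lin w)))

  -- The general m makes the induction go through: m + 1 counts the derivatives taken so far.
  Vanish-lin⁻-aux : ∀ {α N G} m → m + N < q → Vanish α N (emb (suc m) ∙ G +ₚ lin α (∂ G)) → Vanish α N G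
  Vanish-lin⁻-aux m m+N<q zero = zero
  Vanish-lin⁻-aux {α} {suc N} {G} m m+N<q (suc r v) = suc
    (⊗-cancelˡ-0 (emb-suc≢0 (ℕ.≤-<-trans (ℕ.≤-trans (s≤s (ℕ.m≤m+n m N)) (ℕ.≤-reflexive (sym (ℕ.+-suc m N)))) m+N<q)) (begin
      emb (suc m) ⊗ ev α G                                 ≡⟨ ⊕-identityʳ _ ⟨
      emb (suc m) ⊗ ev α G ⊕ 0ᴷ                            ≡⟨ trans (ev-+ α (emb (suc m) ∙ G) (lin α (∂ G))) (cong₂ _⊕_ (ev-∙ α (emb (suc m)) G) (ev-lin-root α (∂ G))) ⟨
      ev α (emb (suc m) ∙ G +ₚ lin α (∂ G))                ≡⟨ r ⟩
      0ᴷ ∎))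
    (Vanish-lin⁻-aux (suc m) (subst (_< q) (ℕ.+-suc m N) m+N<q) (Vanish-cong ∂-eq v))
    where
    open ≡-Reasoning
    ∂-eq : ∂ (emb (suc m) ∙ G +ₚ lin α (∂ G)) ≈ emb (suc (suc m)) ∙ ∂ G +ₚ lin α (∂ (∂ G))
    ∂-eq = ≈-trans (∂-+ (emb (suc m) ∙ G) (lin α (∂ G))) (≈-trans (+ₚ-cong (∂-∙ (emb (suc m)) G) (∂-lin α (∂ G)))
      (≈-trans (≈-sym (+ₚ-assoc _ _ _)) (+ₚ-cong (coeffwise λ n →
        trans (coeff-+ (emb (suc m) ∙ ∂ G) (∂ G) n) (trans (cong (_⊕ coeff (∂ G) n) (coeff-∙ (emb (suc m)) (∂ G) n))
          (trans (solve 2 (λ e g → e :* g :+ g := (con (pos 1) :+ e) :* g) refl (emb (suc m)) (coeff (∂ G) n))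
            (trans (cong (_⊗ coeff (∂ G) n) (emb-+ 1 (suc m))) (sym (coeff-∙ (emb (suc (suc m))) (∂ G) n)))))) ≈-refl)))

  -- At α the derivative of order m + 1 of (X - α) G is m + 1 times the derivative of order m of G.
  -- The factors that occur are 1, ..., N, invertible because N < q.
  Vanish-lin⁻ : ∀ {α N G} → N < q → Vanish α (suc N) (lin α G) → Vanish α N G
  Vanish-lin⁻ {α} {G = G} N<q (suc r v) =
    Vanish-lin⁻-aux 0 N<q (Vanish-cong (≈-trans (∂-lin α G) (+ₚ-cong (≈-sym (∙-identity G)) ≈-refl)) v)

  x-y≡0⇒x≡y : ∀ x y → x ⊕ ⊖ y ≡ 0ᴷ → x ≡ y
  x-y≡0⇒x≡y x y e = trans (solve 2 (λ x y → x := (x :- y) :+ y) refl x y) (trans (cong (_⊕ y) e) (⊕-identityˡ y))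

  -- The derivative of (X - α) G is G + (X - α) G′. By induction G already vanishes to the order one
  -- lower, so subtracting it leaves the same claim for G′ at that lower order; the value of G
  -- itself is obtained by dividing by β - α.
  Vanish-lin⁻-≢ : ∀ {α β} N {G} → β ≢ α → Vanish β N (lin α G) → Vanish β N G
  Vanish-lin⁻-≢ zero β≢α v = zero
  Vanish-lin⁻-≢ {α} {β} (suc N) {G} β≢α v@(suc r w) = suc
    (⊗-cancelˡ-0 (λ e → β≢α (x-y≡0⇒x≡y β α e)) (trans (sym (ev-lin α β G)) r))
    (Vanish-lin⁻-≢ N β≢α (Vanish-cong cancel (Vanish-- (Vanish-cong (∂-lin α G) w) (Vanish-lin⁻-≢ N β≢α (Vanish-pred v)))))
    where
    cancel : (G +ₚ lin α (∂ G)) -ₚ G ≈ lin α (∂ G)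
    cancel = coeffwise λ n → trans (coeff-- (G +ₚ lin α (∂ G)) G n) (trans (cong (_⊕ ⊖ coeff G n) (coeff-+ G (lin α (∂ G)) n))
      (solve 2 (λ g h → (g :+ h) :- g := h) refl (coeff G n) (coeff (lin α (∂ G)) n)))

  -- Division by X − α

  -- Synthetic division: the coefficients of the quotient are the Horner values at α of the
  -- successive tails of the list, and the remainder is `ev α A`.
  quo : K → Poly → Poly
  quo α []      = []
  quo α (a ∷ A) = ev α A ∷ quo α A

  coeff-quo : ∀ α A n → coeff A n ≡ coeff (ev α A ∷ quo α A) n ⊕ ⊖ (α ⊗ coeff (quo α A) n)
  coeff-quo α []      zero    = solve 1 (λ x → con (pos 0) := con (pos 0) :- x :* con (pos 0)) refl α
  coeff-quo α []      (suc n) = solve 1 (λ x → con (pos 0) := con (pos 0) :- x :* con (pos 0)) refl α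
  coeff-quo α (a ∷ A) zero    = solve 3 (λ a x u → a := (a :+ x :* u) :- x :* u) refl a α (ev α A)
  coeff-quo α (a ∷ A) (suc n) = coeff-quo α A n

  lin-quo : ∀ {α A} → ev α A ≡ 0ᴷ → A ≈ lin α (quo α A)
  lin-quo {α} {A} r = coeffwise λ n → trans (coeff-quo α A n)
    (sym (trans (coeff-- (X· quo α A) (α ∙ quo α A) n) (cong₂ (λ x y → coeff (x ∷ quo α A) n ⊕ ⊖ y) (sym r) (coeff-∙ α (quo α A) n))))

  quo-[] : ∀ {α} A → A ≈ [] → quo α A ≈ []
  quo-[]     []      e = ≈-refl
  quo-[] {α} (a ∷ A) e = coeffwise λ { zero → ev-[] A≈[] ; (suc n) → at (quo-[] A A≈[]) n }
    where
    A≈[] : A ≈ []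
    A≈[] = coeffwise λ n → at e (suc n)

  DegLt-quo : ∀ {α d} A → DegLt A d → DegLt (quo α A) (d ∸ 1)
  DegLt-quo         {d = zero}        A       h = ≈[]⇒DegLt (quo-[] A (DegLt0⇒≈[] h))
  DegLt-quo                           []      h = DegLt-[]
  DegLt-quo {α}     {d = suc zero}    (a ∷ A) h = λ { zero _ → ev-[] A≈[] ; (suc n) _ → at (quo-[] A A≈[]) n }
    where
    A≈[] : A ≈ []
    A≈[] = DegLt0⇒≈[] (DegLt-∷⁻ {A = A} h)
  DegLt-quo {α} {d = suc (suc d)} (a ∷ A) h = DegLt-∷ {A = quo α A} (DegLt-quo A (DegLt-∷⁻ {A = A} h))

  -- What is left of A after N divisions by X - α, with the properties that let the division
  -- continue at another point. If d < N, the truncated difference says that the cofactor is zero,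
  -- and `nonzero` passes this on to A.
  record Factor (α : K) (N d : ℕ) (A : Poly) : Set where
    field
      cofactor  : Poly
      degree    : DegLt cofactor (d ∸ N)
      vanishing : ∀ {β n} → β ≢ α → Vanish β n A → Vanish β n cofactor
      nonzero   : cofactor ≈ [] → A ≈ []

  factor : ∀ {α d} N A → N ≤ q → DegLt A d → Vanish α N A → Factor α N d A
  factor zero    A N≤q h v = record { cofactor = A ; degree = h ; vanishing = λ _ w → w ; nonzero = λ e → e }
  factor {α} {d} (suc N) A N<q h v@(suc r _) = record
    { cofactor  = cofactor
    ; degree    = subst (DegLt cofactor) (ℕ.∸-+-assoc d 1 N) degree
    ; vanishing = λ β≢α w → vanishing β≢α (Vanish-lin⁻-≢ _ β≢α (Vanish-cong (lin-quo r) w))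
    ; nonzero   = λ e → ≈-trans (lin-quo r) (≈-trans (lin-cong (nonzero e)) lin-[])
    }
    where
    open Factor (factor N (quo α A) (ℕ.<⇒≤ N<q) (DegLt-quo A h) (Vanish-lin⁻ N<q (Vanish-cong (lin-quo r) v)))
    lin-[] : lin α [] ≈ []
    lin-[] = DegLt0⇒≈[] (DegLt-- {X· []} {α ∙ []} (λ { zero _ → refl ; (suc n) _ → refl }) (DegLt-∙ {[]} α DegLt-[]))

  -- Each listed point lowers the degree bound by N, and distinctness keeps the order N at the
  -- points still to come. N ≤ q because `factor` inverts the numbers produced by differentiation.
  tooManyZeros : ∀ {N d} xs A → N ≤ q → Unique xs → All (λ α → Vanish α N A) xs → DegLt A d → d ≤ length xs * N → A ≈ []
  tooManyZeros []       A N≤q _ _ h d≤0 = DegLt0⇒≈[] (DegLt-mono {A} d≤0 h)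
  tooManyZeros {N} {d} (α ∷ xs) A N≤q (α∉xs ∷ u) (v ∷ vs) h d≤ =
    nonzero (tooManyZeros xs cofactor N≤q u (rest α∉xs vs) degree d∸N≤)
    where
    open Factor (factor N A N≤q h v)
    rest : ∀ {ys} → All (α ≢_) ys → All (λ β → Vanish β N A) ys → All (λ β → Vanish β N cofactor) ys
    rest []         []       = []
    rest (α≢β ∷ ps) (w ∷ ws) = vanishing (λ β≡α → α≢β (sym β≡α)) w ∷ rest ps ws
    d∸N≤ : d ∸ N ≤ length xs * N
    d∸N≤ = ℕ.m≤n+o⇒m∸n≤o d N d≤

  tooManyRoots : ∀ {d} xs A → Unique xs → All (λ α → ev α A ≡ 0ᴷ) xs → DegLt A d → d ≤ length xs → A ≈ []
  tooManyRoots {d} xs A u roots h d≤ = tooManyZeros xs A (ℕ.>-nonZero⁻¹ q) u (All.map (λ r → suc r zero) roots) h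
    (subst (d ≤_) (sym (ℕ.*-identityʳ (length xs))) d≤)

  -- Products

  opaque
    unfolding _+ₚ_

    *ₚ-distribʳ : ∀ A B C → (A +ₚ B) *ₚ C ≈ A *ₚ C +ₚ B *ₚ C
    *ₚ-distribʳ []      B       C = ≈-refl
    *ₚ-distribʳ (a ∷ A) []      C = ≈-sym (+ₚ-identityʳ _)
    *ₚ-distribʳ (a ∷ A) (b ∷ B) C = coeffwise λ n → begin
      coeff ((a ⊕ b) ∙ C +ₚ X· ((A +ₚ B) *ₚ C)) n
        ≡⟨ trans (coeff-+ ((a ⊕ b) ∙ C) _ n) (cong₂ _⊕_ (coeff-∙ (a ⊕ b) C n) (at (≈-trans (X·-cong (*ₚ-distribʳ A B C)) (X·-+ (A *ₚ C) (B *ₚ C))) n)) ⟩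
      (a ⊕ b) ⊗ coeff C n ⊕ coeff (X· (A *ₚ C) +ₚ X· (B *ₚ C)) n
        ≡⟨ cong ((a ⊕ b) ⊗ coeff C n ⊕_) (coeff-+ (X· (A *ₚ C)) (X· (B *ₚ C)) n) ⟩
      (a ⊕ b) ⊗ coeff C n ⊕ (coeff (X· (A *ₚ C)) n ⊕ coeff (X· (B *ₚ C)) n)
        ≡⟨ solve 5 (λ a b c u v → (a :+ b) :* c :+ (u :+ v) := (a :* c :+ u) :+ (b :* c :+ v)) refl a b (coeff C n) _ _ ⟩
      (a ⊗ coeff C n ⊕ coeff (X· (A *ₚ C)) n) ⊕ (b ⊗ coeff C n ⊕ coeff (X· (B *ₚ C)) n)
        ≡⟨ trans (coeff-+ (a ∙ C +ₚ X· (A *ₚ C)) _ n) (cong₂ _⊕_ (expand a A) (expand b B)) ⟨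
      coeff ((a ∙ C +ₚ X· (A *ₚ C)) +ₚ (b ∙ C +ₚ X· (B *ₚ C))) n ∎
      where
      open ≡-Reasoning
      expand : ∀ {n} a A → coeff (a ∙ C +ₚ X· (A *ₚ C)) n ≡ a ⊗ coeff C n ⊕ coeff (X· (A *ₚ C)) n
      expand {n} a A = trans (coeff-+ (a ∙ C) _ n) (cong (_⊕ _) (coeff-∙ a C n))

    ∙-*ₚ : ∀ s A B → (s ∙ A) *ₚ B ≈ s ∙ (A *ₚ B)
    ∙-*ₚ s []      B = ≈-refl
    ∙-*ₚ s (a ∷ A) B = begin
      (s ⊗ a) ∙ B +ₚ X· ((s ∙ A) *ₚ B)     ≈⟨ +ₚ-cong (∙-assoc s a B) (≈-trans (X·-cong (∙-*ₚ s A B)) (X·-∙ s (A *ₚ B))) ⟩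
      s ∙ a ∙ B +ₚ s ∙ X· (A *ₚ B)         ≈⟨ ∙-distribˡ s (a ∙ B) (X· (A *ₚ B)) ⟨
      s ∙ (a ∙ B +ₚ X· (A *ₚ B)) ∎
      where open ≈-Reasoning

    -ₚ-*ₚ : ∀ A B C → (A -ₚ B) *ₚ C ≈ A *ₚ C -ₚ B *ₚ C
    -ₚ-*ₚ A B C = begin
      (A -ₚ B) *ₚ C                              ≈⟨ *ₚ-distribʳ A (Defs.negP q B) C ⟩
      A *ₚ C +ₚ Defs.negP q B *ₚ C               ≈⟨ +ₚ-cong ≈-refl (neg-*ₚ B) ⟩
      A *ₚ C +ₚ ⊖ 1ᴷ ∙ (B *ₚ C)                  ≈⟨ -ₚ≈ (A *ₚ C) (B *ₚ C) ⟨
      A *ₚ C -ₚ B *ₚ C ∎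
      where
      open ≈-Reasoning
      neg-*ₚ : ∀ B → Defs.negP q B *ₚ C ≈ ⊖ 1ᴷ ∙ (B *ₚ C)
      neg-*ₚ []      = ≈-refl
      neg-*ₚ (b ∷ B) = begin
        (⊖ b) ∙ C +ₚ X· (Defs.negP q B *ₚ C)   ≈⟨ +ₚ-cong (coeffwise λ n → trans (coeff-∙ (⊖ b) C n) (trans (solve 2 (λ b c → :- b :* c := :- con (pos 1) :* (b :* c)) refl b (coeff C n)) (sym (trans (coeff-∙ (⊖ 1ᴷ) (b ∙ C) n) (cong (⊖ 1ᴷ ⊗_) (coeff-∙ b C n)))))) (≈-trans (X·-cong (neg-*ₚ B)) (X·-∙ (⊖ 1ᴷ) (B *ₚ C))) ⟩
        ⊖ 1ᴷ ∙ b ∙ C +ₚ ⊖ 1ᴷ ∙ X· (B *ₚ C)     ≈⟨ ∙-distribˡ (⊖ 1ᴷ) (b ∙ C) (X· (B *ₚ C)) ⟨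
        ⊖ 1ᴷ ∙ (b ∙ C +ₚ X· (B *ₚ C)) ∎

  ∙-0 : ∀ A → 0ᴷ ∙ A ≈ []
  ∙-0 A = coeffwise λ n → trans (coeff-∙ 0ᴷ A n) (⊗-zeroˡ _)

  X·-[] : X· [] ≈ []
  X·-[] = coeffwise λ { zero → refl ; (suc n) → refl }

  X·-*ₚ : ∀ A B → (X· A) *ₚ B ≈ X· (A *ₚ B)
  X·-*ₚ A B = ≈-trans (≈-reflexive (*ₚ-∷ 0ᴷ A B)) (≈-trans (+ₚ-cong (∙-0 B) ≈-refl) (coeffwise λ n → trans (coeff-+ [] (X· (A *ₚ B)) n) (⊕-identityˡ _)))

  *ₚ-identityˡ : ∀ B → (1ᴷ ∷ []) *ₚ B ≈ B
  *ₚ-identityˡ B = begin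
    (1ᴷ ∷ []) *ₚ B             ≡⟨ *ₚ-∷ 1ᴷ [] B ⟩
    1ᴷ ∙ B +ₚ X· []            ≈⟨ +ₚ-cong (∙-identity B) X·-[] ⟩
    B +ₚ []                    ≈⟨ +ₚ-identityʳ B ⟩
    B ∎
    where open ≈-Reasoning

  *ₚ-assoc : ∀ A B C → (A *ₚ B) *ₚ C ≈ A *ₚ (B *ₚ C)
  *ₚ-assoc []      B C = ≈-refl
  *ₚ-assoc (a ∷ A) B C = begin
    ((a ∷ A) *ₚ B) *ₚ C                        ≡⟨ cong (_*ₚ C) (*ₚ-∷ a A B) ⟩
    (a ∙ B +ₚ X· (A *ₚ B)) *ₚ C                ≈⟨ *ₚ-distribʳ (a ∙ B) (X· (A *ₚ B)) C ⟩
    (a ∙ B) *ₚ C +ₚ (X· (A *ₚ B)) *ₚ C         ≈⟨ +ₚ-cong (∙-*ₚ a B C) (≈-trans (X·-*ₚ (A *ₚ B) C) (X·-cong (*ₚ-assoc A B C))) ⟩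
    a ∙ (B *ₚ C) +ₚ X· (A *ₚ (B *ₚ C))         ≡⟨ *ₚ-∷ a A (B *ₚ C) ⟨
    (a ∷ A) *ₚ (B *ₚ C) ∎
    where open ≈-Reasoning

  X-α : K → Poly
  X-α = Defs.X-_ q

  opaque
    unfolding ⊖_

    X-α-∷ : ∀ α → X-α α ≡ ⊖ α ∷ 1ᴷ ∷ []
    X-α-∷ α = refl

  X-α-*ₚ : ∀ α B → X-α α *ₚ B ≈ lin α B
  X-α-*ₚ α B = begin
    X-α α *ₚ B                               ≡⟨ cong (_*ₚ B) (X-α-∷ α) ⟩
    (⊖ α ∷ 1ᴷ ∷ []) *ₚ B                     ≡⟨ *ₚ-∷ (⊖ α) (1ᴷ ∷ []) B ⟩
    (⊖ α) ∙ B +ₚ X· ((1ᴷ ∷ []) *ₚ B)         ≈⟨ +ₚ-cong ≈-refl (X·-cong (*ₚ-identityˡ B)) ⟩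
    (⊖ α) ∙ B +ₚ X· B                        ≈⟨ coeffwise (λ n → trans (coeff-+ ((⊖ α) ∙ B) (X· B) n) (trans (cong (_⊕ coeff (X· B) n) (coeff-∙ (⊖ α) B n))
                                                  (trans (solve 3 (λ a b x → :- a :* b :+ x := x :- a :* b) refl α (coeff B n) (coeff (X· B) n))
                                                    (sym (trans (coeff-- (X· B) (α ∙ B) n) (cong (λ z → coeff (X· B) n ⊕ ⊖ z) (coeff-∙ α B n))))))) ⟩
    lin α B ∎
    where open ≈-Reasoning

  powₚ : Poly → ℕ → Poly
  powₚ = Defs.powP q

  Vanish-power : ∀ α r B → Vanish α r (powₚ (X-α α) r *ₚ B)
  Vanish-power α zero    B = zero
  Vanish-power α (suc r) B =
    Vanish-cong (≈-sym (≈-trans (*ₚ-assoc (X-α α) (powₚ (X-α α) r) B) (X-α-*ₚ α _))) (Vanish-lin (Vanish-power α r B))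

  MultGe⇒Vanish : ∀ {A α M} → Defs.MultGe q A α M → Vanish α M A
  MultGe⇒Vanish {α = α} (r , ((B , e) , _) , M≤r) = Vanish-≤ M≤r (Vanish-cong (coeffwise e) (Vanish-power α r B))

  -- The polynomial X^q − X and Fermat's little theorem

  shift : ℕ → Poly → Poly
  shift zero    A = A
  shift (suc n) A = X· shift n A

  shift-cong : ∀ n {A B} → A ≈ B → shift n A ≈ shift n B
  shift-cong zero    e = e
  shift-cong (suc n) e = X·-cong (shift-cong n e)

  shift-X· : ∀ n A → shift n (X· A) ≡ X· shift n A
  shift-X· zero    A = refl
  shift-X· (suc n) A = cong X·_ (shift-X· n A)

  shift-+ : ∀ n A B → shift n (A +ₚ B) ≈ shift n A +ₚ shift n B
  shift-+ zero    A B = ≈-refl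
  shift-+ (suc n) A B = ≈-trans (X·-cong (shift-+ n A B)) (X·-+ _ _)

  shift-∙ : ∀ n s A → shift n (s ∙ A) ≈ s ∙ shift n A
  shift-∙ zero    s A = ≈-refl
  shift-∙ (suc n) s A = ≈-trans (X·-cong (shift-∙ n s A)) (X·-∙ s _)

  coeff-shift-< : ∀ {n m} A → m < n → coeff (shift n A) m ≡ 0ᴷ
  coeff-shift-< {suc n} {zero}  A _         = refl
  coeff-shift-< {suc n} {suc m} A (s≤s m<n) = coeff-shift-< A m<n

  coeff-shift-+ : ∀ n A m → coeff (shift n A) (n + m) ≡ coeff A m
  coeff-shift-+ zero    A m = refl
  coeff-shift-+ (suc n) A m = coeff-shift-+ n A m

  pow : K → ℕ → K
  pow α zero    = 1ᴷ
  pow α (suc n) = α ⊗ pow α n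

  ev-shift : ∀ α n A → ev α (shift n A) ≡ pow α n ⊗ ev α A
  ev-shift α zero    A = sym (⊗-identityˡ _)
  ev-shift α (suc n) A = trans (ev-X· α (shift n A)) (trans (cong (α ⊗_) (ev-shift α n A)) (sym (⊗-assoc _ _ _)))

  -- The product rule for X^n A, multiplied by X so that the exponent n - 1 does not occur.
  X·∂-shift : ∀ n A → X· ∂ (shift n A) ≈ emb n ∙ shift n A +ₚ X· shift n (∂ A)
  X·∂-shift zero    A = coeffwise λ n → sym (trans (coeff-+ (0ᴷ ∙ A) (X· ∂ A) n)
    (trans (cong (_⊕ coeff (X· ∂ A) n) (trans (coeff-∙ 0ᴷ A n) (⊗-zeroˡ _))) (⊕-identityˡ _)))
  X·∂-shift (suc n) A = ≈-trans (X·-cong (≈-trans (+ₚ-cong ≈-refl (X·∂-shift n A)) (≈-trans (≈-sym (+ₚ-assoc _ _ _)) (+ₚ-cong collect ≈-refl))))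
    (≈-trans (X·-+ _ _) (+ₚ-cong (X·-∙ _ _) ≈-refl))
    where
    B = shift n A
    collect : B +ₚ emb n ∙ B ≈ emb (suc n) ∙ B
    collect = coeffwise λ m → trans (coeff-+ B (emb n ∙ B) m) (trans (cong (coeff B m ⊕_) (coeff-∙ (emb n) B m))
      (trans (solve 2 (λ b e → b :+ e :* b := (con (pos 1) :+ e) :* b) refl (coeff B m) (emb n))
        (trans (cong (_⊗ coeff B m) (emb-+ 1 n)) (sym (coeff-∙ (emb (suc n)) B m)))))

  -- The term q X^(q-1) A of the product rule is zero in F_q. The extra factor X is cancelled by
  -- reading off the coefficient of index n + 1.
  ∂-shift-q : ∀ A → ∂ (shift q A) ≈ shift q (∂ A)
  ∂-shift-q A = coeffwise λ n → at X·-eq (suc n)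
    where
    X·-eq : X· ∂ (shift q A) ≈ X· shift q (∂ A)
    X·-eq = ≈-trans (X·∂-shift q A) (coeffwise λ n → trans (coeff-+ (emb q ∙ shift q A) _ n)
      (trans (cong (_⊕ coeff (X· shift q (∂ A)) n) (trans (coeff-∙ (emb q) (shift q A) n) (trans (cong (_⊗ coeff (shift q A) n) emb-q) (⊗-zeroˡ _)))) (⊕-identityˡ _)))

  [1+X]^ : ℕ → Poly
  [1+X]^ zero    = 1ᴷ ∷ []
  [1+X]^ (suc n) = [1+X]^ n +ₚ X· [1+X]^ n

  ev-[1+X]^ : ∀ α n → ev α ([1+X]^ n) ≡ pow (1ᴷ ⊕ α) n
  ev-[1+X]^ α zero    = trans (cong (1ᴷ ⊕_) (⊗-zeroʳ α)) (⊕-identityʳ _)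
  ev-[1+X]^ α (suc n) = trans (ev-+ α ([1+X]^ n) _) (trans (cong₂ _⊕_ (ev-[1+X]^ α n) (trans (ev-X· α ([1+X]^ n)) (cong (α ⊗_) (ev-[1+X]^ α n))))
    (solve 2 (λ a p → p :+ a :* p := (con (pos 1) :+ a) :* p) refl α (pow (1ᴷ ⊕ α) n)))

  [1+X]^-DegLt : ∀ n → DegLt ([1+X]^ n) (suc n)
  [1+X]^-DegLt zero    = DegLt-length (1ᴷ ∷ [])
  [1+X]^-DegLt (suc n) = DegLt-+ {[1+X]^ n} (DegLt-mono {[1+X]^ n} (ℕ.n≤1+n _) ([1+X]^-DegLt n)) (DegLt-∷ {A = [1+X]^ n} ([1+X]^-DegLt n))

  [1+X]^-constant : ∀ n → coeff ([1+X]^ n) 0 ≡ 1ᴷ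
  [1+X]^-constant zero    = refl
  [1+X]^-constant (suc n) = trans (coeff-+ ([1+X]^ n) _ 0) (trans (⊕-identityʳ _) ([1+X]^-constant n))

  [1+X]^-leading : ∀ n → coeff ([1+X]^ n) n ≡ 1ᴷ
  [1+X]^-leading zero    = refl
  [1+X]^-leading (suc n) = trans (coeff-+ ([1+X]^ n) _ (suc n))
    (trans (cong₂ _⊕_ ([1+X]^-DegLt n (suc n) ℕ.≤-refl) ([1+X]^-leading n)) (⊕-identityˡ _))

  ∂-[1+X]^ : ∀ n → ∂ ([1+X]^ n) +ₚ X· ∂ ([1+X]^ n) ≈ emb n ∙ [1+X]^ n
  ∂-[1+X]^ zero    = ≈-trans (+ₚ-cong ∂1 (≈-trans (X·-cong ∂1) X·-[])) (≈-trans (+ₚ-identityʳ []) (≈-sym (∙-0 (1ᴷ ∷ []))))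
    where
    ∂1 : ∂ (1ᴷ ∷ []) ≈ []
    ∂1 = ≈-trans (+ₚ-cong ≈-refl X·-[]) (+ₚ-identityʳ [])
  ∂-[1+X]^ (suc n) = ≈-trans (+ₚ-cong ∂-suc (≈-trans (X·-cong ∂-suc) (X·-∙ (emb (suc n)) P))) (≈-sym (∙-distribˡ (emb (suc n)) P (X· P)))
    where
    P = [1+X]^ n
    ∂-suc : ∂ (P +ₚ X· P) ≈ emb (suc n) ∙ P
    ∂-suc = coeffwise λ m → begin
      coeff (∂ (P +ₚ X· P)) m                               ≡⟨ trans (at (∂-+ P (X· P)) m) (coeff-+ (∂ P) _ m) ⟩
      coeff (∂ P) m ⊕ coeff (P +ₚ X· ∂ P) m                 ≡⟨ cong (coeff (∂ P) m ⊕_) (coeff-+ P (X· ∂ P) m) ⟩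
      coeff (∂ P) m ⊕ (coeff P m ⊕ coeff (X· ∂ P) m)        ≡⟨ solve 3 (λ a p b → a :+ (p :+ b) := p :+ (a :+ b)) refl (coeff (∂ P) m) (coeff P m) _ ⟩
      coeff P m ⊕ (coeff (∂ P) m ⊕ coeff (X· ∂ P) m)        ≡⟨ cong (coeff P m ⊕_) (trans (sym (coeff-+ (∂ P) (X· ∂ P) m)) (trans (at (∂-[1+X]^ n) m) (coeff-∙ (emb n) P m))) ⟩
      coeff P m ⊕ emb n ⊗ coeff P m                         ≡⟨ solve 2 (λ b e → b :+ e :* b := (con (pos 1) :+ e) :* b) refl (coeff P m) (emb n) ⟩
      (1ᴷ ⊕ emb n) ⊗ coeff P m                              ≡⟨ trans (cong (_⊗ coeff P m) (emb-+ 1 n)) (sym (coeff-∙ (emb (suc n)) P m)) ⟩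
      coeff (emb (suc n) ∙ P) m ∎
      where open ≡-Reasoning

  -- P = (1 + X)^q satisfies (1 + X) P′ = q P = 0. Each coefficient of P′ is therefore minus the
  -- preceding one, and all are zero. A coefficient of P at an index strictly between 0 and q is
  -- then zero, since the index is invertible.
  [1+X]^q : [1+X]^ q ≈ (1ᴷ ∷ []) +ₚ shift q (1ᴷ ∷ [])
  [1+X]^q = coeffwise λ n → trans (go n) (sym (coeff-+ (1ᴷ ∷ []) (shift q (1ᴷ ∷ [])) n))
    where
    P = [1+X]^ q
    ∂P≡0 : ∀ n → coeff (∂ P) n ≡ 0ᴷ
    ∂P≡0 n = trans (sym (⊕-identityʳ _)) (trans (cong (coeff (∂ P) n ⊕_) (sym (prev n))) (trans (sym (coeff-+ (∂ P) (X· ∂ P) n))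
      (trans (at (∂-[1+X]^ q) n) (trans (coeff-∙ (emb q) P n) (trans (cong (_⊗ coeff P n) emb-q) (⊗-zeroˡ _))))))
      where
      prev : ∀ n → coeff (X· ∂ P) n ≡ 0ᴷ
      prev zero    = refl
      prev (suc n) = ∂P≡0 n
    go : ∀ n → coeff P n ≡ coeff (1ᴷ ∷ []) n ⊕ coeff (shift q (1ᴷ ∷ [])) n
    go zero = trans ([1+X]^-constant q) (sym (trans (cong (1ᴷ ⊕_) (coeff-shift-< (1ᴷ ∷ []) (ℕ.>-nonZero⁻¹ q))) (⊕-identityʳ _)))
    go (suc n) with ℕ.<-cmp (suc n) q
    ... | tri< n<q _ _ = trans (⊗-cancelˡ-0 (emb-suc≢0 n<q) (trans (sym (coeff-∂ P n)) (∂P≡0 n)))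
                           (sym (trans (⊕-identityˡ _) (coeff-shift-< (1ᴷ ∷ []) n<q)))
    ... | tri≈ _ n≡q _ = trans (cong (coeff P) n≡q) (trans ([1+X]^-leading q) (sym (trans (⊕-identityˡ _)
                           (trans (cong (coeff (shift q (1ᴷ ∷ []))) (trans n≡q (sym (ℕ.+-identityʳ q)))) (coeff-shift-+ q (1ᴷ ∷ []) 0)))))
    ... | tri> _ _ q<n = trans ([1+X]^-DegLt q (suc n) q<n) (sym (trans (⊕-identityˡ _)
                           (trans (cong (coeff (shift q (1ᴷ ∷ []))) (sym n≡)) (coeff-shift-+ q (1ᴷ ∷ []) (suc (n ∸ q))))))
      where
      n≡ : q + suc (n ∸ q) ≡ suc n
      n≡ = trans (ℕ.+-suc q _) (cong suc (ℕ.m+[n∸m]≡n (ℕ.≤-pred q<n)))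

  frobenius : ∀ α → pow (1ᴷ ⊕ α) q ≡ 1ᴷ ⊕ pow α q
  frobenius α = begin
    pow (1ᴷ ⊕ α) q                             ≡⟨ ev-[1+X]^ α q ⟨
    ev α ([1+X]^ q)                            ≡⟨ trans (ev-cong [1+X]^q) (ev-+ α (1ᴷ ∷ []) _) ⟩
    (1ᴷ ⊕ α ⊗ 0ᴷ) ⊕ ev α (shift q (1ᴷ ∷ []))   ≡⟨ cong ((1ᴷ ⊕ α ⊗ 0ᴷ) ⊕_) (ev-shift α q (1ᴷ ∷ [])) ⟩
    (1ᴷ ⊕ α ⊗ 0ᴷ) ⊕ pow α q ⊗ (1ᴷ ⊕ α ⊗ 0ᴷ)    ≡⟨ solve 2 (λ a p → (con (pos 1) :+ a :* con (pos 0)) :+ p :* (con (pos 1) :+ a :* con (pos 0)) := con (pos 1) :+ p) refl α (pow α q) ⟩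
    1ᴷ ⊕ pow α q ∎
    where open ≡-Reasoning

  fermat : ∀ α → pow α q ≡ α
  fermat = viaℕ _ go
    where
    pow-0 : ∀ {n} → 0 < n → pow 0ᴷ n ≡ 0ᴷ
    pow-0 (s≤s _) = ⊗-zeroˡ _
    go : ∀ n → pow (emb n) q ≡ emb n
    go zero    = pow-0 (ℕ.>-nonZero⁻¹ q)
    go (suc n) = begin
      pow (emb (suc n)) q     ≡⟨ cong (λ z → pow z q) (emb-+ 1 n) ⟨
      pow (1ᴷ ⊕ emb n) q      ≡⟨ frobenius (emb n) ⟩
      1ᴷ ⊕ pow (emb n) q      ≡⟨ cong (1ᴷ ⊕_) (go n) ⟩
      1ᴷ ⊕ emb n              ≡⟨ emb-+ 1 n ⟩
      emb (suc n) ∎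
      where open ≡-Reasoning

  -- Expansions in powers of a polynomial with derivative −1

  -- Multiplication by X^q and by a constant α both qualify; the corresponding twists are X^q − X and α − X.
  record Constant (P : Poly → Poly) : Set where
    field
      cong-P : ∀ {A B} → A ≈ B → P A ≈ P B
      +-P    : ∀ A B → P (A +ₚ B) ≈ P A +ₚ P B
      ∙-P    : ∀ s A → P (s ∙ A) ≈ s ∙ P A
      X·-P   : ∀ A → P (X· A) ≈ X· P A
      ∂-P    : ∀ A → ∂ (P A) ≈ P (∂ A)

    twist : Poly → Poly
    twist A = P A -ₚ X· A

    twist-cong : ∀ {A B} → A ≈ B → twist A ≈ twist B
    twist-cong e = -ₚ-cong (cong-P e) (X·-cong e)

    twist-∙ : ∀ s A → twist (s ∙ A) ≈ s ∙ twist A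
    twist-∙ s A = coeffwise λ n → begin
      coeff (P (s ∙ A) -ₚ X· (s ∙ A)) n            ≡⟨ at (-ₚ-cong (∙-P s A) (X·-∙ s A)) n ⟩
      coeff (s ∙ P A -ₚ s ∙ X· A) n                ≡⟨ trans (coeff-- (s ∙ P A) (s ∙ X· A) n) (cong₂ (λ x y → x ⊕ ⊖ y) (coeff-∙ s (P A) n) (coeff-∙ s (X· A) n)) ⟩
      s ⊗ coeff (P A) n ⊕ ⊖ (s ⊗ coeff (X· A) n)   ≡⟨ solve 3 (λ s a b → s :* a :- s :* b := s :* (a :- b)) refl s (coeff (P A) n) (coeff (X· A) n) ⟩
      s ⊗ (coeff (P A) n ⊕ ⊖ coeff (X· A) n)       ≡⟨ trans (coeff-∙ s (twist A) n) (cong (s ⊗_) (coeff-- (P A) (X· A) n)) ⟨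
      coeff (s ∙ twist A) n ∎
      where open ≡-Reasoning

    twist-+ : ∀ A B → twist (A +ₚ B) ≈ twist A +ₚ twist B
    twist-+ A B = coeffwise λ n → begin
      coeff (P (A +ₚ B) -ₚ X· (A +ₚ B)) n          ≡⟨ at (-ₚ-cong (+-P A B) (X·-+ A B)) n ⟩
      coeff (P A +ₚ P B -ₚ (X· A +ₚ X· B)) n       ≡⟨ trans (coeff-- (P A +ₚ P B) (X· A +ₚ X· B) n) (cong₂ (λ x y → x ⊕ ⊖ y) (coeff-+ (P A) (P B) n) (coeff-+ (X· A) (X· B) n)) ⟩
      coeff (P A) n ⊕ coeff (P B) n ⊕ ⊖ (coeff (X· A) n ⊕ coeff (X· B) n)
                                                   ≡⟨ solve 4 (λ a b x y → a :+ b :- (x :+ y) := (a :- x) :+ (b :- y)) refl (coeff (P A) n) (coeff (P B) n) (coeff (X· A) n) (coeff (X· B) n) ⟩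
      (coeff (P A) n ⊕ ⊖ coeff (X· A) n) ⊕ (coeff (P B) n ⊕ ⊖ coeff (X· B) n)
                                                   ≡⟨ trans (coeff-+ (twist A) (twist B) n) (cong₂ _⊕_ (coeff-- (P A) (X· A) n) (coeff-- (P B) (X· B) n)) ⟨
      coeff (twist A +ₚ twist B) n ∎
      where open ≡-Reasoning

    twist-X· : ∀ A → twist (X· A) ≈ X· twist A
    twist-X· A = ≈-trans (-ₚ-cong (X·-P A) ≈-refl) (≈-sym (X·-- (P A) (X· A)))

    ∂-twist : ∀ A → ∂ (twist A) ≈ twist (∂ A) -ₚ A
    ∂-twist A = coeffwise λ n → begin
      coeff (∂ (P A -ₚ X· A)) n                                        ≡⟨ at (≈-trans (∂-- (P A) (X· A)) (-ₚ-cong (∂-P A) ≈-refl)) n ⟩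
      coeff (P (∂ A) -ₚ (A +ₚ X· ∂ A)) n                               ≡⟨ trans (coeff-- (P (∂ A)) (A +ₚ X· ∂ A) n) (cong (λ z → coeff (P (∂ A)) n ⊕ ⊖ z) (coeff-+ A (X· ∂ A) n)) ⟩
      coeff (P (∂ A)) n ⊕ ⊖ (coeff A n ⊕ coeff (X· ∂ A) n)             ≡⟨ solve 3 (λ p a x → p :- (a :+ x) := (p :- x) :- a) refl (coeff (P (∂ A)) n) (coeff A n) (coeff (X· ∂ A) n) ⟩
      (coeff (P (∂ A)) n ⊕ ⊖ coeff (X· ∂ A) n) ⊕ ⊖ coeff A n           ≡⟨ trans (coeff-- (twist (∂ A)) A n) (cong (_⊕ ⊖ coeff A n) (coeff-- (P (∂ A)) (X· ∂ A) n)) ⟨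
      coeff (twist (∂ A) -ₚ A) n ∎
      where open ≡-Reasoning

  shift-q-constant : Constant (shift q)
  shift-q-constant = record
    { cong-P = shift-cong q ; +-P = shift-+ q ; ∙-P = shift-∙ q ; X·-P = λ A → ≈-reflexive (shift-X· q A) ; ∂-P = ∂-shift-q }

  scalar-constant : ∀ α → Constant (α ∙_)
  scalar-constant α = record
    { cong-P = ∙-cong α
    ; +-P    = ∙-distribˡ α
    ; ∙-P    = λ s A → ≈-trans (≈-sym (∙-assoc α s A)) (≈-trans (≈-reflexive (cong (_∙ A) (⊗-comm α s))) (∙-assoc s α A))
    ; X·-P   = λ A → ≈-sym (X·-∙ α A)
    ; ∂-P    = ∂-∙ α
    }

  module Λ = Constant shift-q-constant

  ev-Λ : ∀ α A → ev α (Λ.twist A) ≡ 0ᴷ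
  ev-Λ α A = begin
    ev α (shift q A -ₚ X· A)             ≡⟨ ev-- α (shift q A) (X· A) ⟩
    ev α (shift q A) ⊕ ⊖ ev α (X· A)     ≡⟨ cong₂ (λ x y → x ⊕ ⊖ y) (trans (ev-shift α q A) (cong (_⊗ ev α A) (fermat α))) (ev-X· α A) ⟩
    α ⊗ ev α A ⊕ ⊖ (α ⊗ ev α A)          ≡⟨ ⊖-inverseʳ _ ⟩
    0ᴷ ∎
    where open ≡-Reasoning

  ev-α-X : ∀ α A → ev α (Constant.twist (scalar-constant α) A) ≡ 0ᴷ
  ev-α-X α A = trans (ev-- α (α ∙ A) (X· A)) (trans (cong₂ (λ x y → x ⊕ ⊖ y) (ev-∙ α α A) (ev-X· α A)) (⊖-inverseʳ _))

  ∂^ : ℕ → Poly → Poly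
  ∂^ zero    A = A
  ∂^ (suc ℓ) A = ∂^ ℓ (∂ A)

  ∂^-cong : ∀ ℓ {A B} → A ≈ B → ∂^ ℓ A ≈ ∂^ ℓ B
  ∂^-cong zero    e = e
  ∂^-cong (suc ℓ) e = ∂^-cong ℓ (∂-cong e)

  Vanish⇒ev : ∀ {α N A ℓ} → Vanish α N A → ℓ < N → ev α (∂^ ℓ A) ≡ 0ᴷ
  Vanish⇒ev {ℓ = zero}  (suc r v) _         = r
  Vanish⇒ev {ℓ = suc ℓ} (suc r v) (s≤s ℓ<N) = Vanish⇒ev v ℓ<N

  ev⇒Vanish : ∀ {α A} N → (∀ ℓ → ℓ < N → ev α (∂^ ℓ A) ≡ 0ᴷ) → Vanish α N A
  ev⇒Vanish zero    h = zero
  ev⇒Vanish (suc N) h = suc (h 0 (s≤s z≤n)) (ev⇒Vanish N λ ℓ ℓ<N → h (suc ℓ) (s≤s ℓ<N))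

  -- The derivative of Σ C_j Y^j when Y has derivative −1.
  δ : (ℕ → Poly) → ℕ → Poly
  δ C j = ∂ (C j) -ₚ emb (suc j) ∙ C (suc j)

  δ^ : ℕ → (ℕ → Poly) → ℕ → Poly
  δ^ zero    C = C
  δ^ (suc ℓ) C = δ^ ℓ (δ C)

  private
    chain-regroup₁ : ∀ c u′ u e → (c ⊕ (u′ ⊕ ⊖ u)) ⊕ ⊖ (e ⊗ u) ≡ c ⊕ (u′ ⊕ ⊖ ((1ᴷ ⊕ e) ⊗ u))
    chain-regroup₁ = solve 4 (λ c u′ u e → (c :+ (u′ :- u)) :- e :* u := c :+ (u′ :- (con (pos 1) :+ e) :* u)) refl

    chain-regroup₂ : ∀ c u′ e c₁ v → c ⊕ (u′ ⊕ ⊖ (e ⊗ (c₁ ⊕ v))) ≡ (c ⊕ ⊖ (e ⊗ c₁)) ⊕ (u′ ⊕ ⊖ 1ᴷ ⊗ (e ⊗ v))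
    chain-regroup₂ = solve 5 (λ c u′ e c₁ v → c :+ (u′ :- e :* (c₁ :+ v)) := (c :- e :* c₁) :+ (u′ :+ :- con (pos 1) :* (e :* v))) refl

  module _ {P} (constant : Constant P) where
    open Constant constant

    -- Q j is the tail Σ_{i ≥ j} C_i Y^(i−j) of an expansion in powers of the twist Y.
    Chain : (C Q : ℕ → Poly) → Set
    Chain C Q = ∀ j → Q j ≈ C j +ₚ twist (Q (suc j))

    -- Differentiating the tail Σ C_i Y^(i-j) produces the factor i - j where `δ` has i; the missing
    -- part is j times the next tail, which is subtracted. For j = 0 nothing is missing, so the new
    -- chain starts with the derivative of `Q 0`.
    δ-chain : ∀ {C Q} → Chain C Q → Chain (δ C) (λ j → ∂ (Q j) -ₚ emb j ∙ Q (suc j))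
    δ-chain {C} {Q} chain j = coeffwise λ n →
      let c  = coeff (∂ (C j)) n
          c₁ = coeff (C (suc j)) n
          u  = coeff (Q (suc j)) n
          u′ = coeff (twist (∂ (Q (suc j)))) n
          v  = coeff (twist (Q (suc (suc j)))) n
      in begin
      coeff (∂ (Q j) -ₚ emb j ∙ Q (suc j)) n
        ≡⟨ trans (coeff-- (∂ (Q j)) (emb j ∙ Q (suc j)) n) (cong₂ (λ x y → x ⊕ ⊖ y) (at (∂Q j) n) (coeff-∙ (emb j) (Q (suc j)) n)) ⟩
      coeff (∂ (C j) +ₚ (twist (∂ (Q (suc j))) -ₚ Q (suc j))) n ⊕ ⊖ (emb j ⊗ u)
        ≡⟨ cong (_⊕ ⊖ (emb j ⊗ u)) (trans (coeff-+ (∂ (C j)) _ n) (cong (c ⊕_) (coeff-- (twist (∂ (Q (suc j)))) (Q (suc j)) n))) ⟩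
      (c ⊕ (u′ ⊕ ⊖ u)) ⊕ ⊖ (emb j ⊗ u)
        ≡⟨ chain-regroup₁ c u′ u (emb j) ⟩
      c ⊕ (u′ ⊕ ⊖ ((1ᴷ ⊕ emb j) ⊗ u))
        ≡⟨ cong (λ z → c ⊕ (u′ ⊕ ⊖ z)) (cong₂ _⊗_ (emb-+ 1 j) (trans (at (chain (suc j)) n) (coeff-+ (C (suc j)) _ n))) ⟩
      c ⊕ (u′ ⊕ ⊖ (emb (suc j) ⊗ (c₁ ⊕ v)))
        ≡⟨ chain-regroup₂ c u′ (emb (suc j)) c₁ v ⟩
      (c ⊕ ⊖ (emb (suc j) ⊗ c₁)) ⊕ (u′ ⊕ ⊖ 1ᴷ ⊗ (emb (suc j) ⊗ v))
        ≡⟨ trans (coeff-+ (δ C j) _ n) (cong₂ _⊕_ (trans (coeff-- (∂ (C j)) (emb (suc j) ∙ C (suc j)) n) (cong (λ z → c ⊕ ⊖ z) (coeff-∙ (emb (suc j)) (C (suc j)) n))) (twist-δ n)) ⟨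
      coeff (δ C j +ₚ twist (∂ (Q (suc j)) -ₚ emb (suc j) ∙ Q (suc (suc j)))) n ∎
      where
      open ≡-Reasoning
      ∂Q : ∀ j → ∂ (Q j) ≈ ∂ (C j) +ₚ (twist (∂ (Q (suc j))) -ₚ Q (suc j))
      ∂Q j = ≈-trans (∂-cong (chain j)) (≈-trans (∂-+ (C j) _) (+ₚ-cong ≈-refl (∂-twist (Q (suc j)))))
      twist-δ : ∀ n → coeff (twist (∂ (Q (suc j)) -ₚ emb (suc j) ∙ Q (suc (suc j)))) n
                    ≡ coeff (twist (∂ (Q (suc j)))) n ⊕ ⊖ 1ᴷ ⊗ (emb (suc j) ⊗ coeff (twist (Q (suc (suc j)))) n)
      twist-δ n = trans (at (≈-trans (twist-cong (-ₚ≈ (∂ (Q (suc j))) _)) (≈-trans (twist-+ (∂ (Q (suc j))) _)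
          (+ₚ-cong ≈-refl (≈-trans (twist-∙ (⊖ 1ᴷ) _) (∙-cong (⊖ 1ᴷ) (twist-∙ (emb (suc j)) (Q (suc (suc j))))))))) n)
        (trans (coeff-+ (twist (∂ (Q (suc j)))) _ n) (cong (coeff (twist (∂ (Q (suc j)))) n ⊕_)
          (trans (coeff-∙ (⊖ 1ᴷ) _ n) (cong (⊖ 1ᴷ ⊗_) (coeff-∙ (emb (suc j)) _ n)))))

    chain-∂^ : ∀ ℓ {C Q} → Chain C Q → ∃ λ U → ∂^ ℓ (Q 0) ≈ δ^ ℓ C 0 +ₚ twist U
    chain-∂^ zero    {Q = Q} chain = Q 1 , chain 0
    chain-∂^ (suc ℓ) {C} {Q} chain = let U , e = chain-∂^ ℓ (δ-chain chain) in U , ≈-trans (∂^-cong ℓ ∂Q₀) e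
      where
      ∂Q₀ : ∂ (Q 0) ≈ ∂ (Q 0) -ₚ emb 0 ∙ Q 1
      ∂Q₀ = coeffwise λ n → sym (trans (coeff-- (∂ (Q 0)) (emb 0 ∙ Q 1) n)
        (trans (cong (λ z → coeff (∂ (Q 0)) n ⊕ ⊖ z) (coeff-∙ (emb 0) (Q 1) n))
          (solve 2 (λ a u → a :- con (pos 0) :* u := a) refl (coeff (∂ (Q 0)) n) (coeff (Q 1) n))))

    -- The right-hand side does not mention the twist: two chains with the same coefficients have
    -- the same derivatives at every common root of their twists.
    chain-ev : ∀ {α C Q} → (∀ A → ev α (twist A) ≡ 0ᴷ) → Chain C Q → ∀ ℓ → ev α (∂^ ℓ (Q 0)) ≡ ev α (δ^ ℓ C 0)
    chain-ev {α} {C} root chain ℓ = let U , e = chain-∂^ ℓ chain in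
      trans (ev-cong e) (trans (ev-+ α (δ^ ℓ C 0) (twist U)) (trans (cong (ev α (δ^ ℓ C 0) ⊕_) (root U)) (⊕-identityʳ _)))

  δ^-DegLt : ∀ {d} ℓ {C} → (∀ j → DegLt (C j) d) → ∀ j → DegLt (δ^ ℓ C j) d
  δ^-DegLt zero    h j = h j
  δ^-DegLt (suc ℓ) {C} h = δ^-DegLt ℓ λ j → DegLt-- {∂ (C j)} (∂-DegLt {C j} (h j)) (DegLt-∙ {C (suc j)} (emb (suc j)) (h (suc j)))

  -- Solves the triangular system: (j + 1) C_(j+1) is the derivative of C_j minus `δ C j`. Induction
  -- bounds both, the latter by applying the claim to `δ C` with one derivative fewer, and j + 1 < n
  -- ≤ q makes j + 1 invertible.
  δ^-DegLt⁻ : ∀ {d} n {C} → n ≤ q → (∀ ℓ → ℓ < n → DegLt (δ^ ℓ C 0) d) → ∀ j → j < n → DegLt (C j) d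
  δ^-DegLt⁻     (suc n)       n<q h zero    _         = h 0 (s≤s z≤n)
  δ^-DegLt⁻ {d} (suc (suc n)) {C} n<q h (suc j) (s≤s j<n) m d≤m =
    ⊗-cancelˡ-0 (emb-suc≢0 (ℕ.≤-trans (s≤s j<n) n<q)) (trans (sym (coeff-∙ (emb (suc j)) (C (suc j)) m)) (begin
      coeff (emb (suc j) ∙ C (suc j)) m                               ≡⟨ solve 2 (λ a b → b := a :- (a :- b)) refl (coeff (∂ (C j)) m) _ ⟩
      coeff (∂ (C j)) m ⊕ ⊖ (coeff (∂ (C j)) m ⊕ ⊖ coeff (emb (suc j) ∙ C (suc j)) m)
        ≡⟨ cong₂ (λ x y → x ⊕ ⊖ y) (∂-DegLt {C j} Cj m d≤m) (trans (sym (coeff-- (∂ (C j)) (emb (suc j) ∙ C (suc j)) m)) (δCj m d≤m)) ⟩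
      0ᴷ ⊕ ⊖ 0ᴷ                                                       ≡⟨ ⊖-inverseʳ 0ᴷ ⟩
      0ᴷ ∎))
    where
    open ≡-Reasoning
    Cj : DegLt (C j) d
    Cj = δ^-DegLt⁻ (suc n) (ℕ.<⇒≤ n<q) (λ ℓ ℓ<n → h ℓ (ℕ.m<n⇒m<1+n ℓ<n)) j j<n
    δCj : DegLt (δ C j) d
    δCj = δ^-DegLt⁻ (suc n) (ℕ.<⇒≤ n<q) (λ ℓ ℓ<n → h (suc ℓ) (s≤s ℓ<n)) j j<n

  -- Division by X^q − X

  coeff-Λ1 : coeff (Λ.twist (1ᴷ ∷ [])) q ≡ 1ᴷ
  coeff-Λ1 = trans (coeff-- (shift q (1ᴷ ∷ [])) (X· (1ᴷ ∷ [])) q)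
    (trans (cong₂ (λ x y → x ⊕ ⊖ y) (trans (cong (coeff (shift q (1ᴷ ∷ []))) (sym (ℕ.+-identityʳ q))) (coeff-shift-+ q (1ᴷ ∷ []) 0))
      (DegLt-length (X· (1ᴷ ∷ [])) q (ℕ.nonTrivial⇒n>1 q {{prime⇒nonTrivial q-prime}})))
      (solve 0 (con (pos 1) :- con (pos 0) := con (pos 1)) refl))

  DegLt-Λ1 : DegLt (Λ.twist (1ᴷ ∷ [])) (suc q)
  DegLt-Λ1 = DegLt-- {shift q (1ᴷ ∷ [])} {X· (1ᴷ ∷ [])} shift-q
    (DegLt-mono {X· (1ᴷ ∷ [])} (s≤s (ℕ.>-nonZero⁻¹ q)) (DegLt-length (X· (1ᴷ ∷ []))))
    where
    shift-q : DegLt (shift q (1ᴷ ∷ [])) (suc q)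
    shift-q n q<n = trans (cong (coeff (shift q (1ᴷ ∷ []))) (sym (ℕ.m+[n∸m]≡n (ℕ.<⇒≤ q<n))))
      (trans (coeff-shift-+ q (1ᴷ ∷ []) (n ∸ q)) (DegLt-length (1ᴷ ∷ []) (n ∸ q) (ℕ.m<n⇒0<n∸m q<n)))

  record Division (A : Poly) : Set where
    field
      remainder quotient : Poly
      equation           : A ≈ remainder +ₚ Λ.twist quotient
      remainder-degree   : DegLt remainder q
      quotient-degree    : ∀ d → DegLt A (q + d) → DegLt quotient d

  Λ-[] : Λ.twist [] ≈ []
  Λ-[] = coeffwise λ n → trans (coeff-- (shift q []) (X· []) n) (trans (cong₂ (λ x y → x ⊕ ⊖ y) (at (shift-[] q) n) (at X·-[] n)) (⊖-inverseʳ _))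
    where
    shift-[] : ∀ n → shift n [] ≈ []
    shift-[] zero    = ≈-refl
    shift-[] (suc n) = ≈-trans (X·-cong (shift-[] n)) X·-[]

  -- If A = R + Λ B, then a + X A = (a + X R) + Λ X B. The new remainder can reach degree q; its
  -- coefficient there is the coefficient r of R at q - 1. Since Λ is monic of degree q, moving r Λ
  -- over to the quotient removes it.
  divide : ∀ A → Division A
  divide [] = record
    { remainder = [] ; quotient = [] ; remainder-degree = DegLt-[] ; quotient-degree = λ _ _ → DegLt-[]
    ; equation  = ≈-sym (≈-trans (+ₚ-cong ≈-refl Λ-[]) (+ₚ-identityʳ [])) }
  divide (a ∷ A) = record
    { remainder        = (a ∷ R) -ₚ r ∙ Λ1
    ; quotient         = r ∷ B
    ; equation         = coeffwise λ n → begin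
        coeff (a ∷ A) n                            ≡⟨ at cons n ⟩
        coeff ((a ∷ R) +ₚ X· Λ.twist B) n          ≡⟨ coeff-+ (a ∷ R) (X· Λ.twist B) n ⟩
        coeff (a ∷ R) n ⊕ coeff (X· Λ.twist B) n   ≡⟨ solve 3 (λ a l x → a :+ x := (a :- l) :+ (l :+ x)) refl (coeff (a ∷ R) n) (coeff (r ∙ Λ1) n) _ ⟩
        (coeff (a ∷ R) n ⊕ ⊖ coeff (r ∙ Λ1) n) ⊕ (coeff (r ∙ Λ1) n ⊕ coeff (X· Λ.twist B) n)
                                                   ≡⟨ trans (coeff-+ ((a ∷ R) -ₚ r ∙ Λ1) (Λ.twist (r ∷ B)) n) (cong₂ _⊕_ (coeff-- (a ∷ R) (r ∙ Λ1) n) (trans (at Λ-∷ n) (coeff-+ (r ∙ Λ1) _ n))) ⟨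
        coeff (((a ∷ R) -ₚ r ∙ Λ1) +ₚ Λ.twist (r ∷ B)) n ∎
    ; remainder-degree = remainder-degree′
    ; quotient-degree  = quotient-degree′
    }
    where
    open ≡-Reasoning
    open Division (divide A) renaming (remainder to R; quotient to B)
    p = ℕ.pred q
    suc-p : suc p ≡ q
    suc-p = ℕ.suc-pred q
    Λ1 = Λ.twist (1ᴷ ∷ [])
    r = coeff R p
    cons : a ∷ A ≈ (a ∷ R) +ₚ X· Λ.twist B
    cons = coeffwise λ { zero → sym (trans (coeff-+ (a ∷ R) (X· Λ.twist B) 0) (⊕-identityʳ a))
                         ; (suc n) → trans (at equation n) (trans (coeff-+ R _ n) (sym (coeff-+ (a ∷ R) (X· Λ.twist B) (suc n)))) }
    Λ-∷ : Λ.twist (r ∷ B) ≈ r ∙ Λ1 +ₚ X· Λ.twist B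
    Λ-∷ = ≈-trans (Λ.twist-cong split) (≈-trans (Λ.twist-+ (r ∙ (1ᴷ ∷ [])) (X· B)) (+ₚ-cong (Λ.twist-∙ r (1ᴷ ∷ [])) (Λ.twist-X· B)))
      where
      split : r ∷ B ≈ r ∙ (1ᴷ ∷ []) +ₚ X· B
      split = coeffwise λ { zero → sym (trans (coeff-+ (r ∙ (1ᴷ ∷ [])) (X· B) 0) (trans (⊕-identityʳ _) (trans (coeff-∙ r (1ᴷ ∷ []) 0) (⊗-identityʳ r))))
                          ; (suc n) → sym (trans (coeff-+ (r ∙ (1ᴷ ∷ [])) (X· B) (suc n)) (trans (cong (_⊕ coeff B n) (trans (coeff-∙ r (1ᴷ ∷ []) (suc n)) (⊗-zeroʳ r))) (⊕-identityˡ _))) }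
    remainder-degree′ : DegLt ((a ∷ R) -ₚ r ∙ Λ1) q
    remainder-degree′ n q≤n with ℕ.m≤n⇒m<n∨m≡n q≤n
    ... | inj₁ q<n = DegLt-- {a ∷ R} (DegLt-∷ {A = R} remainder-degree) (DegLt-∙ {Λ1} r DegLt-Λ1) n q<n
    ... | inj₂ refl = trans (coeff-- (a ∷ R) (r ∙ Λ1) q) (trans (cong₂ (λ x y → x ⊕ ⊖ y) (cong (coeff (a ∷ R)) (sym suc-p))
                       (trans (coeff-∙ r Λ1 q) (trans (cong (r ⊗_) coeff-Λ1) (⊗-identityʳ r)))) (⊖-inverseʳ r))
    quotient-degree′ : ∀ d → DegLt (a ∷ A) (q + d) → DegLt (r ∷ B) d
    quotient-degree′ (suc d) h = DegLt-∷ {A = B} (quotient-degree d (DegLt-∷⁻ {A = A} (subst (DegLt (a ∷ A)) (ℕ.+-suc q d) h)))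
    quotient-degree′ zero    h = λ { zero _ → r≡0 ; (suc n) _ → B≡0 n z≤n }
      where
      A<p : DegLt A p
      A<p = DegLt-∷⁻ {A = A} (subst (DegLt (a ∷ A)) (trans (ℕ.+-identityʳ q) (sym suc-p)) h)
      B≡0 : DegLt B 0
      B≡0 = quotient-degree 0 (DegLt-mono {A} (ℕ.≤-trans (ℕ.n≤1+n p) (ℕ.≤-reflexive (trans suc-p (sym (ℕ.+-identityʳ q))))) A<p)
      r≡0 : r ≡ 0ᴷ
      r≡0 = trans (sym (trans (trans (at equation p) (coeff-+ R _ p)) (trans (cong (r ⊕_) (at (≈-trans (Λ.twist-cong (DegLt0⇒≈[] B≡0)) Λ-[]) p)) (⊕-identityʳ r)))) (A<p p ℕ.≤-refl)

  -- The expansion in powers of X^q - X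

  quotients : Poly → ℕ → Poly
  quotients A zero    = A
  quotients A (suc j) = Division.quotient (divide (quotients A j))

  digits : Poly → ℕ → Poly
  digits A j = Division.remainder (divide (quotients A j))

  digits-chain : ∀ A → Chain shift-q-constant (digits A) (quotients A)
  digits-chain A j = Division.equation (divide (quotients A j))

  digits-DegLt : ∀ A j → DegLt (digits A j) q
  digits-DegLt A j = Division.remainder-degree (divide (quotients A j))

  quotients-DegLt : ∀ {A} c → DegLt A (c * q) → ∀ j → DegLt (quotients A j) ((c ∸ j) * q)
  quotients-DegLt c h zero    = h
  quotients-DegLt {A} c h (suc j) with c ∸ j in eq | quotients-DegLt {A} c h j
  ... | zero  | ih = subst (λ m → DegLt (quotients A (suc j)) (m * q)) (sym c∸[1+j]≡0)
                       (Division.quotient-degree (divide (quotients A j)) 0 (DegLt-mono {quotients A j} z≤n ih))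
    where
    c∸[1+j]≡0 : c ∸ suc j ≡ 0
    c∸[1+j]≡0 = trans (cong (c ∸_) (ℕ.+-comm 1 j)) (trans (sym (ℕ.∸-+-assoc c j 1)) (cong (_∸ 1) eq))
  ... | suc t | ih = subst (λ m → DegLt (quotients A (suc j)) (m * q)) (sym c∸[1+j]≡t)
                       (Division.quotient-degree (divide (quotients A j)) (t * q) ih)
    where
    c∸[1+j]≡t : c ∸ suc j ≡ t
    c∸[1+j]≡t = trans (cong (c ∸_) (ℕ.+-comm 1 j)) (trans (sym (ℕ.∸-+-assoc c j 1)) (cong (_∸ 1) eq))

  quotients-[] : ∀ {A} c → DegLt A (c * q) → ∀ j → c ≤ j → quotients A j ≈ []
  quotients-[] {A} c h j c≤j = DegLt0⇒≈[] (subst (λ m → DegLt (quotients A j) (m * q)) (ℕ.m≤n⇒m∸n≡0 c≤j) (quotients-DegLt {A} c h j))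

  digits-[] : ∀ {A} c → DegLt A (c * q) → ∀ j → c ≤ j → digits A j ≈ []
  digits-[] {A} c h j c≤j = coeffwise λ n → begin
    coeff (digits A j) n                                                  ≡⟨ ⊕-identityʳ _ ⟨
    coeff (digits A j) n ⊕ 0ᴷ                                             ≡⟨ cong (coeff (digits A j) n ⊕_) (at (≈-trans (Λ.twist-cong (quotients-[] {A} c h (suc j) (ℕ.m≤n⇒m≤1+n c≤j))) Λ-[]) n) ⟨
    coeff (digits A j) n ⊕ coeff (Λ.twist (quotients A (suc j))) n        ≡⟨ trans (at (digits-chain A j) n) (coeff-+ (digits A j) _ n) ⟨
    coeff (quotients A j) n                                               ≡⟨ at (quotients-[] {A} c h j c≤j) n ⟩
    0ᴷ ∎
    where open ≡-Reasoning

  digits-nonzero : ∀ {A} c → DegLt A (c * q) → (∀ j → j < c → digits A j ≈ []) → A ≈ []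
  digits-nonzero {A} c h zeros = subst (λ m → quotients A m ≈ []) (ℕ.n∸n≡0 c) (go c ℕ.≤-refl)
    where
    go : ∀ j → j ≤ c → quotients A (c ∸ j) ≈ []
    go zero    _   = quotients-[] {A} c h c ℕ.≤-refl
    go (suc j) j<c = ≈-trans (digits-chain A i) (≈-trans (+ₚ-cong (zeros i i<c) (Λ.twist-cong next)) (≈-trans (+ₚ-cong ≈-refl Λ-[]) (+ₚ-identityʳ [])))
      where
      i = c ∸ suc j
      i<c : i < c
      i<c = ℕ.∸-monoʳ-< (s≤s z≤n) j<c
      next : quotients A (suc i) ≈ []
      next = subst (λ m → quotients A m ≈ []) (ℕ.+-∸-assoc 1 j<c) (go j (ℕ.<⇒≤ j<c))

  -- Hasse derivatives

  nC0≡1 : ∀ n → n choose 0 ≡ 1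
  nC0≡1 n = trans (nCk≡nC[n∸k] {0} {n} z≤n) (nCn≡1 n)

  absorption : ∀ n ℓ → suc ℓ * (suc n choose suc ℓ) ≡ suc n * (n choose ℓ)
  absorption zero    zero    = refl
  absorption zero    (suc ℓ) = trans (cong (suc (suc ℓ) *_) (k>n⇒nCk≡0 {1} {suc (suc ℓ)} (s≤s (s≤s z≤n)))) (trans (ℕ.*-zeroʳ ℓ) (sym (cong (1 *_) (k>n⇒nCk≡0 {0} {suc ℓ} (s≤s z≤n)))))
  absorption (suc n) zero    = trans (cong (1 *_) (nC1≡n (suc (suc n)))) (trans (ℕ.*-identityˡ _) (sym (trans (cong (suc (suc n) *_) (nC0≡1 (suc n))) (ℕ.*-identityʳ _))))
  absorption (suc n) (suc ℓ) = begin
    suc (suc ℓ) * (suc (suc n) choose suc (suc ℓ))   ≡⟨ cong (suc (suc ℓ) *_) (nCk+nC[k+1]≡[n+1]C[k+1] (suc n) (suc ℓ)) ⟨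
    suc (suc ℓ) * (x + y)                            ≡⟨ ℕ.*-distribˡ-+ (suc (suc ℓ)) x y ⟩
    (x + suc ℓ * x) + suc (suc ℓ) * y                ≡⟨ cong₂ (λ u v → (x + u) + v) (absorption n ℓ) (absorption n (suc ℓ)) ⟩
    (x + suc n * u) + suc n * v                      ≡⟨ ℕ.+-assoc x _ _ ⟩
    x + (suc n * u + suc n * v)                      ≡⟨ cong (λ z → x + z) (ℕ.*-distribˡ-+ (suc n) u v) ⟨
    x + suc n * (u + v)                              ≡⟨ cong (λ z → x + suc n * z) (nCk+nC[k+1]≡[n+1]C[k+1] n ℓ) ⟩
    suc (suc n) * x ∎
    where
    open ≡-Reasoning
    x = suc n choose suc ℓ
    y = suc n choose suc (suc ℓ)
    u = n choose ℓ
    v = n choose suc ℓ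

  coeff-applyUpTo : ∀ f m n → (m ≤ n → f n ≡ 0ᴷ) → coeff (applyUpTo f m) n ≡ f n
  coeff-applyUpTo f zero    n       h = sym (h z≤n)
  coeff-applyUpTo f (suc m) zero    h = refl
  coeff-applyUpTo f (suc m) (suc n) h = coeff-applyUpTo (f ∘ suc) m n (h ∘ s≤s)

  opaque
    unfolding _⊗_

    coeff-hasse : ∀ ℓ A j → coeff (Defs.hasse q ℓ A) j ≡ emb ((j + ℓ) choose ℓ) ⊗ coeff A (j + ℓ)
    coeff-hasse ℓ A j = trans (cong (λ B → coeff B j) (map-applyUpTo id _ (length A ∸ ℓ))) (coeff-applyUpTo _ (length A ∸ ℓ) j
      λ A∸ℓ≤j → trans (cong (emb ((j + ℓ) choose ℓ) ⊗_) (DegLt-length A (j + ℓ) (ℕ.≤-trans (ℕ.m≤n+m∸n (length A) ℓ) (ℕ.≤-trans (ℕ.+-monoʳ-≤ ℓ A∸ℓ≤j) (ℕ.≤-reflexive (ℕ.+-comm ℓ j)))))) (⊗-zeroʳ (emb ((j + ℓ) choose ℓ))))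

  coeff-∂^ : ∀ ℓ A j → coeff (∂^ ℓ A) j ≡ emb (ℓ ! * ((j + ℓ) choose ℓ)) ⊗ coeff A (j + ℓ)
  coeff-∂^ zero    A j = trans (sym (⊗-identityˡ _)) (cong₂ (λ x y → emb x ⊗ coeff A y) (sym (trans (ℕ.*-identityˡ _) (nC0≡1 (j + 0)))) (sym (ℕ.+-identityʳ j)))
  coeff-∂^ (suc ℓ) A j = begin
    coeff (∂^ ℓ (∂ A)) j                                                           ≡⟨ coeff-∂^ ℓ (∂ A) j ⟩
    emb (ℓ ! * (n choose ℓ)) ⊗ coeff (∂ A) n                                       ≡⟨ cong (emb (ℓ ! * (n choose ℓ)) ⊗_) (coeff-∂ A n) ⟩
    emb (ℓ ! * (n choose ℓ)) ⊗ (emb (suc n) ⊗ coeff A (suc n))                     ≡⟨ trans (sym (⊗-assoc _ _ _)) (cong (_⊗ coeff A (suc n)) (emb-* (ℓ ! * (n choose ℓ)) (suc n))) ⟩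
    emb (ℓ ! * (n choose ℓ) * suc n) ⊗ coeff A (suc n)                             ≡⟨ cong (λ x → emb x ⊗ coeff A (suc n)) count ⟩
    emb (suc ℓ ! * (suc n choose suc ℓ)) ⊗ coeff A (suc n)                         ≡⟨ cong (λ m → emb (suc ℓ ! * (m choose suc ℓ)) ⊗ coeff A m) (ℕ.+-suc j ℓ) ⟨
    emb (suc ℓ ! * ((j + suc ℓ) choose suc ℓ)) ⊗ coeff A (j + suc ℓ) ∎
    where
    open ≡-Reasoning
    n = j + ℓ
    count : ℓ ! * (n choose ℓ) * suc n ≡ suc ℓ ! * (suc n choose suc ℓ)
    count = begin
      ℓ ! * (n choose ℓ) * suc n                   ≡⟨ ℕ.*-assoc (ℓ !) _ _ ⟩
      ℓ ! * ((n choose ℓ) * suc n)                 ≡⟨ cong (ℓ ! *_) (trans (ℕ.*-comm (n choose ℓ) (suc n)) (sym (absorption n ℓ))) ⟩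
      ℓ ! * (suc ℓ * (suc n choose suc ℓ))         ≡⟨ ℕ.*-assoc (ℓ !) (suc ℓ) _ ⟨
      ℓ ! * suc ℓ * (suc n choose suc ℓ)           ≡⟨ cong (_* (suc n choose suc ℓ)) (ℕ.*-comm (ℓ !) (suc ℓ)) ⟩
      suc ℓ ! * (suc n choose suc ℓ) ∎

  hasse-∂^ : ∀ ℓ A → emb (ℓ !) ∙ Defs.hasse q ℓ A ≈ ∂^ ℓ A
  hasse-∂^ ℓ A = coeffwise λ j → trans (coeff-∙ (emb (ℓ !)) (Defs.hasse q ℓ A) j) (trans (cong (emb (ℓ !) ⊗_) (coeff-hasse ℓ A j))
    (trans (sym (⊗-assoc _ _ _)) (trans (cong (_⊗ coeff A (j + ℓ)) (emb-* (ℓ !) _)) (sym (coeff-∂^ ℓ A j)))))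

  emb-!≢0 : ∀ {n} → n < q → emb (n !) ≢ 0ᴷ
  emb-!≢0 {zero}  n<q eq with () ← emb-injective {1} {0} (ℕ.nonTrivial⇒n>1 q {{prime⇒nonTrivial q-prime}}) n<q eq
  emb-!≢0 {suc n} n<q eq = emb-!≢0 (ℕ.<-trans (ℕ.n<1+n n) n<q) (⊗-cancelˡ-0 (emb-suc≢0 n<q) (trans (emb-* (suc n) (n !)) eq))

  -- From the pseudodegree to the digits

  opaque
    unfolding _+ₚ_

    Xp-*ₚ : ∀ B → Defs.Xp q *ₚ B ≈ X· B
    Xp-*ₚ B = ≈-trans (X·-*ₚ (1ᴷ ∷ []) B) (X·-cong (*ₚ-identityˡ B))

    Xp^-*ₚ : ∀ n B → powₚ (Defs.Xp q) n *ₚ B ≈ shift n B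
    Xp^-*ₚ zero    B = *ₚ-identityˡ B
    Xp^-*ₚ (suc n) B = ≈-trans (*ₚ-assoc (Defs.Xp q) (powₚ (Defs.Xp q) n) B) (≈-trans (Xp-*ₚ _) (X·-cong (Xp^-*ₚ n B)))

    XqX-*ₚ : ∀ B → Defs.XqX q *ₚ B ≈ Λ.twist B
    XqX-*ₚ B = ≈-trans (-ₚ-*ₚ (powₚ (Defs.Xp q) q) (Defs.Xp q) B) (-ₚ-cong (Xp^-*ₚ q B) (Xp-*ₚ B))

    remainder-intro : ∀ {A R B} → DegLt R q → A ≈ R +ₚ Λ.twist B → Defs.IsRemModXqX q A R
    remainder-intro {A} {R} {B} h e = h , B , λ n → begin
      coeff (Defs.XqX q *ₚ B) n                                       ≡⟨ at (XqX-*ₚ B) n ⟩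
      coeff (Λ.twist B) n                                             ≡⟨ solve 2 (λ r l → l := (r :+ l) :- r) refl (coeff R n) _ ⟩
      (coeff R n ⊕ coeff (Λ.twist B) n) ⊕ ⊖ coeff R n                 ≡⟨ cong (_⊕ ⊖ coeff R n) (trans (at e n) (coeff-+ R _ n)) ⟨
      coeff A n ⊕ ⊖ coeff R n                                         ≡⟨ coeff-- A R n ⟨
      coeff (A -ₚ R) n ∎
      where open ≡-Reasoning

  ∙-cancel : ∀ {s t} A → s ⊗ t ≡ 1ᴷ → s ∙ t ∙ A ≈ A
  ∙-cancel {s} {t} A st≡1 = ≈-trans (≈-sym (∙-assoc s t A)) (≈-trans (≈-reflexive (cong (_∙ A) st≡1)) (∙-identity A))

  -- By `chain-∂^`, `δ^ ℓ (digits A) 0` is the remainder of the ordinary derivative of order ℓ,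
  -- which is ℓ! times the Hasse derivative. For ℓ < q the factorial is invertible, so dividing by
  -- it gives the pseudoderivative, whose degree is bounded.
  PdegLt⇒δ^-digits : ∀ {A k} → Defs.PdegLt q A k → ∀ ℓ → ℓ < q → DegLt (δ^ ℓ (digits A) 0) k
  PdegLt⇒δ^-digits {A} {k} pdeg ℓ ℓ<q = DegLt-cong {emb (ℓ !) ∙ s ∙ R} {R} (∙-cancel R (trans (⊗-comm _ _) s!≡1)) (DegLt-∙ {s ∙ R} (emb (ℓ !))
    (pdeg ℓ (s ∙ R) (remainder-intro {B = s ∙ U} (DegLt-∙ {R} s (δ^-DegLt ℓ {digits A} (digits-DegLt A) 0)) (begin
      H                                 ≈⟨ ∙-cancel H s!≡1 ⟨
      s ∙ emb (ℓ !) ∙ H                 ≈⟨ ∙-cong s (≈-trans (hasse-∂^ ℓ A) e) ⟩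
      s ∙ (R +ₚ Λ.twist U)              ≈⟨ ∙-distribˡ s R (Λ.twist U) ⟩
      s ∙ R +ₚ s ∙ Λ.twist U            ≈⟨ +ₚ-cong ≈-refl (Λ.twist-∙ s U) ⟨
      s ∙ R +ₚ Λ.twist (s ∙ U) ∎))))
    where
    open ≈-Reasoning
    s = proj₁ (inverse (emb (ℓ !)) (emb-!≢0 ℓ<q))
    s!≡1 = proj₂ (inverse (emb (ℓ !)) (emb-!≢0 ℓ<q))
    H = Defs.hasse q ℓ A
    R = δ^ ℓ (digits A) 0
    U = proj₁ (chain-∂^ shift-q-constant ℓ (digits-chain A))
    e = proj₂ (chain-∂^ shift-q-constant ℓ (digits-chain A))

  digits-DegLt-pdeg : ∀ {A c k} → c ≤ q → DegLt A (c * q) → Defs.PdegLt q A k → ∀ j → DegLt (digits A j) k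
  digits-DegLt-pdeg {A} {c} c≤q h pdeg j with j ℕ.<? c
  ... | yes j<c = δ^-DegLt⁻ c {digits A} c≤q (λ ℓ ℓ<c → PdegLt⇒δ^-digits {A} pdeg ℓ (ℕ.<-≤-trans ℓ<c c≤q)) j j<c
  ... | no  j≮c = ≈[]⇒DegLt (digits-[] {A} c h j (ℕ.≮⇒≥ j≮c))

  Vanish⇒ev-δ^ : ∀ {A α M} → Vanish α M A → ∀ ℓ → ℓ < M → ev α (δ^ ℓ (digits A) 0) ≡ 0ᴷ
  Vanish⇒ev-δ^ {A} {α} v ℓ ℓ<M = trans (sym (chain-ev shift-q-constant (ev-Λ α) (digits-chain A) ℓ)) (Vanish⇒ev v ℓ<M)

  -- Each `δ^ ℓ (digits A) 0` has degree < k and at least k roots, hence is zero; the triangular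
  -- system with degree bound 0 then makes every digit zero. It is applied to the zeros of A, which
  -- gives fewer than k of them, and to all of F_q.
  digits-zeros : ∀ {A c k} xs → Unique xs → c ≤ q → DegLt A (c * q) → (∀ j → DegLt (digits A j) k) → k ≤ length xs →
    (∀ ℓ → ℓ < c → All (λ α → ev α (δ^ ℓ (digits A) 0) ≡ 0ᴷ) xs) → A ≈ []
  digits-zeros {A} {c} xs u c≤q h digits<k k≤xs roots = digits-nonzero {A} c h λ j j<c →
    DegLt0⇒≈[] (δ^-DegLt⁻ c {digits A} c≤q (λ ℓ ℓ<c → ≈[]⇒DegLt (tooManyRoots xs (δ^ ℓ (digits A) 0) u (roots ℓ ℓ<c) (δ^-DegLt ℓ {digits A} digits<k 0) k≤xs)) j j<c)

  -- Expansion of Σ C_j (X − T)^j in powers of X, to be evaluated at X = α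

  module α-X (α : K) = Constant (scalar-constant α)

  horner : K → List Poly → Poly
  horner α []       = []
  horner α (B ∷ Bs) = B +ₚ α ∙ horner α Bs

  -- C + (X − T) Σ B_i X^i, where C and the B_i are polynomials in T.
  step : Poly → List Poly → List Poly
  step C []       = C ∷ []
  step C (B ∷ Bs) = (C -ₚ X· B) ∷ step B Bs

  length-step : ∀ C Bs → length (step C Bs) ≡ suc (length Bs)
  length-step C []       = refl
  length-step C (B ∷ Bs) = cong suc (length-step B Bs)

  step-DegLt : ∀ {d C Bs} → DegLt C d → All (λ B → DegLt B d) Bs → All (λ B → DegLt B (suc d)) (step C Bs)
  step-DegLt {C = C}              h []       = DegLt-mono {C} (ℕ.n≤1+n _) h ∷ []
  step-DegLt {C = C} {Bs = B ∷ _} h (k ∷ ks) = DegLt-- {C} (DegLt-mono {C} (ℕ.n≤1+n _) h) (DegLt-∷ {A = B} k) ∷ step-DegLt {C = B} k ks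

  α-X-[] : ∀ {α} → α-X.twist α [] ≈ []
  α-X-[] {α} = coeffwise λ n → trans (coeff-- (α ∙ []) (X· []) n)
    (trans (cong₂ (λ x y → x ⊕ ⊖ y) (trans (coeff-∙ α [] n) (⊗-zeroʳ α)) (at X·-[] n)) (⊖-inverseʳ 0ᴷ))

  +α-X-[] : ∀ {α A} → A ≈ [] → [] ≈ A +ₚ α-X.twist α []
  +α-X-[] e = ≈-sym (≈-trans (+ₚ-cong e α-X-[]) (+ₚ-identityʳ []))

  horner-step : ∀ α C Bs → horner α (step C Bs) ≈ C +ₚ α-X.twist α (horner α Bs)
  horner-step α C [] = +ₚ-cong ≈-refl (≈-trans (coeffwise λ n → trans (coeff-∙ α [] n) (⊗-zeroʳ α)) (≈-sym (α-X-[] {α})))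
  horner-step α C (B ∷ Bs) = coeffwise λ n →
    let c = coeff C n ; xb = coeff (X· B) n ; b = coeff B n ; t = coeff (α-X.twist α H) n in begin
    coeff ((C -ₚ X· B) +ₚ α ∙ horner α (step B Bs)) n
      ≡⟨ trans (coeff-+ (C -ₚ X· B) (α ∙ horner α (step B Bs)) n) (cong₂ _⊕_ (coeff-- C (X· B) n) (trans (coeff-∙ α (horner α (step B Bs)) n)
           (cong (α ⊗_) (trans (at (horner-step α B Bs) n) (coeff-+ B (α-X.twist α H) n))))) ⟩
    (c ⊕ ⊖ xb) ⊕ α ⊗ (b ⊕ t)
      ≡⟨ regroup c xb b t ⟩
    c ⊕ ((α ⊗ b ⊕ ⊖ xb) ⊕ α ⊗ t)
      ≡⟨ trans (coeff-+ C _ n) (cong (c ⊕_) (trans (at (α-X.twist-+ α B (α ∙ H)) n) (trans (coeff-+ (α-X.twist α B) _ n)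
           (cong₂ _⊕_ (trans (coeff-- (α ∙ B) (X· B) n) (cong (_⊕ ⊖ xb) (coeff-∙ α B n))) (trans (at (α-X.twist-∙ α α H) n) (coeff-∙ α (α-X.twist α H) n)))))) ⟨
    coeff (C +ₚ α-X.twist α (B +ₚ α ∙ H)) n ∎
    where
    open ≡-Reasoning
    H = horner α Bs
    regroup : ∀ c xb b t → (c ⊕ ⊖ xb) ⊕ α ⊗ (b ⊕ t) ≡ c ⊕ ((α ⊗ b ⊕ ⊖ xb) ⊕ α ⊗ t)
    regroup c xb b t = solve 5 (λ a c xb b t → (c :- xb) :+ a :* (b :+ t) := c :+ ((a :* b :- xb) :+ a :* t)) refl α c xb b t

  expand : ℕ → (ℕ → Poly) → List Poly
  expand zero    C = []
  expand (suc n) C = step (C 0) (expand n (C ∘ suc))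

  length-expand : ∀ n C → length (expand n C) ≡ n
  length-expand zero    C = refl
  length-expand (suc n) C = trans (length-step (C 0) (expand n (C ∘ suc))) (cong suc (length-expand n (C ∘ suc)))

  -- The innermost digit enters unchanged, and each of the n further steps multiplies by X - T,
  -- raising the degree in T by at most one. With n + 1 = c this is the origin of k + c - 1.
  expand-DegLt : ∀ {k} n C → (∀ j → DegLt (C j) k) → All (λ B → DegLt B (k + n)) (expand (suc n) C)
  expand-DegLt {k} zero    C h = DegLt-mono {C 0} (ℕ.m≤m+n k 0) (h 0) ∷ []
  expand-DegLt {k} (suc n) C h = subst (λ d → All (λ B → DegLt B d) (expand (suc (suc n)) C)) (sym (ℕ.+-suc k n))
    (step-DegLt {C = C 0} (DegLt-mono {C 0} (ℕ.m≤m+n k n) (h 0)) (expand-DegLt n (C ∘ suc) (h ∘ suc)))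

  tails : K → ℕ → (ℕ → Poly) → ℕ → Poly
  tails α n       C zero    = horner α (expand n C)
  tails α zero    C (suc j) = []
  tails α (suc n) C (suc j) = tails α n (C ∘ suc) j

  tails-chain : ∀ α n C → (∀ j → n ≤ j → C j ≈ []) → Chain (scalar-constant α) C (tails α n C)
  tails-chain α zero    C h zero    = +α-X-[] (h 0 z≤n)
  tails-chain α zero    C h (suc j) = +α-X-[] (h (suc j) z≤n)
  tails-chain α (suc n) C h zero    = horner-step α (C 0) (expand n (C ∘ suc))
  tails-chain α (suc n) C h (suc j) = tails-chain α n (C ∘ suc) (λ i n≤i → h (suc i) (s≤s n≤i)) j

  -- Tensors Σ p ⊗ E, evaluated in the first factor

  Tensor : Set
  Tensor = List (Poly × Poly)

  value : K → Tensor → Poly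
  value α []             = []
  value α ((p , E) ∷ ts) = ev α p ∙ E +ₚ value α ts

  -- Σ X^i ⊗ B_i: the family `horner α` with α turned into a variable.
  toTensor : List Poly → Tensor
  toTensor []       = []
  toTensor (B ∷ Bs) = (1ᴷ ∷ [] , B) ∷ map (λ (p , E) → X· p , E) (toTensor Bs)

  length-toTensor : ∀ Bs → length (toTensor Bs) ≡ length Bs
  length-toTensor []       = refl
  length-toTensor (B ∷ Bs) = cong suc (trans (length-map _ (toTensor Bs)) (length-toTensor Bs))

  value-X· : ∀ α ts → value α (map (λ (p , E) → X· p , E) ts) ≈ α ∙ value α ts
  value-X· α []             = coeffwise λ n → sym (trans (coeff-∙ α [] n) (⊗-zeroʳ α))
  value-X· α ((p , E) ∷ ts) = ≈-trans
    (+ₚ-cong (≈-trans (≈-reflexive (cong (_∙ E) (ev-X· α p))) (∙-assoc α (ev α p) E)) (value-X· α ts))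
    (≈-sym (∙-distribˡ α (ev α p ∙ E) (value α ts)))

  value-toTensor : ∀ α Bs → value α (toTensor Bs) ≈ horner α Bs
  value-toTensor α []       = ≈-refl
  value-toTensor α (B ∷ Bs) = +ₚ-cong (≈-trans (≈-reflexive (cong (_∙ B) (trans (cong (1ᴷ ⊕_) (⊗-zeroʳ α)) (⊕-identityʳ 1ᴷ)))) (∙-identity B))
    (≈-trans (value-X· α (toTensor Bs)) (∙-cong α (value-toTensor α Bs)))

  Bounded : ℕ → ℕ → Poly × Poly → Set
  Bounded c d (p , E) = DegLt p c × DegLt E d

  toTensor-Bounded : ∀ {d Bs} → All (λ B → DegLt B d) Bs → All (Bounded (length Bs) d) (toTensor Bs)
  toTensor-Bounded []                  = []
  toTensor-Bounded {Bs = B ∷ Bs} (h ∷ hs) =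
    (DegLt-mono {1ᴷ ∷ []} (s≤s z≤n) (DegLt-length (1ᴷ ∷ [])) , h) ∷
    All.map⁺ (All.map (λ { {p , E} (hp , hE) → DegLt-∷ {A = p} hp , hE }) (toTensor-Bounded hs))

  -- Reduction to strictly decreasing degrees in the second factor

  record Pivot (c d : ℕ) (ts : Tensor) : Set where
    field
      p E         : Poly
      rest        : Tensor
      p-degree    : DegLt p c
      E-degree    : DegLt E (suc d)
      leading     : coeff E d ≢ 0ᴷ
      rest-bound  : All (Bounded c d) rest
      rest-length : length ts ≡ suc (length rest)
      same-value  : ∀ α → value α ts ≈ value α ((p , E) ∷ rest)

  DegLt-pred : ∀ {A d} → DegLt A (suc d) → coeff A d ≡ 0ᴷ → DegLt A d
  DegLt-pred h e n d≤n with ℕ.m≤n⇒m<n∨m≡n d≤n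
  ... | inj₁ d<n  = h n d<n
  ... | inj₂ refl = e

  -- Elimination moves scalars across the tensor: p ⊗ E + p₀ ⊗ E₀ = p ⊗ (E - t E₀) + (p₀ + t p) ⊗
  -- E₀. The number of terms and the bound c on the first factors are kept, while E loses its
  -- coefficient of degree d.
  pivot : ∀ {c d} ts → All (Bounded c (suc d)) ts → All (Bounded c d) ts ⊎ Pivot c d ts
  pivot [] [] = inj₁ []
  pivot {c} {d} ((p , E) ∷ ts) ((hp , hE) ∷ hs) with pivot ts hs
  ... | inj₁ small with coeff E d ≟ 0ᴷ
  ...   | yes e = inj₁ ((hp , DegLt-pred {E} hE e) ∷ small)
  ...   | no ¬e = inj₂ (record
    { p = p ; E = E ; rest = ts ; p-degree = hp ; E-degree = hE ; leading = ¬e ; rest-bound = small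
    ; rest-length = refl ; same-value = λ α → ≈-refl })
  pivot {c} {d} ((p , E) ∷ ts) ((hp , hE) ∷ hs) | inj₂ P = inj₂ (record
    { p = P.p +ₚ t ∙ p ; E = P.E ; rest = (p , E -ₚ t ∙ P.E) ∷ P.rest
    ; p-degree    = DegLt-+ {P.p} P.p-degree (DegLt-∙ {p} t hp)
    ; E-degree    = P.E-degree
    ; leading     = P.leading
    ; rest-bound  = (hp , DegLt-pred {E -ₚ t ∙ P.E} (DegLt-- {E} hE (DegLt-∙ {P.E} t P.E-degree)) top) ∷ P.rest-bound
    ; rest-length = cong suc P.rest-length
    ; same-value  = λ α → ≈-trans (+ₚ-cong ≈-refl (P.same-value α)) (coeffwise λ n →
        let a = ev α p ; b = ev α P.p ; x = coeff E n ; y = coeff P.E n ; z = coeff (value α P.rest) n in begin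
        coeff (a ∙ E +ₚ (b ∙ P.E +ₚ value α P.rest)) n
          ≡⟨ trans (coeff-+ (a ∙ E) _ n) (cong₂ _⊕_ (coeff-∙ a E n) (trans (coeff-+ (b ∙ P.E) _ n) (cong (_⊕ z) (coeff-∙ b P.E n)))) ⟩
        a ⊗ x ⊕ (b ⊗ y ⊕ z)
          ≡⟨ regroup a b x y z ⟩
        (b ⊕ t ⊗ a) ⊗ y ⊕ (a ⊗ (x ⊕ ⊖ (t ⊗ y)) ⊕ z)
          ≡⟨ trans (coeff-+ (ev α (P.p +ₚ t ∙ p) ∙ P.E) _ n) (cong₂ _⊕_
               (trans (coeff-∙ _ P.E n) (cong (_⊗ y) (trans (ev-+ α P.p (t ∙ p)) (cong (b ⊕_) (ev-∙ α t p)))))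
               (trans (coeff-+ (a ∙ (E -ₚ t ∙ P.E)) _ n) (cong (_⊕ z) (trans (coeff-∙ a (E -ₚ t ∙ P.E) n) (cong (a ⊗_) (trans (coeff-- E (t ∙ P.E) n) (cong (λ u → x ⊕ ⊖ u) (coeff-∙ t P.E n)))))))) ⟨
        coeff (ev α (P.p +ₚ t ∙ p) ∙ P.E +ₚ (a ∙ (E -ₚ t ∙ P.E) +ₚ value α P.rest)) n ∎) })
    where
    open ≡-Reasoning
    module P = Pivot P
    s = proj₁ (inverse (coeff P.E d) P.leading)
    t = coeff E d ⊗ s
    top : coeff (E -ₚ t ∙ P.E) d ≡ 0ᴷ
    top = begin
      coeff (E -ₚ t ∙ P.E) d                         ≡⟨ trans (coeff-- E (t ∙ P.E) d) (cong (λ u → coeff E d ⊕ ⊖ u) (trans (coeff-∙ t P.E d) (⊗-assoc (coeff E d) s (coeff P.E d)))) ⟩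
      coeff E d ⊕ ⊖ (coeff E d ⊗ (s ⊗ coeff P.E d))  ≡⟨ cong (λ u → coeff E d ⊕ ⊖ (coeff E d ⊗ u)) (proj₂ (inverse (coeff P.E d) P.leading)) ⟩
      coeff E d ⊕ ⊖ (coeff E d ⊗ 1ᴷ)                 ≡⟨ trans (cong (λ u → coeff E d ⊕ ⊖ u) (⊗-identityʳ _)) (⊖-inverseʳ _) ⟩
      0ᴷ ∎
    regroup : ∀ a b x y z → a ⊗ x ⊕ (b ⊗ y ⊕ z) ≡ (b ⊕ t ⊗ a) ⊗ y ⊕ (a ⊗ (x ⊕ ⊖ (t ⊗ y)) ⊕ z)
    regroup a b x y z = regroup′ a b x y z t
      where
      regroup′ : ∀ a b x y z t → a ⊗ x ⊕ (b ⊗ y ⊕ z) ≡ (b ⊕ t ⊗ a) ⊗ y ⊕ (a ⊗ (x ⊕ ⊖ (t ⊗ y)) ⊕ z)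
      regroup′ = solve 6 (λ a b x y z t → a :* x :+ (b :* y :+ z) := (b :+ t :* a) :* y :+ (a :* (x :- t :* y) :+ z)) refl

  record Term : Set where
    constructor term
    field
      weight vector : Poly
      degree        : ℕ
      exact         : DegLt vector (suc degree) × coeff vector degree ≢ 0ᴷ
  open Term public

  termsValue : K → List Term → Poly
  termsValue α []       = []
  termsValue α (t ∷ ts) = ev α (weight t) ∙ vector t +ₚ termsValue α ts

  data Descending : ℕ → List Term → Set where
    []  : ∀ {d} → Descending d []
    _∷_ : ∀ {d t ts} → degree t < d → Descending (degree t) ts → Descending d (t ∷ ts)

  Descending-mono : ∀ {d e ts} → d ≤ e → Descending d ts → Descending e ts
  Descending-mono d≤e []       = []
  Descending-mono d≤e (h ∷ hs) = ℕ.<-≤-trans h d≤e ∷ hs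

  record Echelon (c d : ℕ) (ts : Tensor) : Set where
    field
      terms        : List Term
      descending   : Descending d terms
      weights      : All (λ t → DegLt (weight t) c) terms
      terms-length : length terms ≤ length ts
      terms-value  : ∀ α → value α ts ≈ termsValue α terms

  echelon : ∀ {c} d ts → All (Bounded c d) ts → Echelon c d ts
  -- All remaining second factors are zero and their terms are dropped, which is why `terms-length`
  -- is an inequality.
  echelon zero ts hs = record
    { terms = [] ; descending = [] ; weights = [] ; terms-length = z≤n ; terms-value = λ α → vanish α hs }
    where
    vanish : ∀ {c ts} α → All (Bounded c 0) ts → value α ts ≈ []
    vanish α []              = ≈-refl
    vanish {ts = (p , E) ∷ ts} α ((_ , hE) ∷ hs) = DegLt0⇒≈[]
      (DegLt-+ {ev α p ∙ E} (DegLt-∙ {E} (ev α p) hE) (≈[]⇒DegLt (vanish α hs)))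
  echelon (suc d) ts hs with pivot ts hs
  ... | inj₁ small = record
    { terms = terms ; descending = Descending-mono (ℕ.n≤1+n d) descending ; weights = weights
    ; terms-length = terms-length ; terms-value = terms-value }
    where open Echelon (echelon d ts small)
  ... | inj₂ P = record
    { terms        = term p E d (E-degree , leading) ∷ terms
    ; descending   = ℕ.n<1+n d ∷ descending
    ; weights      = p-degree ∷ weights
    ; terms-length = ℕ.≤-trans (s≤s terms-length) (ℕ.≤-reflexive (sym rest-length))
    ; terms-value  = λ α → ≈-trans (same-value α) (+ₚ-cong ≈-refl (terms-value α))
    }
    where
    open Pivot P
    open Echelon (echelon d rest rest-bound)

  termsValue-↭ : ∀ {α ts us} → ts ↭ us → termsValue α ts ≈ termsValue α us
  termsValue-↭ refl         = ≈-refl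
  termsValue-↭ (prep t r)   = +ₚ-cong ≈-refl (termsValue-↭ r)
  termsValue-↭ (swap t u r) = ≈-trans (≈-sym (+ₚ-assoc _ _ _)) (≈-trans (+ₚ-cong (+ₚ-comm _ _) (termsValue-↭ r)) (+ₚ-assoc _ _ _))
  termsValue-↭ (↭-step r s)  = ≈-trans (termsValue-↭ r) (termsValue-↭ s)

  -- Differential operators Σ X^a I_a(θ) with θ = X d/dX

  θ : Poly → Poly
  θ A = X· ∂ A

  coeff-θ : ∀ A n → coeff (θ A) n ≡ emb n ⊗ coeff A n
  coeff-θ A zero    = sym (⊗-zeroˡ _)
  coeff-θ A (suc n) = coeff-∂ A n

  -- I(θ) f. The monomial X^n is an eigenvector of θ with eigenvalue n, so I(θ) multiplies the
  -- coefficient of index n by I(n).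
  euler : Poly → Poly → Poly
  euler []      f = []
  euler (c ∷ I) f = c ∙ f +ₚ euler I (θ f)

  coeff-euler : ∀ I f n → coeff (euler I f) n ≡ ev (emb n) I ⊗ coeff f n
  coeff-euler []      f n = sym (⊗-zeroˡ _)
  coeff-euler (c ∷ I) f n = begin
    coeff (c ∙ f +ₚ euler I (θ f)) n                            ≡⟨ trans (coeff-+ (c ∙ f) _ n) (cong₂ _⊕_ (coeff-∙ c f n) (trans (coeff-euler I (θ f) n) (cong (ev (emb n) I ⊗_) (coeff-θ f n)))) ⟩
    c ⊗ coeff f n ⊕ ev (emb n) I ⊗ (emb n ⊗ coeff f n)          ≡⟨ solve 4 (λ c f i e → c :* f :+ i :* (e :* f) := (c :+ e :* i) :* f) refl c (coeff f n) (ev (emb n) I) (emb n) ⟩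
    (c ⊕ emb n ⊗ ev (emb n) I) ⊗ coeff f n ∎
    where open ≡-Reasoning

  apply : List Poly → Poly → Poly
  apply []       f = []
  apply (I ∷ Is) f = euler I f +ₚ X· apply Is f

  coeff-apply : ∀ I Is f n → coeff (apply (I ∷ Is) f) n ≡ ev (emb n) I ⊗ coeff f n ⊕ coeff (X· apply Is f) n
  coeff-apply I Is f n = trans (coeff-+ (euler I f) _ n) (cong (_⊕ coeff (X· apply Is f) n) (coeff-euler I f n))

  euler-+ : ∀ I f g → euler I (f +ₚ g) ≈ euler I f +ₚ euler I g
  euler-+ I f g = coeffwise λ n → begin
    coeff (euler I (f +ₚ g)) n                                          ≡⟨ trans (coeff-euler I (f +ₚ g) n) (cong (ev (emb n) I ⊗_) (coeff-+ f g n)) ⟩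
    ev (emb n) I ⊗ (coeff f n ⊕ coeff g n)                              ≡⟨ ⊗-distribˡ-⊕ _ _ _ ⟩
    ev (emb n) I ⊗ coeff f n ⊕ ev (emb n) I ⊗ coeff g n                 ≡⟨ trans (coeff-+ (euler I f) (euler I g) n) (cong₂ _⊕_ (coeff-euler I f n) (coeff-euler I g n)) ⟨
    coeff (euler I f +ₚ euler I g) n ∎
    where open ≡-Reasoning

  euler-∙ : ∀ I s f → euler I (s ∙ f) ≈ s ∙ euler I f
  euler-∙ I s f = coeffwise λ n → begin
    coeff (euler I (s ∙ f)) n            ≡⟨ trans (coeff-euler I (s ∙ f) n) (cong (ev (emb n) I ⊗_) (coeff-∙ s f n)) ⟩
    ev (emb n) I ⊗ (s ⊗ coeff f n)       ≡⟨ solve 3 (λ i s f → i :* (s :* f) := s :* (i :* f)) refl (ev (emb n) I) s (coeff f n) ⟩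
    s ⊗ (ev (emb n) I ⊗ coeff f n)       ≡⟨ trans (coeff-∙ s (euler I f) n) (cong (s ⊗_) (coeff-euler I f n)) ⟨
    coeff (s ∙ euler I f) n ∎
    where open ≡-Reasoning

  +ₚ-interchange : ∀ A B C D → (A +ₚ B) +ₚ (C +ₚ D) ≈ (A +ₚ C) +ₚ (B +ₚ D)
  +ₚ-interchange A B C D = coeffwise λ n → begin
    coeff ((A +ₚ B) +ₚ (C +ₚ D)) n                              ≡⟨ trans (coeff-+ (A +ₚ B) (C +ₚ D) n) (cong₂ _⊕_ (coeff-+ A B n) (coeff-+ C D n)) ⟩
    (coeff A n ⊕ coeff B n) ⊕ (coeff C n ⊕ coeff D n)           ≡⟨ solve 4 (λ a b c d → (a :+ b) :+ (c :+ d) := (a :+ c) :+ (b :+ d)) refl (coeff A n) (coeff B n) (coeff C n) (coeff D n) ⟩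
    (coeff A n ⊕ coeff C n) ⊕ (coeff B n ⊕ coeff D n)           ≡⟨ trans (coeff-+ (A +ₚ C) (B +ₚ D) n) (cong₂ _⊕_ (coeff-+ A C n) (coeff-+ B D n)) ⟨
    coeff ((A +ₚ C) +ₚ (B +ₚ D)) n ∎
    where open ≡-Reasoning

  euler-cong : ∀ I {f g} → f ≈ g → euler I f ≈ euler I g
  euler-cong I {f} {g} e = coeffwise λ n → trans (coeff-euler I f n) (trans (cong (ev (emb n) I ⊗_) (at e n)) (sym (coeff-euler I g n)))

  apply-cong : ∀ Is {f g} → f ≈ g → apply Is f ≈ apply Is g
  apply-cong []       e = ≈-refl
  apply-cong (I ∷ Is) e = +ₚ-cong (euler-cong I e) (X·-cong (apply-cong Is e))

  apply-+ : ∀ Is f g → apply Is (f +ₚ g) ≈ apply Is f +ₚ apply Is g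
  apply-+ []       f g = ≈-sym (+ₚ-identityʳ [])
  apply-+ (I ∷ Is) f g = ≈-trans (+ₚ-cong (euler-+ I f g) (≈-trans (X·-cong (apply-+ Is f g)) (X·-+ (apply Is f) (apply Is g))))
    (+ₚ-interchange (euler I f) (euler I g) (X· apply Is f) (X· apply Is g))

  apply-∙ : ∀ Is s f → apply Is (s ∙ f) ≈ s ∙ apply Is f
  apply-∙ []       s f = coeffwise λ n → sym (trans (coeff-∙ s [] n) (⊗-zeroʳ s))
  apply-∙ (I ∷ Is) s f = ≈-trans (+ₚ-cong (euler-∙ I s f) (≈-trans (X·-cong (apply-∙ Is s f)) (X·-∙ s (apply Is f))))
    (≈-sym (∙-distribˡ s (euler I f) (X· apply Is f)))

  apply-DegLt : ∀ Is {f d} → DegLt f (suc d) → DegLt (apply Is f) (length Is + d)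
  apply-DegLt []       h = DegLt-[]
  apply-DegLt (I ∷ Is) {f} {d} h (suc n) (s≤s d≤n) = trans (coeff-apply I Is f (suc n)) (trans (cong₂ _⊕_
    (trans (cong (ev (emb (suc n)) I ⊗_) (h (suc n) (s≤s (ℕ.≤-trans (ℕ.m≤n+m d (length Is)) d≤n)))) (⊗-zeroʳ _))
    (apply-DegLt Is h n d≤n)) (⊕-identityˡ _))

  Vanish-θ : ∀ {α N A} → Vanish α (suc N) A → Vanish α N (θ A)
  Vanish-θ (suc _ v) = Vanish-X· v

  Vanish-euler : ∀ {α N f} I → Vanish α (N + ℕ.pred (length I)) f → Vanish α N (euler I f)
  Vanish-euler               []          v = Vanish-[] _
  Vanish-euler {N = N} {f}   (c ∷ [])    v = Vanish-+ (Vanish-∙ c (Vanish-≤ (ℕ.m≤m+n N 0) v)) (Vanish-[] N)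
  Vanish-euler {α} {N} {f} (c ∷ c′ ∷ I) v = Vanish-+ (Vanish-∙ c (Vanish-≤ (ℕ.m≤m+n N _) v))
    (Vanish-euler (c′ ∷ I) (Vanish-θ (subst (λ m → Vanish α m f) (ℕ.+-suc N (length I)) v)))

  Vanish-apply : ∀ {α N ρ f} Is → All (λ I → length I ≡ suc ρ) Is → Vanish α (N + ρ) f → Vanish α N (apply Is f)
  Vanish-apply []       []       v = Vanish-[] _
  Vanish-apply {α} {N} {ρ} {f} (I ∷ Is) (e ∷ es) v =
    Vanish-+ (Vanish-euler I (subst (λ m → Vanish α (N + ℕ.pred m) f) (sym e) v)) (Vanish-X· (Vanish-apply Is es v))

  -- An operator of order < r is determined by its values on r polynomials of distinct degrees < q.

  ≈∧length⇒≡ : ∀ {A B} → length A ≡ length B → A ≈ B → A ≡ B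
  ≈∧length⇒≡ {[]}    {[]}    _ _ = refl
  ≈∧length⇒≡ {a ∷ A} {b ∷ B} l e = cong₂ _∷_ (at e 0) (≈∧length⇒≡ (ℕ.suc-injective l) (coeffwise λ n → at e (suc n)))

  -ₚ≈[]⇒≈ : ∀ {A B} → A -ₚ B ≈ [] → A ≈ B
  -ₚ≈[]⇒≈ {A} {B} e = coeffwise λ n → x-y≡0⇒x≡y _ _ (trans (sym (coeff-- A B n)) (at e n))

  ⊗-cancelʳ : ∀ {a x y} → a ≢ 0ᴷ → x ⊗ a ≡ y ⊗ a → x ≡ y
  ⊗-cancelʳ {a} {x} {y} a≢0 e = x-y≡0⇒x≡y x y (⊗-cancelˡ-0 a≢0 (begin
    a ⊗ (x ⊕ ⊖ y)         ≡⟨ solve 3 (λ a x y → a :* (x :- y) := x :* a :- y :* a) refl a x y ⟩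
    x ⊗ a ⊕ ⊖ (y ⊗ a)     ≡⟨ cong (λ z → z ⊕ ⊖ (y ⊗ a)) e ⟩
    y ⊗ a ⊕ ⊖ (y ⊗ a)     ≡⟨ ⊖-inverseʳ _ ⟩
    0ᴷ ∎))
    where open ≡-Reasoning

  ⊕-cancelʳ : ∀ {x y z} → x ⊕ z ≡ y ⊕ z → x ≡ y
  ⊕-cancelʳ {x} {y} {z} e = x-y≡0⇒x≡y x y (begin
    x ⊕ ⊖ y                       ≡⟨ solve 3 (λ x y z → x :- y := (x :+ z) :- (y :+ z)) refl x y z ⟩
    (x ⊕ z) ⊕ ⊖ (y ⊕ z)           ≡⟨ cong (λ u → u ⊕ ⊖ (y ⊕ z)) e ⟩
    (y ⊕ z) ⊕ ⊖ (y ⊕ z)           ≡⟨ ⊖-inverseʳ _ ⟩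
    0ᴷ ∎)
    where open ≡-Reasoning

  DistinctDegrees : List Term → Set
  DistinctDegrees ts = Unique (map degree ts) × All (λ t → degree t < q) ts

  emb-degrees-unique : ∀ {ts} → DistinctDegrees ts → Unique (map (emb ∘ degree) ts)
  emb-degrees-unique {[]}     _ = []
  emb-degrees-unique {t ∷ ts} (t∉ ∷ u , t<q ∷ ts<q) = All.map⁺ (distinct (All.map⁻ t∉) ts<q) ∷ emb-degrees-unique (u , ts<q)
    where
    distinct : ∀ {us} → All (λ u → degree t ≢ degree u) us → All (λ u → degree u < q) us → All (λ u → emb (degree t) ≢ emb (degree u)) us
    distinct []       []       = []
    distinct (d ∷ ds) (b ∷ bs) = (λ e → d (emb-injective t<q b e)) ∷ distinct ds bs

  -- Above `degree t` the head contributes nothing, so the coefficients from `degree t` + 1 on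
  -- determine the tail by induction. The coefficient at `degree t` then yields the value of the
  -- head at `emb (degree t)`; these are r distinct points, and the head has r coefficients.
  -- Agreement is assumed only from `degree t` on because lower coefficients of the tail remain
  -- mixed with the head.
  apply-injective : ∀ {r ts} Is Js → DistinctDegrees ts → length ts ≡ r → length Is ≡ length Js →
    All (λ I → length I ≡ r) Is → All (λ J → length J ≡ r) Js →
    All (λ t → ∀ n → degree t ≤ n → coeff (apply Is (vector t)) n ≡ coeff (apply Js (vector t)) n) ts → Is ≡ Js
  apply-injective []       []       _  _ _ _ _ _ = refl
  apply-injective {r} {ts} (I ∷ Is) (J ∷ Js) dd lt l (lI ∷ lIs) (lJ ∷ lJs) agree = cong₂ _∷_ I≡J Is≡Js
    where
    coeff-tail : ∀ I Is t n → degree t ≤ n → coeff (apply (I ∷ Is) (vector t)) (suc n) ≡ coeff (apply Is (vector t)) n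
    coeff-tail I Is t n d≤n = trans (coeff-apply I Is (vector t) (suc n))
      (trans (cong (_⊕ coeff (apply Is (vector t)) n) (trans (cong (ev (emb (suc n)) I ⊗_) (proj₁ (exact t) (suc n) (s≤s d≤n))) (⊗-zeroʳ _))) (⊕-identityˡ _))
    Is≡Js : Is ≡ Js
    Is≡Js = apply-injective Is Js dd lt (ℕ.suc-injective l) lIs lJs
      (All.map (λ {t} a n d≤n → trans (sym (coeff-tail I Is t n d≤n)) (trans (a (suc n) (ℕ.m≤n⇒m≤1+n d≤n)) (coeff-tail J Js t n d≤n))) agree)
    ev-degree : ∀ {t} → coeff (apply (I ∷ Is) (vector t)) (degree t) ≡ coeff (apply (J ∷ Js) (vector t)) (degree t) →
      ev (emb (degree t)) (I -ₚ J) ≡ 0ᴷ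
    ev-degree {t} a = trans (ev-- (emb (degree t)) I J) (trans (cong (λ x → x ⊕ ⊖ ev (emb (degree t)) J) (⊗-cancelʳ (proj₂ (exact t)) (⊕-cancelʳ (begin
      ev (emb d) I ⊗ coeff E d ⊕ coeff (X· apply Is E) d    ≡⟨ coeff-apply I Is E d ⟨
      coeff (apply (I ∷ Is) E) d                            ≡⟨ a ⟩
      coeff (apply (J ∷ Js) E) d                            ≡⟨ coeff-apply J Js E d ⟩
      ev (emb d) J ⊗ coeff E d ⊕ coeff (X· apply Js E) d    ≡⟨ cong (λ Ks → ev (emb d) J ⊗ coeff E d ⊕ coeff (X· apply Ks E) d) Is≡Js ⟨
      ev (emb d) J ⊗ coeff E d ⊕ coeff (X· apply Is E) d ∎)))) (⊖-inverseʳ _))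
      where
      open ≡-Reasoning
      d = degree t
      E = vector t
    I≡J : I ≡ J
    I≡J = ≈∧length⇒≡ (trans lI (sym lJ)) (-ₚ≈[]⇒≈ (tooManyRoots (map (emb ∘ degree) ts) (I -ₚ J) (emb-degrees-unique dd)
      (All.map⁺ (All.map (λ {t} a → ev-degree {t} (a (degree t) ℕ.≤-refl)) agree))
      (DegLt-- {I} {J} (subst (DegLt I) lI (DegLt-length I)) (subst (DegLt J) lJ (DegLt-length J)))
      (ℕ.≤-reflexive (sym (trans (length-map _ ts) lt)))))

  -- Existence of operators by counting

  tabulate-injective : ∀ {A : Set} {n} (f g : Fin n → A) → tabulate f ≡ tabulate g → f ≗ g
  tabulate-injective f g e zero    = proj₁ (∷-injective e)
  tabulate-injective f g e (suc i) = tabulate-injective (f ∘ suc) (g ∘ suc) (proj₂ (∷-injective e)) i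

  funToFin-cong : ∀ {m n} {f g : Fin m → Fin n} → f ≗ g → funToFin f ≡ funToFin g
  funToFin-cong {zero}  e = refl
  funToFin-cong {suc m} e = cong₂ combine (e zero) (funToFin-cong (e ∘ suc))

  finToFun-injective : ∀ {m n} {x y : Fin (m ^ n)} → finToFun {m} {n} x ≗ finToFun y → x ≡ y
  finToFun-injective {m} {n} {x} {y} e = trans (sym (funToFin-finToFin {n} {m} x)) (trans (funToFin-cong e) (funToFin-finToFin {n} {m} y))

  funToFin-injective : ∀ {m n} (f g : Fin m → Fin n) → funToFin f ≡ funToFin g → f ≗ g
  funToFin-injective f g e i = trans (sym (finToFun-funToFin f i)) (trans (cong (λ x → finToFun x i) e) (finToFun-funToFin g i))

  All-lookup⁻ : ∀ {A : Set} {P : A → Set} (xs : List A) → (∀ i → P (lookup xs i)) → All P xs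
  All-lookup⁻ []       h = []
  All-lookup⁻ (x ∷ xs) h = h zero ∷ All-lookup⁻ xs (h ∘ suc)

  record Collision (r a : ℕ) (φs : List (List Poly → K)) : Set where
    field
      Is Js     : List Poly
      length-Is : length Is ≡ a
      length-Js : length Js ≡ a
      orders-Is : All (λ I → length I ≡ r) Is
      orders-Js : All (λ J → length J ≡ r) Js
      distinct  : Is ≢ Js
      agree     : All (λ φ → φ Is ≡ φ Js) φs

  -- Pigeonhole replaces linear algebra: the difference of two colliding operators solves the homogeneous system φ = 0.
  collision : ∀ r a (φs : List (List Poly → K)) → length φs < r * a → Collision r a φs
  collision r a φs m<ra =
    let x , y , x<y , e = pigeonhole q^m<q^ra values in record
    { Is = decode x ; Js = decode y
    ; length-Is = length-tabulate (row x) ; length-Js = length-tabulate (row y)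
    ; orders-Is = All.tabulate⁺ λ i → length-tabulate (finToFun (finToFun x i))
    ; orders-Js = All.tabulate⁺ λ i → length-tabulate (finToFun (finToFun y i))
    ; distinct  = λ dx≡dy → <⇒≢ x<y (finToFun-injective λ i → finToFun-injective (tabulate-injective _ _ (tabulate-injective (row x) (row y) dx≡dy i)))
    ; agree     = All-lookup⁻ φs (funToFin-injective _ _ e)
    }
    where
    row : Fin ((q ^ r) ^ a) → Fin a → Poly
    row x i = tabulate {n = r} (finToFun (finToFun x i))
    decode : Fin ((q ^ r) ^ a) → List Poly
    decode x = tabulate (row x)
    values : Fin ((q ^ r) ^ a) → Fin (q ^ length φs)
    values x = funToFin λ i → lookup φs i (decode x)
    q^m<q^ra : q ^ length φs < (q ^ r) ^ a
    q^m<q^ra = subst (q ^ length φs <_) (sym (ℕ.^-*-assoc q r a)) (ℕ.^-monoʳ-< q (ℕ.nonTrivial⇒n>1 q {{prime⇒nonTrivial q-prime}}) m<ra)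

  tri : ℕ → ℕ
  tri zero    = 0
  tri (suc n) = suc n + tri n

  tri-double : ∀ n → tri n + tri n ≡ n * suc n
  tri-double zero    = refl
  tri-double (suc n) = trans (regroup n (tri n)) (trans (cong (suc n + suc n +_) (tri-double n)) (regroup′ n))
    where
    regroup : ∀ n t → suc n + t + (suc n + t) ≡ suc n + suc n + (t + t)
    regroup = solve-∀
    regroup′ : ∀ n → suc n + suc n + n * suc n ≡ suc n * suc (suc n)
    regroup′ = solve-∀

  hd : List Poly → Poly
  hd []       = []
  hd (I ∷ Is) = I

  tl : List Poly → List Poly
  tl []       = []
  tl (I ∷ Is) = Is

  -- I_a(j) for a + j < ρ: two operators agreeing on these produce the same coefficients below X^ρ.
  lowEquations : ℕ → List (List Poly → K)
  lowEquations zero    = []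
  lowEquations (suc ρ) = applyUpTo (λ j Is → ev (emb j) (hd Is)) (suc ρ) ++ map (_∘ tl) (lowEquations ρ)

  length-lowEquations : ∀ ρ → length (lowEquations ρ) ≡ tri ρ
  length-lowEquations zero    = refl
  length-lowEquations (suc ρ) = trans (length-++ (applyUpTo (λ j Is → ev (emb j) (hd Is)) (suc ρ)))
    (cong₂ _+_ (length-applyUpTo (λ j Is → ev (emb j) (hd Is)) (suc ρ)) (trans (length-map _ (lowEquations ρ)) (length-lowEquations ρ)))

  -- The coefficient of X^n in Σ X^a I_a(θ) f is Σ I_a(n - a) f_(n-a), and for n < ρ all these
  -- points are covered by the equations. They do not involve f, so one set serves every vector to
  -- be killed.
  lowAgreement : ∀ {ρ Is Js} f → length Is ≡ length Js → All (λ φ → φ Is ≡ φ Js) (lowEquations ρ) →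
    ∀ n → n < ρ → coeff (apply Is f) n ≡ coeff (apply Js f) n
  lowAgreement {Is = []} {[]} f l h n n<ρ = refl
  lowAgreement {suc ρ} {I ∷ Is} {J ∷ Js} f l h n n<ρ = begin
    coeff (apply (I ∷ Is) f) n                                ≡⟨ coeff-apply I Is f n ⟩
    ev (emb n) I ⊗ coeff f n ⊕ coeff (X· apply Is f) n        ≡⟨ cong₂ (λ x y → x ⊗ coeff f n ⊕ y) (All.applyUpTo⁻ (λ j Is → ev (emb j) (hd Is)) (suc ρ) (All.++⁻ˡ _ h) n<ρ) (shifted n n<ρ) ⟩
    ev (emb n) J ⊗ coeff f n ⊕ coeff (X· apply Js f) n        ≡⟨ coeff-apply J Js f n ⟨
    coeff (apply (J ∷ Js) f) n ∎
    where
    open ≡-Reasoning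
    shifted : ∀ n → n < suc ρ → coeff (X· apply Is f) n ≡ coeff (X· apply Js f) n
    shifted zero    _         = refl
    shifted (suc n) (s≤s n<ρ) = lowAgreement f (ℕ.suc-injective l) (All.map⁻ (All.++⁻ʳ (applyUpTo (λ j Is → ev (emb j) (hd Is)) (suc ρ)) h)) n n<ρ

  -- With b + ρ powers of X the image of `vector t` has degree < b + ρ + `degree t`. Beyond the ρ
  -- coefficients already handled, b + `degree t` remain.
  highEquations : ℕ → ℕ → List Term → List (List Poly → K)
  highEquations ρ b []       = []
  highEquations ρ b (t ∷ ts) = applyUpTo (λ i Is → coeff (apply Is (vector t)) (ρ + i)) (b + degree t) ++ highEquations ρ b ts

  degreeSum : List Term → ℕ
  degreeSum ts = sum (map degree ts)

  length-highEquations : ∀ ρ b ts → length (highEquations ρ b ts) ≡ length ts * b + degreeSum ts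
  length-highEquations ρ b []       = refl
  length-highEquations ρ b (t ∷ ts) = trans (length-++ (applyUpTo (λ i Is → coeff (apply Is (vector t)) (ρ + i)) (b + degree t)))
    (trans (cong₂ _+_ (length-applyUpTo _ (b + degree t)) (length-highEquations ρ b ts)) (regroup b (degree t) (length ts * b) (degreeSum ts)))
    where
    regroup : ∀ b d x s → b + d + (x + s) ≡ b + x + (d + s)
    regroup = solve-∀

  highAgreement : ∀ {ρ b ts Is Js} → length Is ≡ b + ρ → length Js ≡ b + ρ →
    All (λ φ → φ Is ≡ φ Js) (lowEquations ρ) → All (λ φ → φ Is ≡ φ Js) (highEquations ρ b ts) →
    All (λ t → apply Is (vector t) ≈ apply Js (vector t)) ts
  highAgreement {ts = []} _ _ _ _ = []
  highAgreement {ρ} {b} {t ∷ ts} {Is} {Js} lI lJ low high = coeffwise go ∷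
    highAgreement lI lJ low (All.++⁻ʳ (applyUpTo (λ i Is → coeff (apply Is (vector t)) (ρ + i)) (b + degree t)) high)
    where
    length-split : ∀ {Ks n} → length Ks ≡ b + ρ → b + degree t ≤ n ∸ ρ → ρ ≤ n → length Ks + degree t ≤ n
    length-split {Ks} {n} lK big ρ≤n = begin
      length Ks + degree t    ≡⟨ cong (_+ degree t) lK ⟩
      b + ρ + degree t        ≡⟨ regroup b ρ (degree t) ⟩
      ρ + (b + degree t)      ≤⟨ ℕ.+-monoʳ-≤ ρ big ⟩
      ρ + (n ∸ ρ)             ≡⟨ ℕ.m+[n∸m]≡n ρ≤n ⟩
      n ∎
      where
      open ℕ.≤-Reasoning
      regroup : ∀ b r d → b + r + d ≡ r + (b + d)
      regroup = solve-∀
    go : ∀ n → coeff (apply Is (vector t)) n ≡ coeff (apply Js (vector t)) n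
    go n with n ℕ.<? ρ
    ... | yes n<ρ = lowAgreement (vector t) (trans lI (sym lJ)) low n n<ρ
    ... | no  n≮ρ with (n ∸ ρ) ℕ.<? (b + degree t)
    ...   | yes small = subst (λ m → coeff (apply Is (vector t)) m ≡ coeff (apply Js (vector t)) m) (ℕ.m+[n∸m]≡n (ℕ.≮⇒≥ n≮ρ))
                          (All.applyUpTo⁻ (λ i Is → coeff (apply Is (vector t)) (ρ + i)) (b + degree t) (All.++⁻ˡ _ high) small)
    ...   | no  big   = trans (apply-DegLt Is (proj₁ (exact t)) n (length-split {Is} lI (ℕ.≮⇒≥ big) (ℕ.≮⇒≥ n≮ρ)))
                          (sym (apply-DegLt Js (proj₁ (exact t)) n (length-split {Js} lJ (ℕ.≮⇒≥ big) (ℕ.≮⇒≥ n≮ρ))))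

  -ₚ-self : ∀ {A B} → A ≈ B → A -ₚ B ≈ []
  -ₚ-self {A} {B} e = coeffwise λ n → trans (coeff-- A B n) (trans (cong (λ x → x ⊕ ⊖ coeff B n) (at e n)) (⊖-inverseʳ _))

  -ₚ-interchange : ∀ A B C D → (A +ₚ B) -ₚ (C +ₚ D) ≈ (A -ₚ C) +ₚ (B -ₚ D)
  -ₚ-interchange A B C D = ≈-trans (-ₚ≈ (A +ₚ B) (C +ₚ D)) (≈-trans (+ₚ-cong ≈-refl (∙-distribˡ (⊖ 1ᴷ) C D))
    (≈-trans (+ₚ-interchange A B (⊖ 1ᴷ ∙ C) (⊖ 1ᴷ ∙ D)) (+ₚ-cong (≈-sym (-ₚ≈ A C)) (≈-sym (-ₚ≈ B D)))))

  ∙-distribˡ-- : ∀ s A B → s ∙ A -ₚ s ∙ B ≈ s ∙ (A -ₚ B)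
  ∙-distribˡ-- s A B = ≈-trans (-ₚ≈ (s ∙ A) (s ∙ B)) (≈-trans (+ₚ-cong ≈-refl (≈-trans (≈-sym (∙-assoc (⊖ 1ᴷ) s B))
    (≈-trans (≈-reflexive (cong (_∙ B) (⊗-comm (⊖ 1ᴷ) s))) (∙-assoc s (⊖ 1ᴷ) B)))) (≈-trans (≈-sym (∙-distribˡ s A (⊖ 1ᴷ ∙ B))) (∙-cong s (≈-sym (-ₚ≈ A B)))))

  -- L stands for an operator with b + ρ powers of X and order at most ρ, where ρ is also the number
  -- of vectors killed; the order is what `L-vanish` loses.
  record Annihilator (ρ b : ℕ) (t : Term) (os : List Term) : Set where
    field
      L        : Poly → Poly
      L-cong   : ∀ {f g} → f ≈ g → L f ≈ L g
      L-+      : ∀ f g → L (f +ₚ g) ≈ L f +ₚ L g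
      L-∙      : ∀ s f → L (s ∙ f) ≈ s ∙ L f
      L-vanish : ∀ {α N f} → Vanish α (N + ρ) f → Vanish α N (L f)
      kills    : All (λ o → L (vector o) ≈ []) os
      nonzero  : ¬ L (vector t) ≈ []
      L-degree : DegLt (L (vector t)) (b + ρ + degree t)

    L-[] : L [] ≈ []
    L-[] = ≈-trans (L-cong (≈-sym (∙-0 []))) (≈-trans (L-∙ 0ᴷ []) (∙-0 (L [])))

    L-others : ∀ α {us} → All (λ o → L (vector o) ≈ []) us → L (termsValue α us) ≈ []
    L-others α []              = L-[]
    L-others α {u ∷ us} (k ∷ ks) = ≈-trans (L-+ _ _) (≈-trans (+ₚ-cong (≈-trans (L-∙ (ev α (weight u)) (vector u)) (∙-cong (ev α (weight u)) k)) (L-others α ks))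
      (≈-trans (+ₚ-identityʳ _) (coeffwise λ n → trans (coeff-∙ _ [] n) (⊗-zeroʳ _))))

    -- L maps the whole sum to `ev α (weight t)` times the image of `vector t`; away from the roots
    -- of the weight this scalar can be divided out.
    L-vanish-vector : ∀ {α N} → ev α (weight t) ≢ 0ᴷ → Vanish α (N + ρ) (termsValue α (t ∷ os)) → Vanish α N (L (vector t))
    L-vanish-vector {α} w≢0 v = Vanish-cong (∙-cancel (L (vector t)) (proj₂ (inverse (ev α (weight t)) w≢0)))
      (Vanish-∙ (proj₁ (inverse (ev α (weight t)) w≢0)) (Vanish-cong (≈-trans (L-+ _ _) (≈-trans (+ₚ-cong (L-∙ (ev α (weight t)) (vector t)) (L-others α kills)) (+ₚ-identityʳ _)))
        (L-vanish v)))

  annihilator : ∀ {ρ b} t os → DistinctDegrees (t ∷ os) → length os ≡ ρ →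
    tri ρ + (ρ * b + degreeSum os) < suc ρ * (b + ρ) → Annihilator ρ b t os
  annihilator {ρ} {b} t os dd lo count = record
    { L        = λ f → apply Is f -ₚ apply Js f
    ; L-cong   = λ {f} {g} e → -ₚ-cong (apply-cong Is e) (apply-cong Js e)
    ; L-+      = λ f g → ≈-trans (-ₚ-cong (apply-+ Is f g) (apply-+ Js f g)) (-ₚ-interchange (apply Is f) (apply Is g) (apply Js f) (apply Js g))
    ; L-∙      = λ s f → ≈-trans (-ₚ-cong (apply-∙ Is s f) (apply-∙ Js s f)) (∙-distribˡ-- s (apply Is f) (apply Js f))
    ; L-vanish = λ v → Vanish-- (Vanish-apply Is orders-Is v) (Vanish-apply Js orders-Js v)
    ; kills    = All.map -ₚ-self agree-os
    ; nonzero  = λ e → distinct (apply-injective Is Js dd (cong suc lo) (trans length-Is (sym length-Js)) orders-Is orders-Js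
        (All.map (λ e n _ → at e n) (-ₚ≈[]⇒≈ e ∷ agree-os)))
    ; L-degree = DegLt-- {apply Is (vector t)} (subst (λ m → DegLt (apply Is (vector t)) (m + degree t)) length-Is (apply-DegLt Is (proj₁ (exact t))))
        (subst (λ m → DegLt (apply Js (vector t)) (m + degree t)) length-Js (apply-DegLt Js (proj₁ (exact t))))
    }
    where
    equations = lowEquations ρ ++ highEquations ρ b os
    length-equations : length equations ≡ tri ρ + (ρ * b + degreeSum os)
    length-equations = trans (length-++ (lowEquations ρ)) (cong₂ _+_ (length-lowEquations ρ)
      (trans (length-highEquations ρ b os) (cong (λ m → m * b + degreeSum os) lo)))
    open Collision (collision (suc ρ) (b + ρ) equations (subst (_< suc ρ * (b + ρ)) (sym length-equations) count))
    agree-os : All (λ o → apply Is (vector o) ≈ apply Js (vector o)) os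
    agree-os = highAgreement length-Is length-Js (All.++⁻ˡ (lowEquations ρ) agree) (All.++⁻ʳ (lowEquations ρ) agree)

  -- Counting

  -- The i-th degree is at most d - i, counting from i = 1, and these deficits add up to `tri`.
  -- `degree-count` needs exactly this gain.
  Descending-sum : ∀ {d ts} → Descending d ts → degreeSum ts + tri (length ts) ≤ length ts * d
  Descending-sum []                              = z≤n
  Descending-sum {d} (_∷_ {t = t} {ts} e<d desc) = begin
    degree t + degreeSum ts + (suc (length ts) + tri (length ts))    ≡⟨ regroup (degree t) (degreeSum ts) (length ts) (tri (length ts)) ⟩
    suc (degree t) + (length ts + (degreeSum ts + tri (length ts)))  ≤⟨ ℕ.+-monoʳ-≤ (suc (degree t)) (ℕ.+-monoʳ-≤ (length ts) (Descending-sum desc)) ⟩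
    suc (degree t) + (length ts + length ts * degree t)              ≡⟨ cong (suc (degree t) +_) (ℕ.*-suc (length ts) (degree t)) ⟨
    suc (degree t) + length ts * suc (degree t)                      ≤⟨ ℕ.+-mono-≤ e<d (ℕ.*-monoʳ-≤ (length ts) e<d) ⟩
    d + length ts * d ∎
    where
    open ℕ.≤-Reasoning
    regroup : ∀ e s l t → e + s + (suc l + t) ≡ suc e + (l + (s + t))
    regroup = solve-∀

  below : ∀ {d ts} → Descending d ts → All (λ t → degree t < d) ts
  below []         = []
  below (h ∷ desc) = h ∷ All.map (λ k → ℕ.<-trans k h) (below desc)

  Descending-distinct : ∀ {d ts} → d ≤ q → Descending d ts → DistinctDegrees ts
  Descending-distinct d≤q [] = [] , []
  Descending-distinct {d} d≤q (_∷_ {t = t} {ts} e<d desc) =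
    let u , b = Descending-distinct (ℕ.≤-trans (ℕ.<⇒≤ e<d) d≤q) desc
    in All.map⁺ (All.map (λ o<e e≡o → ℕ.<⇒≢ o<e (sym e≡o)) (below desc)) ∷ u , ℕ.<-≤-trans e<d d≤q ∷ b

  DistinctDegrees-↭ : ∀ {ts us} → ts ↭ us → DistinctDegrees ts → DistinctDegrees us
  DistinctDegrees-↭ r (u , b) = Permutation.Unique-resp-↭ (setoid ℕ) (↭⇒↭ₛ (↭-map⁺ degree r)) u , All-resp-↭ r b

  -- With b = (S ∸ tri ρ) + 1 there are more unknowns (right) than equations (left).
  equation-count : ∀ ρ S → tri ρ + (ρ * suc (S ∸ tri ρ) + S) < suc ρ * (suc (S ∸ tri ρ) + ρ)
  equation-count ρ S = begin-strict
    tri ρ + (ρ * suc s + S)                   ≤⟨ ℕ.+-monoʳ-≤ (tri ρ) (ℕ.+-monoʳ-≤ (ρ * suc s) (ℕ.m≤n+m∸n S (tri ρ))) ⟩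
    tri ρ + (ρ * suc s + (tri ρ + s))         ≡⟨ regroup (tri ρ) (ρ * suc s) s ⟩
    ρ * suc s + s + (tri ρ + tri ρ)           ≡⟨ cong (ρ * suc s + s +_) (tri-double ρ) ⟩
    ρ * suc s + s + ρ * suc ρ                 <⟨ ℕ.n<1+n _ ⟩
    suc (ρ * suc s + s + ρ * suc ρ)           ≡⟨ regroup′ ρ s ⟩
    suc ρ * (suc s + ρ) ∎
    where
    open ℕ.≤-Reasoning
    s = S ∸ tri ρ
    regroup : ∀ t x s → t + (x + (t + s)) ≡ x + s + (t + t)
    regroup = solve-∀
    regroup′ : ∀ r s → suc (r * suc s + s + r * suc r) ≡ suc r * (suc s + r)
    regroup′ = solve-∀

  -- Here D = k + c − 1 with c = c′ + 1, and r = ρ + 1 ≤ c < k.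
  degree-count : ∀ {ρ c′ k e S} → ρ ≤ c′ → suc c′ < k → e < k + c′ → e + S + tri (suc ρ) ≤ suc ρ * (k + c′) →
    S ∸ tri ρ + ρ + e ≤ suc c′ * k
  degree-count {ρ} {c′} {k} {e} {S} ρ≤c′ c<k e<D sum≤ with ℕ.≤-total S (tri ρ)
  -- The truncated difference is 0 here; ρ + e is at most k + 2 c′, and 2 ≤ k suffices.
  ... | inj₁ S≤tri = begin
    S ∸ tri ρ + ρ + e         ≡⟨ cong (λ s → s + ρ + e) (ℕ.m≤n⇒m∸n≡0 S≤tri) ⟩
    ρ + e                     ≤⟨ ℕ.+-mono-≤ ρ≤c′ (ℕ.<⇒≤ e<D) ⟩
    c′ + (k + c′)             ≡⟨ regroup c′ k ⟩
    k + c′ * 2                ≤⟨ ℕ.+-monoʳ-≤ k (ℕ.*-monoʳ-≤ c′ (ℕ.≤-trans (s≤s (s≤s z≤n)) c<k)) ⟩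
    k + c′ * k ∎
    where
    open ℕ.≤-Reasoning
    regroup : ∀ c k → c + (k + c) ≡ k + c * 2
    regroup = solve-∀
  -- The added ρ (ρ + 1) + 1 is twice `tri ρ` plus 1: one copy restores S from the difference, and
  -- the rest completes `tri (suc ρ)`, so that `sum≤` applies. The surplus (ρ + 1)(c′ - ρ) is at
  -- most k (c′ - ρ), which supplies the c′ - ρ copies of k still missing from c k.
  ... | inj₂ tri≤S = ℕ.+-cancelʳ-≤ (ρ * suc ρ + 1) _ _ (begin
    s + ρ + e + (ρ * suc ρ + 1)                   ≡⟨ cong (λ x → s + ρ + e + (x + 1)) (tri-double ρ) ⟨
    s + ρ + e + (tri ρ + tri ρ + 1)               ≡⟨ regroup s ρ e (tri ρ) ⟩
    e + (tri ρ + s) + tri (suc ρ)                 ≡⟨ cong (λ x → e + x + tri (suc ρ)) (ℕ.m+[n∸m]≡n tri≤S) ⟩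
    e + S + tri (suc ρ)                           ≤⟨ sum≤ ⟩
    suc ρ * (k + c′)                              ≡⟨ cong (λ x → suc ρ * (k + x)) (ℕ.m+[n∸m]≡n ρ≤c′) ⟨
    suc ρ * (k + (ρ + u))                         ≡⟨ regroup₁ ρ k u ⟩
    suc ρ * k + suc ρ * u + ρ * suc ρ             ≤⟨ ℕ.+-monoˡ-≤ (ρ * suc ρ) (ℕ.+-monoʳ-≤ (suc ρ * k) (ℕ.*-monoˡ-≤ u (ℕ.≤-trans (s≤s ρ≤c′) (ℕ.<⇒≤ c<k)))) ⟩
    suc ρ * k + k * u + ρ * suc ρ                 ≡⟨ regroup₂ ρ k u ⟩
    suc (ρ + u) * k + ρ * suc ρ                   ≡⟨ cong (λ x → suc x * k + ρ * suc ρ) (ℕ.m+[n∸m]≡n ρ≤c′) ⟩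
    suc c′ * k + ρ * suc ρ                        ≤⟨ ℕ.+-monoʳ-≤ (suc c′ * k) (ℕ.m≤m+n (ρ * suc ρ) 1) ⟩
    suc c′ * k + (ρ * suc ρ + 1) ∎)
    where
    open ℕ.≤-Reasoning
    s = S ∸ tri ρ
    u = c′ ∸ ρ
    regroup : ∀ s r e t → s + r + e + (t + t + 1) ≡ e + (t + s) + (suc r + t)
    regroup = solve-∀
    regroup₁ : ∀ r k u → suc r * (k + (r + u)) ≡ suc r * k + suc r * u + r * suc r
    regroup₁ = solve-∀
    regroup₂ : ∀ r k u → suc r * k + k * u + r * suc r ≡ suc (r + u) * k + r * suc r
    regroup₂ = solve-∀

  -- Isolating one term

  ≈[]? : ∀ A → Dec (A ≈ [])
  ≈[]? []      = yes ≈-refl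
  ≈[]? (a ∷ A) with a ≟ 0ᴷ | ≈[]? A
  ... | yes a≡0 | yes A≈[] = yes (coeffwise λ { zero → a≡0 ; (suc n) → at A≈[] n })
  ... | no  a≢0 | _        = no λ e → a≢0 (at e 0)
  ... | yes _   | no  A≉[] = no λ e → A≉[] (coeffwise λ n → at e (suc n))

  -- The term to be isolated needs a nonzero weight, since only such a weight has fewer than c
  -- roots. It may stand anywhere in the list, hence the permutation.
  selectNonzero : ∀ ts → All (λ t → weight t ≈ []) ts ⊎ ∃₂ λ t os → ts ↭ t ∷ os × ¬ weight t ≈ []
  selectNonzero [] = inj₁ []
  selectNonzero (t ∷ ts) with ≈[]? (weight t) | selectNonzero ts
  ... | no  w≉[] | _                          = inj₂ (t , ts , refl , w≉[])
  ... | yes w≈[] | inj₁ zeros                 = inj₁ (w≈[] ∷ zeros)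
  ... | yes _    | inj₂ (u , os , ts↭ , w≉[]) = inj₂ (u , t ∷ os , ↭-step (prep t ts↭) (swap t u refl) , w≉[])

  length-filter-split : ∀ {A : Set} {P : A → Set} (P? : ∀ x → Dec (P x)) xs → length (filter P? xs) + length (filter (¬? ∘ P?) xs) ≡ length xs
  length-filter-split P? []       = refl
  length-filter-split P? (x ∷ xs) with P? x
  ... | yes _ = cong suc (length-filter-split P? xs)
  ... | no  _ = trans (ℕ.+-suc _ _) (cong suc (length-filter-split P? xs))

  -- The roots of the weight of t are exceptional; every other α is a zero of order M − ρ of L applied to the vector of t.
  term-bound : ∀ {c′ k M} t os xs → length os ≤ c′ → suc c′ < k → k + c′ ≤ q → suc c′ < M → M ≤ q → DistinctDegrees (t ∷ os) →
    degreeSum (t ∷ os) + tri (length (t ∷ os)) ≤ length (t ∷ os) * (k + c′) → degree t < k + c′ →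
    DegLt (weight t) (suc c′) → ¬ weight t ≈ [] → Unique xs → All (λ α → Vanish α M (termsValue α (t ∷ os))) xs →
    length xs * suc (M ∸ suc c′) ≤ suc c′ * k + suc c′ * suc (M ∸ suc c′)
  term-bound {c′} {k} {M} t os xs ρ≤c′ c<k D≤q c<M M≤q dd sum≤ e<D w-degree w≉[] unique zeros = begin
    length xs * N                          ≡⟨ cong (_* N) (length-filter-split root? xs) ⟨
    (length bad + length good) * N         ≡⟨ ℕ.*-distribʳ-+ N (length bad) (length good) ⟩
    length bad * N + length good * N       ≤⟨ ℕ.+-mono-≤ (ℕ.*-monoˡ-≤ N (ℕ.<⇒≤ bad<c)) (ℕ.*-monoʳ-≤ (length good) N≤M∸ρ) ⟩
    -- The 1 in b = (S ∸ tri ρ) + 1 is regained from the strictness of `good<`.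
    suc c′ * N + length good * (M ∸ ρ)     ≤⟨ ℕ.+-monoʳ-≤ (suc c′ * N) (ℕ.≤-trans (ℕ.≤-pred good<) (degree-count ρ≤c′ c<k e<D sum≤)) ⟩
    suc c′ * N + suc c′ * k                ≡⟨ ℕ.+-comm (suc c′ * N) (suc c′ * k) ⟩
    suc c′ * k + suc c′ * N ∎
    where
    open ℕ.≤-Reasoning
    ρ = length os
    N = suc (M ∸ suc c′)
    root? : ∀ α → Dec (ev α (weight t) ≡ 0ᴷ)
    root? α = ev α (weight t) ≟ 0ᴷ
    bad = filter root? xs
    good = filter (¬? ∘ root?) xs
    ρ<M : ρ < M
    ρ<M = ℕ.≤-<-trans ρ≤c′ (ℕ.<-trans (ℕ.n<1+n c′) c<M)
    N≤M∸ρ : N ≤ M ∸ ρ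
    N≤M∸ρ = ℕ.∸-monoʳ-< (s≤s ρ≤c′) (ℕ.<⇒≤ c<M)
    bad<c : length bad < suc c′
    bad<c = ℕ.≰⇒> λ c≤bad → w≉[] (tooManyRoots bad (weight t) (Unique.filter⁺ root? unique) (All.all-filter root? xs) w-degree c≤bad)
    open Annihilator (annihilator {ρ} {suc (degreeSum os ∸ tri ρ)} t os dd refl (equation-count ρ (degreeSum os)))
    good-zeros : All (λ α → Vanish α (M ∸ ρ) (L (vector t))) good
    good-zeros = All.zipWith (λ {α} (w≢0 , v) → L-vanish-vector w≢0 (subst (λ m → Vanish α m (termsValue α (t ∷ os))) (sym (ℕ.m∸n+n≡m (ℕ.<⇒≤ ρ<M))) v))
      (All.all-filter (¬? ∘ root?) xs , All.filter⁺ (¬? ∘ root?) zeros)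
    good< : length good * (M ∸ ρ) < suc (degreeSum os ∸ tri ρ) + ρ + degree t
    good< = ℕ.≰⇒> λ d≤ → nonzero (tooManyZeros good (L (vector t)) (ℕ.≤-trans (ℕ.m∸n≤m M ρ) M≤q) (Unique.filter⁺ (¬? ∘ root?) unique) good-zeros L-degree d≤)

  ∂^-[] : ∀ ℓ → ∂^ ℓ [] ≡ []
  ∂^-[] zero    = refl
  ∂^-[] (suc ℓ) = ∂^-[] ℓ

  termsValue-[] : ∀ {α ts} → All (λ t → weight t ≈ []) ts → termsValue α ts ≈ []
  termsValue-[]              []       = ≈-refl
  termsValue-[] {α} {t ∷ ts} (w ∷ ws) = ≈-trans (+ₚ-cong (≈-trans (≈-reflexive (cong (_∙ vector t) (ev-[] {A = weight t} w))) (∙-0 (vector t))) (termsValue-[] ws)) (+ₚ-identityʳ [])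

  -- The two bounds for a list of zeros

  module _ {A : Poly} {c k M : ℕ} (c<M : c < M) (M<q : M < q) (A≉[] : ¬ A ≈ []) (A-degree : DegLt A (c * q)) (pdeg : Defs.PdegLt q A k)
           (xs : List K) (unique : Unique xs) (zeros : All (λ α → Vanish α M A) xs) where

    private
      c≤q : c ≤ q
      c≤q = ℕ.<⇒≤ (ℕ.<-trans c<M M<q)
      digits<k : ∀ j → DegLt (digits A j) k
      digits<k = digits-DegLt-pdeg {A} c≤q A-degree pdeg
      N : ℕ
      N = suc (M ∸ c)
      N≤M : 0 < c → N ≤ M
      N≤M 0<c = ℕ.∸-monoʳ-< 0<c (ℕ.<⇒≤ c<M)

    zeros<k : length xs < k
    zeros<k = ℕ.≰⇒> λ k≤xs → A≉[] (digits-zeros {A} xs unique c≤q A-degree digits<k k≤xs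
      λ ℓ ℓ<c → All.map (λ v → Vanish⇒ev-δ^ {A} v ℓ (ℕ.<-trans ℓ<c c<M)) zeros)

    -- Let y be the number of zeros beyond c. Counting with multiplicity, y M + c M < c q ≤ c k + c
    -- c. As c < M this leaves y M ≤ c k, and M - c + 1 ≤ M.
    large-pdeg-bound : 0 < c → q ≤ k + c → length xs * N ≤ c * k + c * N
    large-pdeg-bound 0<c q≤k+c with ℕ.≤-total (length xs) c
    ... | inj₁ xs≤c = ℕ.≤-trans (ℕ.*-monoˡ-≤ N xs≤c) (ℕ.m≤n+m (c * N) (c * k))
    ... | inj₂ c≤xs = begin
      length xs * N          ≡⟨ cong (_* N) (ℕ.m∸n+n≡m c≤xs) ⟨
      (y + c) * N            ≡⟨ ℕ.*-distribʳ-+ N y c ⟩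
      y * N + c * N          ≤⟨ ℕ.+-monoˡ-≤ (c * N) (ℕ.≤-trans (ℕ.*-monoʳ-≤ y (N≤M 0<c)) yM≤ck) ⟩
      c * k + c * N ∎
      where
      open ℕ.≤-Reasoning
      y = length xs ∸ c
      xsM<cq : length xs * M < c * q
      xsM<cq = ℕ.≰⇒> λ cq≤ → A≉[] (tooManyZeros xs A (ℕ.<⇒≤ M<q) unique zeros A-degree cq≤)
      yM≤ck : y * M ≤ c * k
      yM≤ck = ℕ.+-cancelʳ-≤ (c * M) _ _ (begin
        y * M + c * M        ≡⟨ ℕ.*-distribʳ-+ M y c ⟨
        (y + c) * M          ≡⟨ cong (_* M) (ℕ.m∸n+n≡m c≤xs) ⟩
        length xs * M        ≤⟨ ℕ.<⇒≤ xsM<cq ⟩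
        c * q                ≤⟨ ℕ.*-monoʳ-≤ c q≤k+c ⟩
        c * (k + c)          ≡⟨ ℕ.*-distribˡ-+ c k c ⟩
        c * k + c * c        ≤⟨ ℕ.+-monoʳ-≤ (c * k) (ℕ.*-monoʳ-≤ c (ℕ.<⇒≤ c<M)) ⟩
        c * k + c * M ∎)

    private
      Bs : List Poly
      Bs = expand c (digits A)

      chain : ∀ α → Chain (scalar-constant α) (digits A) (tails α c (digits A))
      chain α = tails-chain α c (digits A) (digits-[] {A} c A-degree)

      horner-ev : ∀ α ℓ → ev α (∂^ ℓ (horner α Bs)) ≡ ev α (δ^ ℓ (digits A) 0)
      horner-ev α ℓ = chain-ev (scalar-constant α) (ev-α-X α) (chain α) ℓ

      horner-vanish : ∀ {α} → Vanish α M A → Vanish α M (horner α Bs)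
      horner-vanish {α} v = ev⇒Vanish M λ ℓ ℓ<M → trans (horner-ev α ℓ) (Vanish⇒ev-δ^ {A} v ℓ ℓ<M)

      -- If all of them were zero, each `δ^ ℓ (digits A) 0` would vanish on the whole of F_q, that
      -- is, at q ≥ k points. A single one can be zero, as for C_0 = X - α and C_1 = 1, so the claim
      -- concerns the family.
      horner-nonzero : k ≤ q → ¬ (∀ α → horner α Bs ≈ [])
      horner-nonzero k≤q h = A≉[] (digits-zeros {A} (allFin q) (Unique.allFin⁺ q) c≤q A-degree digits<k
        (ℕ.≤-trans k≤q (ℕ.≤-reflexive (sym (length-tabulate id))))
        λ ℓ _ → All.tabulate λ {α} _ → trans (sym (horner-ev α ℓ)) (trans (ev-cong (∂^-cong ℓ (h α))) (cong (ev α) (∂^-[] ℓ))))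

    small-pdeg-bound : ∀ {c′} → c ≡ suc c′ → c < k → k + c′ ≤ q → length xs * N ≤ c * k + c * N
    small-pdeg-bound {c′} refl c<k D≤q = bound (selectNonzero terms)
      where
      ts = toTensor Bs
      bounded : All (Bounded c (k + c′)) ts
      bounded = subst (λ n → All (Bounded n (k + c′)) ts) (length-expand c (digits A)) (toTensor-Bounded (expand-DegLt c′ (digits A) digits<k))
      open Echelon (echelon (k + c′) ts bounded)
      value-terms : ∀ α → horner α Bs ≈ termsValue α terms
      value-terms α = ≈-trans (≈-sym (value-toTensor α Bs)) (terms-value α)
      terms≤c : length terms ≤ c
      terms≤c = ℕ.≤-trans terms-length (ℕ.≤-reflexive (trans (length-toTensor Bs) (length-expand c (digits A))))
      bound : All (λ t → weight t ≈ []) terms ⊎ (∃₂ λ t os → terms ↭ t ∷ os × ¬ weight t ≈ []) → length xs * N ≤ c * k + c * N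
      bound (inj₁ all-zero) = contradiction (λ α → ≈-trans (value-terms α) (termsValue-[] all-zero))
        (horner-nonzero (ℕ.≤-trans (ℕ.m≤m+n k c′) D≤q))
      bound (inj₂ (t , os , terms↭ , w≉[])) = term-bound t os xs
        (ℕ.≤-pred (subst (_≤ c) (↭-length terms↭) terms≤c)) c<k D≤q c<M (ℕ.<⇒≤ M<q)
        (DistinctDegrees-↭ terms↭ (Descending-distinct D≤q descending))
        (subst₂ (λ s l → s + tri l ≤ l * (k + c′)) (sum-↭ (↭-map⁺ degree terms↭)) (↭-length terms↭) (Descending-sum descending))
        (All.head (All-resp-↭ terms↭ (below descending)))
        (All.head (All-resp-↭ terms↭ weights)) w≉[] unique
        (All.map (λ {α} v → Vanish-cong (≈-trans (value-terms α) (termsValue-↭ terms↭)) (horner-vanish v)) zeros)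

    zeros-bound : 0 < c → length xs * N ≤ c * k + c * N
    zeros-bound 0<c with c ℕ.<? k | (k + ℕ.pred c) ℕ.≤? q
    ... | no  c≮k | _       = ℕ.≤-trans (ℕ.*-monoˡ-≤ N (ℕ.≤-trans (ℕ.<⇒≤ zeros<k) (ℕ.≮⇒≥ c≮k))) (ℕ.m≤n+m (c * N) (c * k))
    ... | yes c<k | yes D≤q = small-pdeg-bound (sym (ℕ.suc-pred c {{ℕ.>-nonZero 0<c}})) c<k D≤q
    ... | yes c<k | no  D≰q = large-pdeg-bound 0<c (ℕ.≤-trans (ℕ.<⇒≤ (ℕ.≰⇒> D≰q)) (ℕ.+-monoʳ-≤ k (ℕ.pred[n]≤n {c})))

open import Defs
open import Data.Nat using (ℕ; suc; _*_; _∸_; _<_; NonZero)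
open import Data.Nat.Primality using (Prime)
open import Data.Fin.Subset using (Subset; _∈_; ∣_∣)
open import Data.Integer using (+_)
open import Data.Rational using (ℚ; _/_; _+_; _⊓_; _≤_)
import Data.Rational as ℚ

open import Data.Empty using (⊥)
open import Data.Fin using (Fin; zero; suc)
open import Data.Fin.Properties using (suc-injective)
open import Data.Fin.Subset using (inside; outside)
import Data.Integer as ℤ
import Data.Integer.Properties as ℤ
open import Data.List.Base as List using (List; []; _∷_)
open import Data.List.Properties using (length-map)
open import Data.List.Relation.Unary.All as All using (All; []; _∷_)
import Data.List.Relation.Unary.All.Properties as All
open import Data.List.Relation.Unary.AllPairs using ([]; _∷_)
open import Data.List.Relation.Unary.Unique.Propositional using (Unique)
import Data.List.Relation.Unary.Unique.Propositional.Properties as Unique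
import Data.Nat as ℕ
import Data.Nat.Properties as ℕ
open import Data.Product.Base using (_,_)
import Data.Rational.Properties as ℚ
import Data.Rational.Unnormalised as ℚᵘ
import Data.Rational.Unnormalised.Properties as ℚᵘ
open import Data.Vec.Base using ([]; _∷_; here; there)
open import Relation.Binary.PropositionalEquality

-- Passage to rational numbers

toℚᵘ-/ : ∀ m d → ℚ.toℚᵘ (+ m / suc d) ℚᵘ.≃ ℚᵘ.mkℚᵘ (+ m) d
toℚᵘ-/ m d = ℚ.toℚᵘ-fromℚᵘ (ℚᵘ.mkℚᵘ (+ m) d)

integer-≤ : ∀ {m n} → m ℕ.≤ n → + m / 1 ≤ + n / 1
integer-≤ {m} {n} m≤n = ℚ.toℚᵘ-cancel-≤ (begin
  ℚ.toℚᵘ (+ m / 1)     ≃⟨ toℚᵘ-/ m 0 ⟩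
  ℚᵘ.mkℚᵘ (+ m) 0      ≤⟨ ℚᵘ.*≤* (ℤ.*-monoʳ-≤-nonNeg (+ 1) (ℤ.+≤+ m≤n)) ⟩
  ℚᵘ.mkℚᵘ (+ n) 0      ≃⟨ toℚᵘ-/ n 0 ⟨
  ℚ.toℚᵘ (+ n / 1) ∎)
  where open ℚᵘ.≤-Reasoning

-- Proved for unnormalised rationals, where the order is cross multiplication and the denominators
-- are the plain products (d + 1) · 1 and (d + 1) · 1 · 1.
fraction-≤ : ∀ s c k d → s * suc d ℕ.≤ c * k ℕ.+ c * suc d → + s / 1 ≤ (+ c / suc d) ℚ.* (+ k / 1) + + c / 1
fraction-≤ s c k d h = ℚ.toℚᵘ-cancel-≤ (begin
  ℚ.toℚᵘ (+ s / 1)                                        ≃⟨ toℚᵘ-/ s 0 ⟩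
  ℚᵘ.mkℚᵘ (+ s) 0                                         ≤⟨ ℚᵘ.*≤* (subst₂ ℤ._≤_ lhs rhs (ℤ.+≤+ h)) ⟩
  ℚᵘ.mkℚᵘ (+ c) d ℚᵘ.* ℚᵘ.mkℚᵘ (+ k) 0 ℚᵘ.+ ℚᵘ.mkℚᵘ (+ c) 0   ≃⟨ ℚᵘ.+-cong (ℚᵘ.*-cong (toℚᵘ-/ c d) (toℚᵘ-/ k 0)) (toℚᵘ-/ c 0) ⟨
  ℚ.toℚᵘ (+ c / suc d) ℚᵘ.* ℚ.toℚᵘ (+ k / 1) ℚᵘ.+ ℚ.toℚᵘ (+ c / 1)  ≃⟨ ℚᵘ.+-congˡ (ℚ.toℚᵘ (+ c / 1)) (ℚ.toℚᵘ-homo-* (+ c / suc d) (+ k / 1)) ⟨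
  ℚ.toℚᵘ ((+ c / suc d) ℚ.* (+ k / 1)) ℚᵘ.+ ℚ.toℚᵘ (+ c / 1)  ≃⟨ ℚ.toℚᵘ-homo-+ ((+ c / suc d) ℚ.* (+ k / 1)) (+ c / 1) ⟨
  ℚ.toℚᵘ ((+ c / suc d) ℚ.* (+ k / 1) + + c / 1) ∎)
  where
  open ℚᵘ.≤-Reasoning
  D = suc d * 1
  lhs : + (s * suc d) ≡ + s ℤ.* + (D * 1)
  lhs = trans (ℤ.pos-* s (suc d)) (cong (λ n → + s ℤ.* + n) (sym (trans (ℕ.*-identityʳ D) (ℕ.*-identityʳ (suc d)))))
  rhs : + (c * k ℕ.+ c * suc d) ≡ (+ c ℤ.* + k ℤ.* + 1 ℤ.+ + c ℤ.* + D) ℤ.* + 1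
  rhs = trans (cong₂ ℤ._+_ (trans (ℤ.pos-* c k) (sym (ℤ.*-identityʳ _))) (trans (ℤ.pos-* c (suc d)) (cong (λ n → + c ℤ.* + n) (sym (ℕ.*-identityʳ (suc d)))))) (sym (ℤ.*-identityʳ _))

-- Subsets as lists without repetition

elements : ∀ {n} → Subset n → List (Fin n)
elements []            = []
elements (inside  ∷ S) = zero ∷ List.map suc (elements S)
elements (outside ∷ S) = List.map suc (elements S)

length-elements : ∀ {n} (S : Subset n) → List.length (elements S) ≡ ∣ S ∣
length-elements []            = refl
length-elements (inside  ∷ S) = cong suc (trans (length-map suc (elements S)) (length-elements S))
length-elements (outside ∷ S) = trans (length-map suc (elements S)) (length-elements S)

elements-∈ : ∀ {n} (S : Subset n) → All (_∈ S) (elements S)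
elements-∈ []            = []
elements-∈ (inside  ∷ S) = here ∷ All.map⁺ (All.map there (elements-∈ S))
elements-∈ (outside ∷ S) = All.map⁺ (All.map there (elements-∈ S))

elements-unique : ∀ {n} (S : Subset n) → Unique (elements S)
elements-unique []            = []
elements-unique (inside  ∷ S) = All.map⁺ (All.tabulate λ _ ()) ∷ Unique.map⁺ suc-injective (elements-unique S)
elements-unique (outside ∷ S) = Unique.map⁺ suc-injective (elements-unique S)

theorem5p4 : (q : ℕ) .{{_ : NonZero q}} → Prime q →
    (c k M : ℕ) → 0 < c → 0 < k → c < M → M < q →
    (A : Poly q) → NonZeroP q A → DegLt q A (c * q) → PdegLt q A k →
    (S : Subset q) → (∀ α → α ∈ S → MultGe q A α M) →
    (+ ∣ S ∣ / 1) ≤ ((((+ c) / suc (M ∸ c)) ℚ.* ((+ k) / 1)) + ((+ c) / 1)) ⊓ ((+ k) / 1)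
theorem5p4 q q-prime c k M 0<c 0<k c<M M<q A (n , aₙ≢0) A-degree pdeg S mult = ℚ.⊓-glb
  (fraction-≤ ∣ S ∣ c k (M ∸ c) (subst (λ s → s * suc (M ∸ c) ℕ.≤ c * k ℕ.+ c * suc (M ∸ c)) (length-elements S)
    (zeros-bound c<M M<q A≉[] A-degree pdeg (elements S) (elements-unique S) zeros 0<c)))
  (integer-≤ (subst (ℕ._≤ k) (length-elements S)
    (ℕ.<⇒≤ (zeros<k c<M M<q A≉[] A-degree pdeg (elements S) (elements-unique S) zeros))))
  where
  open HighMultiplicityZeros q q-prime using (_≈_; at; Vanish; MultGe⇒Vanish; zeros-bound; zeros<k)
  A≉[] : A ≈ [] → ⊥
  A≉[] A≈[] = aₙ≢0 (at A≈[] n)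
  zeros : All (λ α → Vanish α M A) (elements S)
  zeros = All.map (λ α∈S → MultGe⇒Vanish (mult _ α∈S)) (elements-∈ S)
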